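{- For a real number $\lambda\ge 0$ define $$S_\lambda=\sum_{n\ge 0}\frac{[n^\lambda]}{n!}.$$ Then the set $\{1,e\}\cup\{S_\lambda:\lambda\in(0,\infty)\setminus\mathbb{Z}\}$ is linearly independent over $\mathbb{Q}$; that is, the real numbers $1$, $e$, and $S_\lambda$ (with $\lambda$ ranging over all positive non-integral real numbers, distinct $\lambda$ giving distinct members of the family) are $\mathbb{Q}$-linearly independent.
   Context: $[x]$ denotes the integer part (floor) of the real number $x$, and $e=\sum_{n\ge0}1/n!$. Only values $S_\lambda$ with $\lambda>0$ enter the conclusion, and for these $0^\lambda=0$, so the $n=0$ term is $0$. -}

module Defs where

open import Algebra.Bundles using (CommutativeRing)
import Algebra.Properties.Semiring.Exp as Exp
open import Axiom.ExcludedMiddle using (ExcludedMiddle)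
open import Data.Empty using (⊥; ⊥-elim)
open import Data.Fin.Base using (Fin)
open import Data.Integer.Base as ℤ using (ℤ; +_; -[1+_])
import Data.Integer.Properties as ℤₚ
open import Data.Nat.Base as ℕ using (ℕ; zero; suc; _!)
import Data.Nat.Properties as ℕₚ
import Data.Nat.Solver as ℕ-Solver
open import Data.Product.Base using (Σ; ∃; ∃-syntax; _×_; _,_; proj₁; proj₂)
open import Data.Rational.Base as ℚ hiding (floor)
import Data.Rational.Properties as ℚₚ
open import Data.Rational.Solver using (module +-*-Solver)
import Data.Rational.Unnormalised.Base as ℚᵘ
import Data.Rational.Unnormalised.Properties as ℚᵘₚ
open import Data.Sum.Base using (_⊎_; inj₁; inj₂)
open import Data.Vec.Functional using (foldr)
open import Function.Definitions using (Injective)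
open import Level using (0ℓ)
open import Relation.Binary.Core using (Rel)
open import Relation.Binary.PropositionalEquality hiding (J)
open import Relation.Nullary using (¬_; Dec; yes; no; contradiction)

open Exp (CommutativeRing.semiring ℚₚ.+-*-commutativeRing) using (_^_; ^-assocʳ)

ι : ℤ → ℚ
ι z = z / 1

nat : ℕ → ℚ
nat n = ι (+ n)

unit : ℕ → ℚ
unit k = + 1 / suc k

module ℚ-Lemmas where

  open +-*-Solver using (solve; _:+_; _:*_; :-_; _:-_; con; _:=_)

  abstract
    ≤-gap : ∀ {a b} d → 0ℚ ≤ d → a + d ≡ b → a ≤ b
    ≤-gap {a} d 0≤d refl = subst (_≤ a + d) (ℚₚ.+-identityʳ a) (ℚₚ.+-monoʳ-≤ a 0≤d)

    <-gap : ∀ {a b} d → 0ℚ < d → a + d ≡ b → a < b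
    <-gap {a} d 0<d refl = subst (_< a + d) (ℚₚ.+-identityʳ a) (ℚₚ.+-monoʳ-< a 0<d)

    0<b-a : ∀ {a b} → a < b → 0ℚ < b - a
    0<b-a {a} {b} a<b = subst (_< b - a) (ℚₚ.+-inverseʳ a) (ℚₚ.+-monoˡ-< (- a) a<b)

    0≤b-a : ∀ {a b} → a ≤ b → 0ℚ ≤ b - a
    0≤b-a {a} {b} a≤b = subst (_≤ b - a) (ℚₚ.+-inverseʳ a) (ℚₚ.+-monoˡ-≤ (- a) a≤b)

    a+[b-a] : ∀ a b → a + (b - a) ≡ b
    a+[b-a] = solve 2 (λ a b → a :+ (b :- a) := b) refl

    *-pos : ∀ {a b} → 0ℚ < a → 0ℚ < b → 0ℚ < a * b
    *-pos {a} {b} 0<a 0<b =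
      subst (_< a * b) (ℚₚ.*-zeroʳ a) (ℚₚ.*-monoʳ-<-pos a {{positive 0<a}} 0<b)

    *-mono : ∀ {a b c d} → 0ℚ ≤ a → 0ℚ ≤ d → a ≤ b → c ≤ d → a * c ≤ b * d
    *-mono {a} {b} {c} {d} 0≤a 0≤d a≤b c≤d =
      ℚₚ.≤-trans (ℚₚ.*-monoˡ-≤-nonNeg a {{nonNegative 0≤a}} c≤d)
                 (ℚₚ.*-monoʳ-≤-nonNeg d {{nonNegative 0≤d}} a≤b)

    *-nonNeg : ∀ {a b} → 0ℚ ≤ a → 0ℚ ≤ b → 0ℚ ≤ a * b
    *-nonNeg {a} {b} 0≤a 0≤b =
      subst (_≤ a * b) (ℚₚ.*-zeroʳ a) (ℚₚ.*-monoˡ-≤-nonNeg a {{nonNegative 0≤a}} 0≤b)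

    0<½ : 0ℚ < ½
    0<½ = ℚₚ.positive⁻¹ ½

    0<½* : ∀ {ε} → 0ℚ < ε → 0ℚ < ½ * ε
    0<½* = *-pos 0<½

    halves : ∀ ε → ½ * ε + ½ * ε ≡ ε
    halves = solve 1 (λ ε → con ½ :* ε :+ con ½ :* ε := ε) refl

    p≤∣p∣ : ∀ p → p ≤ ∣ p ∣
    p≤∣p∣ p with ℚₚ.≤-total 0ℚ p
    ... | inj₁ 0≤p = ℚₚ.≤-reflexive (sym (ℚₚ.0≤p⇒∣p∣≡p 0≤p))
    ... | inj₂ p≤0 = ℚₚ.≤-trans p≤0 (ℚₚ.0≤∣p∣ p)

    -p≤∣p∣ : ∀ p → - p ≤ ∣ p ∣
    -p≤∣p∣ p = subst (- p ≤_) (ℚₚ.∣-p∣≡∣p∣ p) (p≤∣p∣ (- p))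

    ∣p∣-case : ∀ (Q : ℚ → Set) p → Q p → Q (- p) → Q ∣ p ∣
    ∣p∣-case Q p q q⁻ with ℚₚ.∣p∣≡p∨∣p∣≡-p p
    ... | inj₁ e = subst Q (sym e) q
    ... | inj₂ e = subst Q (sym e) q⁻

    flip-neg : ∀ a b → - (a - b) ≡ b - a
    flip-neg = solve 2 (λ a b → :- (a :- b) := b :- a) refl

    dist< : ∀ {a b ε} → a < b + ε → b < a + ε → ∣ a - b ∣ < ε
    dist< {a} {b} {ε} a<b+ε b<a+ε = ∣p∣-case (_< ε) (a - b) (shift a b a<b+ε)
      (subst (_< ε) (sym (flip-neg a b)) (shift b a b<a+ε))
      where
      shift : ∀ a b → a < b + ε → a - b < ε
      shift a b a<b+ε = subst (a - b <_)
        (solve 2 (λ b ε → (b :+ ε) :- b := ε) refl b ε) (ℚₚ.+-monoˡ-< (- b) a<b+ε)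

    dist-upper : ∀ a b ε → ∣ a - b ∣ < ε → a < b + ε
    dist-upper a b ε d = subst (_< b + ε) (a+[b-a] b a)
      (ℚₚ.+-monoʳ-< b (ℚₚ.≤-<-trans (p≤∣p∣ (a - b)) d))

    dist-lower : ∀ a b ε → ∣ a - b ∣ < ε → b < a + ε
    dist-lower a b ε d = subst (_< a + ε) (a+[b-a] a b)
      (ℚₚ.+-monoʳ-< a (ℚₚ.≤-<-trans (subst (_≤ ∣ a - b ∣) (flip-neg a b) (-p≤∣p∣ (a - b))) d))

    spread : ∀ a a′ b b′ η → a′ < a + η → a + ((η + η) + (η + η)) ≤ b → b < b′ + η →
             a′ + (η + η) ≤ b′
    spread a a′ b b′ η a′<a+η a+4η≤b b<b′+η = ℚₚ.≮⇒≥ λ lt → ℚₚ.<-irrefl refl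
      (ℚₚ.<-trans (ℚₚ.+-monoˡ-< (η + η) a′<a+η)
        (subst (_< a′ + (η + η))
          (solve 2 (λ a η → (a :+ ((η :+ η) :+ (η :+ η))) :- η := (a :+ η) :+ (η :+ η)) refl a η)
          (ℚₚ.≤-<-trans (ℚₚ.+-monoˡ-≤ (- η) a+4η≤b)
            (ℚₚ.<-trans (ℚₚ.+-monoˡ-< (- η) b<b′+η)
              (subst (_< a′ + (η + η)) (solve 2 (λ b η → b := (b :+ η) :- η) refl b′ η) lt)))))

    widen : ∀ a b c ε d → d + d ≡ ε → c ≤ a + d → a + ε ≤ b → c + d ≤ b
    widen a b c _ d refl c≤a+d a+2d≤b = ℚₚ.≤-trans (ℚₚ.+-monoˡ-≤ d c≤a+d)
      (subst (_≤ b) (sym (ℚₚ.+-assoc a d d)) a+2d≤b)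

    double-positive : ∀ {η} → 0ℚ < η → 0ℚ < η + η
    double-positive {η} 0<η = ℚₚ.+-mono-< {0ℚ} {η} {0ℚ} {η} 0<η 0<η

    eighth : ∀ {ε} → 0ℚ < ε → ∃[ η ] 0ℚ < η × ((η + η) + (η + η)) + ((η + η) + (η + η)) ≡ ε
    eighth {ε} 0<ε = ½ * (½ * (½ * ε)) , 0<½* (0<½* (0<½* 0<ε)) ,
      trans (cong (λ a → (a + a) + (a + a)) (halves (½ * (½ * ε))))
        (trans (cong (λ a → a + a) (halves (½ * ε))) (halves ε))

    toℚᵘ-/ : ∀ i n .{{_ : ℕ.NonZero n}} → toℚᵘ (i / n) ℚᵘ.≃ i ℚᵘ./ n
    toℚᵘ-/ i (suc n) = ℚₚ.toℚᵘ-fromℚᵘ (ℚᵘ.mkℚᵘ i n)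

    /-mono-≤ : ∀ i j m n .{{_ : ℕ.NonZero m}} .{{_ : ℕ.NonZero n}} →
               i ℤ.* + n ℤ.≤ j ℤ.* + m → i / m ≤ j / n
    /-mono-≤ i j (suc m) (suc n) le = ℚₚ.toℚᵘ-cancel-≤
      (ℚᵘₚ.≤-trans (ℚᵘₚ.≤-reflexive (toℚᵘ-/ i (suc m)))
      (ℚᵘₚ.≤-trans (ℚᵘ.*≤* le)
                   (ℚᵘₚ.≤-reflexive (ℚᵘₚ.≃-sym (toℚᵘ-/ j (suc n))))))

    /-cancel-≤ : ∀ i j m n .{{_ : ℕ.NonZero m}} .{{_ : ℕ.NonZero n}} →
                 i / m ≤ j / n → i ℤ.* + n ℤ.≤ j ℤ.* + m
    /-cancel-≤ i j (suc m) (suc n) le = ℚᵘₚ.drop-*≤*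
      (ℚᵘₚ.≤-trans (ℚᵘₚ.≤-reflexive (ℚᵘₚ.≃-sym (toℚᵘ-/ i (suc m))))
      (ℚᵘₚ.≤-trans (ℚₚ.toℚᵘ-mono-≤ le)
                   (ℚᵘₚ.≤-reflexive (toℚᵘ-/ j (suc n)))))

    /-*-/ : ∀ i j m n .{{_ : ℕ.NonZero m}} .{{_ : ℕ.NonZero n}} .{{_ : ℕ.NonZero (m ℕ.* n)}} →
            (i / m) * (j / n) ≡ (i ℤ.* j) / (m ℕ.* n)
    /-*-/ i j (suc m) (suc n) = ℚₚ.toℚᵘ-injective
      (ℚᵘₚ.≃-trans (ℚₚ.toℚᵘ-homo-* (i / suc m) (j / suc n))
      (ℚᵘₚ.≃-trans (ℚᵘₚ.*-cong (toℚᵘ-/ i (suc m)) (toℚᵘ-/ j (suc n)))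
                   (ℚᵘₚ.≃-sym (toℚᵘ-/ (i ℤ.* j) (suc m ℕ.* suc n)))))

    ι-+ : ∀ i j → ι i + ι j ≡ ι (i ℤ.+ j)
    ι-+ i j = ℚₚ.toℚᵘ-injective
      (ℚᵘₚ.≃-trans (ℚₚ.toℚᵘ-homo-+ (ι i) (ι j))
      (ℚᵘₚ.≃-trans (ℚᵘₚ.+-cong (toℚᵘ-/ i 1) (toℚᵘ-/ j 1))
      (ℚᵘₚ.≃-trans (ℚᵘₚ.≃-reflexive
                     (cong (λ k → ℚᵘ.mkℚᵘ k 0) (cong₂ ℤ._+_ (ℤₚ.*-identityʳ i) (ℤₚ.*-identityʳ j))))
                   (ℚᵘₚ.≃-sym (toℚᵘ-/ (i ℤ.+ j) 1)))))

    ι-* : ∀ i j → ι i * ι j ≡ ι (i ℤ.* j)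
    ι-* i j = /-*-/ i j 1 1

    ι-mono : ∀ {i j} → i ℤ.≤ j → ι i ≤ ι j
    ι-mono {i} {j} i≤j =
      /-mono-≤ i j 1 1 (subst₂ ℤ._≤_ (sym (ℤₚ.*-identityʳ i)) (sym (ℤₚ.*-identityʳ j)) i≤j)

    ι-cancel : ∀ {i j} → ι i ≤ ι j → i ℤ.≤ j
    ι-cancel {i} {j} le =
      subst₂ ℤ._≤_ (ℤₚ.*-identityʳ i) (ℤₚ.*-identityʳ j) (/-cancel-≤ i j 1 1 le)

    nat-mono : ∀ {m n} → m ℕ.≤ n → nat m ≤ nat n
    nat-mono m≤n = ι-mono (ℤ.+≤+ m≤n)

    0≤nat : ∀ n → 0ℚ ≤ nat n
    0≤nat n = nat-mono {0} {n} ℕ.z≤n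

    natural-bound : ∀ p → ∃[ B ] p ≤ nat B
    natural-bound p@(mkℚ i d _) = ℤ.∣ i ∣ , subst (_≤ nat ℤ.∣ i ∣) (ℚₚ.↥p/↧p≡p p)
      (/-mono-≤ i (+ ℤ.∣ i ∣) (suc d) 1
        (subst (ℤ._≤ + ℤ.∣ i ∣ ℤ.* + suc d) (sym (ℤₚ.*-identityʳ i))
          (ℤₚ.≤-trans (i≤∣i∣ i) (ℤₚ.≤-trans
            (ℤ.+≤+ (ℕₚ.m≤m*n ℤ.∣ i ∣ (suc d)))
            (ℤₚ.≤-reflexive (ℤₚ.pos-* ℤ.∣ i ∣ (suc d)))))))
      where
      i≤∣i∣ : ∀ i → i ℤ.≤ + ℤ.∣ i ∣
      i≤∣i∣ (+ n)    = ℤₚ.≤-refl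
      i≤∣i∣ -[1+ n ] = ℤ.-≤+

    0<unit : ∀ k → 0ℚ < unit k
    0<unit k = ℚₚ.positive⁻¹ (unit k) {{ℚₚ.normalize-pos 1 (suc k)}}

    unit-anti : ∀ {m n} → m ℕ.≤ n → unit n ≤ unit m
    unit-anti {m} {n} m≤n = /-mono-≤ (+ 1) (+ 1) (suc n) (suc m)
      (subst₂ ℤ._≤_ (sym (ℤₚ.*-identityˡ (+ suc m))) (sym (ℤₚ.*-identityˡ (+ suc n)))
        (ℤ.+≤+ (ℕ.s≤s m≤n)))

    cancel-unit : ∀ k ε → nat (suc k) * (unit k * ε) ≡ ε
    cancel-unit k ε = trans (sym (ℚₚ.*-assoc (nat (suc k)) (unit k) ε))
      (trans (cong (_* ε) (trans (/-*-/ (+ suc k) (+ 1) 1 (suc k))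
        (ℚₚ.≤-antisym
          (/-mono-≤ (+ suc k ℤ.* + 1) (+ 1) (1 ℕ.* suc k) 1 (ℤₚ.≤-reflexive eq))
          (/-mono-≤ (+ 1) (+ suc k ℤ.* + 1) 1 (1 ℕ.* suc k) (ℤₚ.≤-reflexive (sym eq))))))
        (ℚₚ.*-identityˡ ε))
      where
      eq : (+ suc k ℤ.* + 1) ℤ.* + 1 ≡ + 1 ℤ.* + (1 ℕ.* suc k)
      eq = trans (ℤₚ.*-identityʳ (+ suc k ℤ.* + 1)) (trans (ℤₚ.*-identityʳ (+ suc k))
        (sym (trans (ℤₚ.*-identityˡ (+ (1 ℕ.* suc k))) (cong +_ (ℕₚ.*-identityˡ (suc k))))))

    archimedean : ∀ {ε} → 0ℚ < ε → ∃[ k ] unit k ≤ ε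
    archimedean {ε@(mkℚ i d _)} 0<ε = d , subst (unit d ≤_) (ℚₚ.↥p/↧p≡p ε)
      (/-mono-≤ (+ 1) i (suc d) (suc d)
        (ℤₚ.*-monoʳ-≤-nonNeg (+ suc d) (1≤ i (positive 0<ε))))
      where
      1≤ : ∀ i → ℤ.Positive i → + 1 ℤ.≤ i
      1≤ (+ suc n) _ = ℤ.+≤+ (ℕ.s≤s ℕ.z≤n)

    ι-neg : ∀ B → ι (ℤ.- + B) ≡ - nat B
    ι-neg zero    = refl
    ι-neg (suc B) = refl

    ι-cancel-< : ∀ {i j} → ι i < ι j → i ℤ.< j
    ι-cancel-< {i} {j} lt = ℤₚ.≰⇒> λ j≤i → ℚₚ.<-irrefl refl (ℚₚ.<-≤-trans lt (ι-mono j≤i))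

    nat-^ : ∀ n k → nat n ^ k ≡ nat (n ℕ.^ k)
    nat-^ n zero    = refl
    nat-^ n (suc k) = trans (cong (nat n *_) (nat-^ n k))
      (trans (ι-* (+ n) (+ (n ℕ.^ k))) (cong ι (sym (ℤₚ.pos-* n (n ℕ.^ k)))))

    ^-nonNeg : ∀ {a} → 0ℚ ≤ a → ∀ k → 0ℚ ≤ a ^ k
    ^-nonNeg 0≤a zero    = ℚₚ.nonNegative⁻¹ 1ℚ
    ^-nonNeg 0≤a (suc k) = *-nonNeg 0≤a (^-nonNeg 0≤a k)

    ^-positive : ∀ {a} → 0ℚ < a → ∀ k → 0ℚ < a ^ k
    ^-positive 0<a zero    = ℚₚ.positive⁻¹ 1ℚ
    ^-positive 0<a (suc k) = *-pos 0<a (^-positive 0<a k)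

    ^-monoˡ-≤ : ∀ {a b} → 0ℚ ≤ a → a ≤ b → ∀ k → a ^ k ≤ b ^ k
    ^-monoˡ-≤ 0≤a a≤b zero    = ℚₚ.≤-refl
    ^-monoˡ-≤ 0≤a a≤b (suc k) =
      *-mono 0≤a (^-nonNeg (ℚₚ.≤-trans 0≤a a≤b) k) a≤b (^-monoˡ-≤ 0≤a a≤b k)

    ^-monoˡ-< : ∀ {a b} → 0ℚ ≤ a → a < b → ∀ k → a ^ suc k < b ^ suc k
    ^-monoˡ-< {a} {b} 0≤a a<b k = ℚₚ.≤-<-trans
      (ℚₚ.*-monoˡ-≤-nonNeg a {{nonNegative 0≤a}} (^-monoˡ-≤ 0≤a (ℚₚ.<⇒≤ a<b) k))
      (ℚₚ.*-monoˡ-<-pos (b ^ k) {{positive (^-positive (ℚₚ.≤-<-trans 0≤a a<b) k)}} a<b)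

    ^-cancelˡ-≤ : ∀ {a b} → 0ℚ ≤ b → ∀ k → a ^ suc k ≤ b ^ suc k → a ≤ b
    ^-cancelˡ-≤ 0≤b k le = ℚₚ.≮⇒≥ λ b<a →
      ℚₚ.<-irrefl refl (ℚₚ.<-≤-trans (^-monoˡ-< 0≤b b<a k) le)

    nat-^-monoʳ-≤ : ∀ n {j k} → j ℕ.≤ k → nat (suc n) ^ j ≤ nat (suc n) ^ k
    nat-^-monoʳ-≤ n {j} {k} j≤k = subst₂ _≤_ (sym (nat-^ (suc n) j)) (sym (nat-^ (suc n) k))
      (nat-mono (ℕₚ.^-monoʳ-≤ (suc n) j≤k))

open ℚ-Lemmas

Cauchy : (ℕ → ℚ) → Set
Cauchy s = ∀ ε → 0ℚ < ε → ∃[ N ] ∀ m n → N ℕ.≤ m → N ℕ.≤ n → ∣ s m - s n ∣ < ε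

-- Cantor's reals: rational Cauchy sequences, compared by _≈_.
record ℝ : Set where
  constructor _,_
  field
    seq    : ℕ → ℚ
    cauchy : Cauchy seq

open ℝ

infix 4 _≈_ _<ᴿ_ _≤ᴿ_

_≈_ : Rel ℝ 0ℓ
x ≈ y = ∀ ε → 0ℚ < ε → ∃[ N ] ∀ n → N ℕ.≤ n → ∣ seq x n - seq y n ∣ < ε

_<ᴿ_ : Rel ℝ 0ℓ
x <ᴿ y = ∃[ ε ] 0ℚ < ε × ∃[ N ] ∀ n → N ℕ.≤ n → seq x n + ε ≤ seq y n

_≤ᴿ_ : Rel ℝ 0ℓ
x ≤ᴿ y = ¬ (y <ᴿ x)

const : ℚ → ℝ
const q = (λ _ → q) , λ ε 0<ε → 0 , λ _ _ _ _ → subst (_< ε) (cong ∣_∣ (sym (ℚₚ.+-inverseʳ q))) 0<ε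

0ᴿ 1ᴿ : ℝ
0ᴿ = const 0ℚ
1ᴿ = const 1ℚ

ℝ⁺ : Set
ℝ⁺ = ∃ (0ᴿ <ᴿ_)

infixl 6 _+ᴿ_
infixl 7 _·_

_+ᴿ_ : ℝ → ℝ → ℝ
x +ᴿ y = (λ n → seq x n + seq y n) , λ ε 0<ε →
  let (M , p) = cauchy x (½ * ε) (0<½* 0<ε)
      (N , q) = cauchy y (½ * ε) (0<½* 0<ε)
  in M ℕ.⊔ N , λ m n M⊔N≤m M⊔N≤n →
     subst₂ _<_ (cong ∣_∣ (regroup (seq x m) (seq x n) (seq y m) (seq y n))) (halves ε)
       (ℚₚ.≤-<-trans (ℚₚ.∣p+q∣≤∣p∣+∣q∣ (seq x m - seq x n) (seq y m - seq y n))
         (ℚₚ.+-mono-<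
           (p m n (ℕₚ.m⊔n≤o⇒m≤o M N M⊔N≤m) (ℕₚ.m⊔n≤o⇒m≤o M N M⊔N≤n))
           (q m n (ℕₚ.m⊔n≤o⇒n≤o M N M⊔N≤m) (ℕₚ.m⊔n≤o⇒n≤o M N M⊔N≤n))))
  where
  open +-*-Solver
  regroup : ∀ a b c d → (a - b) + (c - d) ≡ (a + c) - (b + d)
  regroup = solve 4 (λ a b c d → (a :- b) :+ (c :- d) := (a :+ c) :- (b :+ d)) refl

_·_ : ℚ → ℝ → ℝ
c · x = (λ n → c * seq x n) , λ ε 0<ε →
  let (B , ∣c∣≤B) = natural-bound ∣ c ∣
      (N , p)     = cauchy x (unit B * ε) (*-pos (0<unit B) 0<ε)
  in N , λ m n N≤m N≤n → subst (_< ε) (cong ∣_∣ (factor (seq x m) (seq x n)))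
       (subst (_< ε) (sym (ℚₚ.∣p*q∣≡∣p∣*∣q∣ c (seq x m - seq x n)))
         (ℚₚ.≤-<-trans
           (*-mono (ℚₚ.0≤∣p∣ c) (ℚₚ.0≤∣p∣ _)
             (ℚₚ.≤-trans ∣c∣≤B (nat-mono (ℕₚ.n≤1+n B))) ℚₚ.≤-refl)
           (subst (nat (suc B) * ∣ seq x m - seq x n ∣ <_) (cancel-unit B ε)
             (ℚₚ.*-monoʳ-<-pos (nat (suc B)) {{ℚₚ.normalize-pos (suc B) 1}} (p m n N≤m N≤n)))))
  where
  open +-*-Solver
  factor : ∀ a b → c * (a - b) ≡ c * a - c * b
  factor = solve 3 (λ c a b → c :* (a :- b) := c :* a :- c :* b) refl c

sumᴿ : ∀ {m} → (Fin m → ℝ) → ℝ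
sumᴿ = foldr _+ᴿ_ 0ᴿ

module ℝ-Lemmas where

  abstract
    NearFrom : ℕ → ℚ → ℝ → Set
    NearFrom A η x = ∀ n → A ℕ.≤ n → ∣ seq x n - seq x A ∣ < η

    eventually-near : ∀ x {η} → 0ℚ < η → ∃[ N ] ∀ A → N ℕ.≤ A → NearFrom A η x
    eventually-near x {η} 0<η = proj₁ (cauchy x η 0<η) , λ A N≤A n A≤n →
      proj₂ (cauchy x η 0<η) n A (ℕₚ.≤-trans N≤A A≤n) N≤A

    separated : ∀ x y A η → 0ℚ < η → NearFrom A η x → NearFrom A η y →
                seq x A + ((η + η) + (η + η)) ≤ seq y A → x <ᴿ y
    separated x y A η 0<η x-near y-near le = η + η , double-positive 0<η , A , λ n A≤n →
      spread (seq x A) (seq x n) (seq y A) (seq y n) η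
        (dist-upper (seq x n) (seq x A) η (x-near n A≤n)) le
        (dist-lower (seq y n) (seq y A) η (y-near n A≤n))

    <-cotrans : ∀ {x y} → x <ᴿ y → ∀ z → x <ᴿ z ⊎ z <ᴿ y
    <-cotrans {x} {y} (ε , 0<ε , N , x+ε≤y) z
      with eighth 0<ε
    ... | η , 0<η , 8η≡ε
      with eventually-near x 0<η | eventually-near y 0<η | eventually-near z 0<η
    ... | K , x-near | L , y-near | M , z-near = compare
      (N ℕ.⊔ (K ℕ.⊔ (L ℕ.⊔ M)))
      (ℕₚ.m≤m⊔n N (K ℕ.⊔ (L ℕ.⊔ M)))
      (ℕₚ.≤-trans (ℕₚ.m≤m⊔n K (L ℕ.⊔ M)) (ℕₚ.m≤n⊔m N (K ℕ.⊔ (L ℕ.⊔ M))))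
      (ℕₚ.≤-trans (ℕₚ.m≤m⊔n L M) (ℕₚ.≤-trans (ℕₚ.m≤n⊔m K (L ℕ.⊔ M)) (ℕₚ.m≤n⊔m N (K ℕ.⊔ (L ℕ.⊔ M)))))
      (ℕₚ.≤-trans (ℕₚ.m≤n⊔m L M) (ℕₚ.≤-trans (ℕₚ.m≤n⊔m K (L ℕ.⊔ M)) (ℕₚ.m≤n⊔m N (K ℕ.⊔ (L ℕ.⊔ M)))))
      where
      compare : ∀ A → N ℕ.≤ A → K ℕ.≤ A → L ℕ.≤ A → M ℕ.≤ A → x <ᴿ z ⊎ z <ᴿ y
      compare A N≤A K≤A L≤A M≤A with ℚₚ.≤-total (seq x A + ((η + η) + (η + η))) (seq z A)
      ... | inj₁ le = inj₁ (separated x z A η 0<η (x-near A K≤A) (z-near A M≤A) le)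
      ... | inj₂ le = inj₂ (separated z y A η 0<η (z-near A M≤A) (y-near A L≤A)
        (widen (seq x A) (seq y A) (seq z A) ε ((η + η) + (η + η)) 8η≡ε le (x+ε≤y A N≤A)))

    ≤ᴿ-trans : ∀ {x y z} → x ≤ᴿ y → y ≤ᴿ z → x ≤ᴿ z
    ≤ᴿ-trans {x} {y} {z} x≤y y≤z z<x with <-cotrans {z} {x} z<x y
    ... | inj₁ z<y = y≤z z<y
    ... | inj₂ y<x = x≤y y<x

    <ᴿ-≤ᴿ-trans : ∀ {x y z} → x <ᴿ y → y ≤ᴿ z → x <ᴿ z
    <ᴿ-≤ᴿ-trans {x} {y} {z} x<y y≤z with <-cotrans {x} {y} x<y z
    ... | inj₁ x<z = x<z
    ... | inj₂ z<y = ⊥-elim (y≤z z<y)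

    ≤ᴿ-<ᴿ-trans : ∀ {x y z} → x ≤ᴿ y → y <ᴿ z → x <ᴿ z
    ≤ᴿ-<ᴿ-trans {x} {y} {z} x≤y y<z with <-cotrans {y} {z} y<z x
    ... | inj₁ y<x = ⊥-elim (x≤y y<x)
    ... | inj₂ x<z = x<z

    const-< : ∀ {p q} → p < q → const p <ᴿ const q
    const-< {p} {q} p<q = q - p , 0<b-a p<q , 0 , λ _ _ → ℚₚ.≤-reflexive (a+[b-a] p q)

    const-<⁻¹ : ∀ {p q} → const p <ᴿ const q → p < q
    const-<⁻¹ {p} {q} (ε , 0<ε , N , h) = ℚₚ.<-≤-trans (<-gap ε 0<ε refl) (h N ℕₚ.≤-refl)

    const-≤ : ∀ {p q} → p ≤ q → const p ≤ᴿ const q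
    const-≤ p≤q q<p = ℚₚ.<-irrefl refl (ℚₚ.<-≤-trans (const-<⁻¹ q<p) p≤q)

    const-≤⁻¹ : ∀ {p q} → const p ≤ᴿ const q → p ≤ q
    const-≤⁻¹ p≤q = ℚₚ.≮⇒≥ λ q<p → p≤q (const-< q<p)

    <ᴿ⇒≤ᴿ : ∀ {x y} → x <ᴿ y → x ≤ᴿ y
    <ᴿ⇒≤ᴿ {x} {y} (ε , 0<ε , M , h) (δ , 0<δ , N , k) =
      ℚₚ.<-asym (ℚₚ.<-≤-trans (<-gap ε 0<ε refl) (h (M ℕ.⊔ N) (ℕₚ.m≤m⊔n M N)))
                (ℚₚ.<-≤-trans (<-gap δ 0<δ refl) (k (M ℕ.⊔ N) (ℕₚ.m≤n⊔m M N)))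

    upper-bound : ∀ x → ∃[ B ] x <ᴿ const (nat B)
    upper-bound x =
      let (N , p) = cauchy x 1ℚ (ℚₚ.positive⁻¹ 1ℚ)
          (B , h) = natural-bound (seq x N + (1ℚ + 1ℚ))
      in B , 1ℚ , ℚₚ.positive⁻¹ 1ℚ , N , λ n N≤n →
         ℚₚ.≤-trans {seq x n + 1ℚ} {(seq x N + 1ℚ) + 1ℚ} (ℚₚ.+-monoˡ-≤ 1ℚ (ℚₚ.<⇒≤ (dist-upper (seq x n) (seq x N) 1ℚ (p n N N≤n ℕₚ.≤-refl))))
           (subst (_≤ nat B) (sym (ℚₚ.+-assoc (seq x N) 1ℚ 1ℚ)) h)

    lower-bound : ∀ x → ∃[ B ] const (- nat B) <ᴿ x
    lower-bound x =
      let (N , p) = cauchy x 1ℚ (ℚₚ.positive⁻¹ 1ℚ)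
          (B , h) = natural-bound (- seq x N + (1ℚ + 1ℚ))
      in B , 1ℚ , ℚₚ.positive⁻¹ 1ℚ , N , λ n N≤n →
         ≤-gap ((seq x n + 1ℚ - seq x N) + (nat B - (- seq x N + (1ℚ + 1ℚ))))
           (ℚₚ.+-mono-≤ {0ℚ} (ℚₚ.<⇒≤ (0<b-a (dist-lower (seq x n) (seq x N) 1ℚ (p n N N≤n ℕₚ.≤-refl)))) (0≤b-a h))
           (solve 3 (λ b xN xn → (:- b :+ con 1ℚ) :+ ((xn :+ con 1ℚ :- xN) :+ (b :- (:- xN :+ (con 1ℚ :+ con 1ℚ)))) := xn)
              refl (nat B) (seq x N) (seq x n))
      where open +-*-Solver

open ℝ-Lemmas

sumTo : (ℕ → ℚ) → ℕ → ℚ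
sumTo t zero    = 0ℚ
sumTo t (suc n) = sumTo t n + t n

_/!_ : ℤ → ℕ → ℚ
a /! n = (a / (n !)) {{n ℕₚ.!≢0}}

module Series where

  h : ℕ → ℚ
  h zero    = 1ℚ
  h (suc j) = ½ * h j

  0<h : ∀ j → 0ℚ < h j
  0<h zero    = ℚₚ.positive⁻¹ 1ℚ
  0<h (suc j) = 0<½* (0<h j)

  h≡ : ∀ j → h j ≡ (+ 1 / (2 ℕ.^ j)) {{ℕₚ.m^n≢0 2 j}}
  h≡ zero    = refl
  h≡ (suc j) = trans (cong (½ *_) (h≡ j))
    (/-*-/ (+ 1) (+ 1) 2 (2 ℕ.^ j) {{_}} {{ℕₚ.m^n≢0 2 j}} {{ℕₚ.m^n≢0 2 (suc j)}})

  j<2^j : ∀ j → suc j ℕ.≤ 2 ℕ.^ j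
  j<2^j zero    = ℕₚ.≤-refl
  j<2^j (suc j) = subst (suc (suc j) ℕ.≤_) (cong (2 ℕ.^ j ℕ.+_) (sym (ℕₚ.+-identityʳ (2 ℕ.^ j))))
    (ℕₚ.+-mono-≤ (ℕₚ.m^n>0 2 j) (j<2^j j))

  h≤unit : ∀ j → h j ≤ unit j
  h≤unit j = subst (_≤ unit j) (sym (h≡ j))
    (/-mono-≤ (+ 1) (+ 1) (2 ℕ.^ j) (suc j) {{ℕₚ.m^n≢0 2 j}}
      (ℤₚ.*-monoˡ-≤-nonNeg (+ 1) (ℤ.+≤+ (j<2^j j))))

  factorial-growth : ∀ M j → (j !) ℕ.* suc j ℕ.^ M ℕ.≤ (M ℕ.+ j) !
  factorial-growth zero    j = ℕₚ.≤-reflexive (ℕₚ.*-identityʳ (j !))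
  factorial-growth (suc M) j = ℕₚ.≤-trans
    (ℕₚ.≤-reflexive (rearrange (j !) (suc j) (suc j ℕ.^ M)))
    (ℕₚ.*-mono-≤ (ℕ.s≤s (ℕₚ.m≤n+m j M)) (factorial-growth M j))
    where
    open ℕ-Solver.+-*-Solver
    rearrange : ∀ a b c → a ℕ.* (b ℕ.* c) ≡ b ℕ.* (a ℕ.* c)
    rearrange = solve 3 (λ a b c → a :* (b :* c) := b :* (a :* c)) refl

  2^≤ : ∀ j → 2 ℕ.^ j ℕ.≤ 2 ℕ.* j !
  2^≤ zero          = ℕ.s≤s ℕ.z≤n
  2^≤ (suc zero)    = ℕₚ.≤-refl
  2^≤ (suc (suc j)) = ℕₚ.*-monoʳ-≤ 2 {2 ℕ.^ suc j} {suc (suc j) !}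
    (ℕₚ.≤-trans {j = 2 ℕ.* suc j !} (2^≤ (suc j))
      (ℕₚ.*-monoˡ-≤ (suc j !) {2} {suc (suc j)} (ℕ.s≤s (ℕ.s≤s ℕ.z≤n))))

  term-growth : ∀ M j →
    suc (M ℕ.+ j) ℕ.^ M ℕ.* 2 ℕ.^ j ℕ.≤ (2 ℕ.* suc M ℕ.^ M) ℕ.* (M ℕ.+ j) !
  term-growth M j = begin
    suc (M ℕ.+ j) ℕ.^ M ℕ.* 2 ℕ.^ j
      ≤⟨ ℕₚ.*-mono-≤ (ℕₚ.^-monoˡ-≤ M base) (2^≤ j) ⟩
    (suc M ℕ.* suc j) ℕ.^ M ℕ.* (2 ℕ.* j !)
      ≡⟨ cong (ℕ._* (2 ℕ.* j !)) (^-distrib M) ⟩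
    (suc M ℕ.^ M ℕ.* suc j ℕ.^ M) ℕ.* (2 ℕ.* j !)
      ≡⟨ rearrange (suc M ℕ.^ M) (suc j ℕ.^ M) (j !) ⟩
    (2 ℕ.* suc M ℕ.^ M) ℕ.* ((j !) ℕ.* suc j ℕ.^ M)
      ≤⟨ ℕₚ.*-monoʳ-≤ (2 ℕ.* suc M ℕ.^ M) (factorial-growth M j) ⟩
    (2 ℕ.* suc M ℕ.^ M) ℕ.* (M ℕ.+ j) ! ∎
    where
    open ℕₚ.≤-Reasoning
    open ℕ-Solver.+-*-Solver
    rearrange : ∀ a b c → (a ℕ.* b) ℕ.* (2 ℕ.* c) ≡ (2 ℕ.* a) ℕ.* (c ℕ.* b)
    rearrange = solve 3 (λ a b c → (a :* b) :* (con 2 :* c) := (con 2 :* a) :* (c :* b)) refl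
    base : suc (M ℕ.+ j) ℕ.≤ suc M ℕ.* suc j
    base = ℕₚ.≤-trans (ℕₚ.m≤m+n (suc (M ℕ.+ j)) (M ℕ.* j))
      (ℕₚ.≤-reflexive (solve 2 (λ M j → con 1 :+ (M :+ j) :+ M :* j := (con 1 :+ M) :* (con 1 :+ j)) refl M j))
    ^-distrib : ∀ k → (suc M ℕ.* suc j) ℕ.^ k ≡ suc M ℕ.^ k ℕ.* suc j ℕ.^ k
    ^-distrib zero    = refl
    ^-distrib (suc k) = trans (cong ((suc M ℕ.* suc j) ℕ.*_) (^-distrib k))
      (interchange (suc M) (suc j) (suc M ℕ.^ k) (suc j ℕ.^ k))
      where
      interchange : ∀ a b c d → (a ℕ.* b) ℕ.* (c ℕ.* d) ≡ (a ℕ.* c) ℕ.* (b ℕ.* d)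
      interchange = solve 4 (λ a b c d → (a :* b) :* (c :* d) := (a :* c) :* (b :* d)) refl

  ∣/∣ : ∀ i n .{{_ : ℕ.NonZero n}} → ∣ i / n ∣ ≡ + ℤ.∣ i ∣ / n
  ∣/∣ (+ i)    n = ℚₚ.0≤p⇒∣p∣≡p (ℚₚ.nonNegative⁻¹ (+ i / n) {{ℚₚ.normalize-nonNeg i n}})
  ∣/∣ -[1+ i ] n = trans (ℚₚ.∣-p∣≡∣p∣ (+ suc i / n)) (∣/∣ (+ suc i) n)

  module _ (a : ℕ → ℤ) (M : ℕ) (bound : ∀ n → ℤ.∣ a n ∣ ℕ.≤ suc n ℕ.^ M) where

    C = 2 ℕ.* suc M ℕ.^ M
    t = λ n → a n /! n

    term-bound : ∀ j → ∣ t (M ℕ.+ j) ∣ ≤ nat C * h j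
    term-bound j = subst₂ _≤_ (sym (∣/∣ (a (M ℕ.+ j)) ((M ℕ.+ j) !)))
      (sym (trans (cong (nat C *_) (h≡ j)) (/-*-/ (+ C) (+ 1) 1 (2 ℕ.^ j))))
      (/-mono-≤ (+ ℤ.∣ a (M ℕ.+ j) ∣) (+ C ℤ.* + 1) ((M ℕ.+ j) !) (1 ℕ.* 2 ℕ.^ j)
        (subst₂ ℤ._≤_
          (trans (ℤₚ.pos-* ℤ.∣ a (M ℕ.+ j) ∣ (2 ℕ.^ j))
            (cong (λ k → + ℤ.∣ a (M ℕ.+ j) ∣ ℤ.* + k) (sym (ℕₚ.*-identityˡ (2 ℕ.^ j)))))
          (trans (ℤₚ.pos-* C ((M ℕ.+ j) !))
            (cong (ℤ._* + ((M ℕ.+ j) !)) (sym (ℤₚ.*-identityʳ (+ C)))))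
          (ℤ.+≤+ (ℕₚ.≤-trans (ℕₚ.*-monoˡ-≤ (2 ℕ.^ j) (bound (M ℕ.+ j))) (term-growth M j)))))
      where
      instance
        _ = (M ℕ.+ j) ℕₚ.!≢0
        _ = ℕₚ.m^n≢0 2 j
        _ = ℕₚ.m*n≢0 1 (2 ℕ.^ j)

    δ : ℕ → ℚ
    δ j = nat C * h j + nat C * h j

    tail : ∀ J d → ∣ sumTo t (M ℕ.+ (J ℕ.+ d)) - sumTo t (M ℕ.+ J) ∣ ≤ δ J - δ (J ℕ.+ d)
    tail J zero rewrite ℕₚ.+-identityʳ J =
      subst₂ _≤_ (cong ∣_∣ (sym (ℚₚ.+-inverseʳ (sumTo t (M ℕ.+ J))))) (sym (ℚₚ.+-inverseʳ (δ J))) ℚₚ.≤-refl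
    tail J (suc d) rewrite ℕₚ.+-suc J d | ℕₚ.+-suc M (J ℕ.+ d) =
      subst₂ _≤_ (cong ∣_∣ (shift (sumTo t (M ℕ.+ (J ℕ.+ d))) (t (M ℕ.+ (J ℕ.+ d))) (sumTo t (M ℕ.+ J))))
        (step (δ J) (nat C) (h (J ℕ.+ d)))
        (ℚₚ.≤-trans (ℚₚ.∣p+q∣≤∣p∣+∣q∣ (sumTo t (M ℕ.+ (J ℕ.+ d)) - sumTo t (M ℕ.+ J)) (t (M ℕ.+ (J ℕ.+ d))))
          (ℚₚ.+-mono-≤ (tail J d) (term-bound (J ℕ.+ d))))
      where
      open +-*-Solver
      shift : ∀ s t u → (s - u) + t ≡ (s + t) - u
      shift = solve 3 (λ s t u → (s :- u) :+ t := (s :+ t) :- u) refl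
      step : ∀ δJ C h → (δJ - (C * h + C * h)) + C * h ≡ δJ - (C * (½ * h) + C * (½ * h))
      step = solve 3 (λ δJ C h → (δJ :- (C :* h :+ C :* h)) :+ C :* h
                              := δJ :- (C :* (con ½ :* h) :+ C :* (con ½ :* h))) refl

    cauchy-sums : Cauchy (sumTo t)
    cauchy-sums ε 0<ε = M ℕ.+ J , λ m n MJ≤m MJ≤n →
      subst₂ _<_ (cong ∣_∣ (join (sumTo t m) (sumTo t n) (sumTo t (M ℕ.+ J)))) (halves ε)
        (ℚₚ.≤-<-trans (ℚₚ.∣p-q∣≤∣p∣+∣q∣ (sumTo t m - sumTo t (M ℕ.+ J)) (sumTo t n - sumTo t (M ℕ.+ J)))
          (ℚₚ.+-mono-< (close m MJ≤m) (close n MJ≤n)))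
      where
      open +-*-Solver
      η = ½ * (½ * ε)
      0<η = 0<½* (0<½* 0<ε)
      K = suc C
      0<K⁻¹η = *-pos (0<unit C) 0<η
      J = proj₁ (archimedean 0<K⁻¹η)
      nonNeg-Ch : ∀ j → 0ℚ ≤ nat C * h j
      nonNeg-Ch j = *-nonNeg (0≤nat C) (ℚₚ.<⇒≤ (0<h j))
      Ch<η : nat C * h J < η
      Ch<η = ℚₚ.<-≤-trans
        (ℚₚ.*-monoˡ-<-pos (h J) {{positive (0<h J)}}
          (<-gap {nat C} 1ℚ (ℚₚ.positive⁻¹ 1ℚ) (trans (ι-+ (+ C) (+ 1)) (cong nat (ℕₚ.+-comm C 1)))))
        (subst (nat K * h J ≤_) (cancel-unit C η)
          (ℚₚ.*-monoˡ-≤-nonNeg (nat K) {{nonNegative (0≤nat K)}}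
            (ℚₚ.≤-trans (h≤unit J) (proj₂ (archimedean 0<K⁻¹η)))))
      δ<ε/2 : δ J < ½ * ε
      δ<ε/2 = subst (δ J <_) (halves (½ * ε)) (ℚₚ.+-mono-< Ch<η Ch<η)
      join : ∀ a b c → (a - c) - (b - c) ≡ a - b
      join = solve 3 (λ a b c → (a :- c) :- (b :- c) := a :- b) refl
      close : ∀ m → M ℕ.+ J ℕ.≤ m → ∣ sumTo t m - sumTo t (M ℕ.+ J) ∣ < ½ * ε
      close m MJ≤m = ℚₚ.≤-<-trans
        (subst (λ k → ∣ sumTo t k - sumTo t (M ℕ.+ J) ∣ ≤ δ J - δ (J ℕ.+ d))
          (trans (sym (ℕₚ.+-assoc M J d)) (ℕₚ.m+[n∸m]≡n MJ≤m)) (tail J d))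
        (ℚₚ.≤-<-trans
          (≤-gap (δ (J ℕ.+ d)) (ℚₚ.+-mono-≤ {0ℚ} (nonNeg-Ch (J ℕ.+ d)) (nonNeg-Ch (J ℕ.+ d)))
            (solve 2 (λ a b → (a :- b) :+ b := a) refl (δ J) (δ (J ℕ.+ d))))
          δ<ε/2)
        where d = m ℕ.∸ (M ℕ.+ J)

-- The bound makes the partial sums of ∑ aₙ/n! a Cauchy sequence.
PolynomiallyBounded : (ℕ → ℤ) → Set
PolynomiallyBounded a = ∃[ M ] ∀ n → ℤ.∣ a n ∣ ℕ.≤ suc n ℕ.^ M

-- The sequence of partial sums, as an element of ℝ, is the sum of the series.
∑[_/n!] : (a : ℕ → ℤ) → PolynomiallyBounded a → ℝ
∑[ a /n!] (M , bound) = sumTo (λ n → a n /! n) , Series.cauchy-sums a M bound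

e : ℝ
e = ∑[ (λ _ → + 1) /n!] (0 , λ _ → ℕₚ.≤-refl)

IsSupremum : (ℚ → Set) → ℝ → Set
IsSupremum P x = (∀ y → P y → const y ≤ᴿ x)
               × (∀ u → (∀ y → P y → const y ≤ᴿ u) → x ≤ᴿ u)

-- The rationals 0 ≤ y ≤ n^r with 0 < r ≤ λ rational. For r = p / q the
-- inequality y ≤ n^(p/q) is written y^q ≤ n^p. The supremum of this set is n^λ
-- for every λ > 0; since r > 0 the set is {0} for n = 0, so 0^λ = 0.
RationalPowersBelow : ℕ → ℝ → ℚ → Set
RationalPowersBelow n λ′ y = 0ℚ ≤ y × ∃[ p ] ∃[ q ]
  const (+ suc p / suc q) ≤ᴿ λ′ × y ^ suc q ≤ ι (+ n) ^ suc p

module Powers where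

  abstract
    inhabited : ∀ n λ′ → 0ᴿ <ᴿ λ′ → ∃ (RationalPowersBelow n λ′)
    inhabited n λ′ (ε , 0<ε , N , h) =
      0ℚ , ℚₚ.≤-refl , 0 , proj₁ (archimedean 0<ε) ,
      (λ (δ , 0<δ , M , k) → ℚₚ.<-irrefl refl
        (ℚₚ.<-≤-trans (<-gap δ 0<δ refl)
          (ℚₚ.≤-trans (k (M ℕ.⊔ N) (ℕₚ.m≤m⊔n M N))
            (ℚₚ.≤-trans (proj₂ (archimedean 0<ε))
              (subst (_≤ seq λ′ (M ℕ.⊔ N)) (ℚₚ.+-identityˡ ε) (h (M ℕ.⊔ N) (ℕₚ.m≤n⊔m M N))))))) ,
      subst (_≤ ι (+ n) ^ 1) (sym (ℚₚ.*-zeroˡ (0ℚ ^ proj₁ (archimedean 0<ε)))) (^-nonNeg (0≤nat n) 1)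

    upper : ∀ n λ′ M → λ′ <ᴿ const (nat M) →
            ∀ y → RationalPowersBelow n λ′ y → y ≤ nat (suc n ℕ.^ M)
    upper n λ′ M λ<M y (0≤y , p , q , p/q≤λ , y^q≤n^p) =
      subst (y ≤_) (nat-^ (suc n) M)
        (^-cancelˡ-≤ (^-nonNeg (0≤nat (suc n)) M) q
          (ℚₚ.≤-trans y^q≤n^p
          (ℚₚ.≤-trans (^-monoˡ-≤ (0≤nat n) (nat-mono (ℕₚ.n≤1+n n)) (suc p))
          (subst (nat (suc n) ^ suc p ≤_) (sym (^-assocʳ (nat (suc n)) M (suc q)))
            (nat-^-monoʳ-≤ n p≤Mq)))))
      where
      p/q≤M : + suc p / suc q ≤ nat M
      p/q≤M = ℚₚ.<⇒≤ (const-<⁻¹ (≤ᴿ-<ᴿ-trans {const (+ suc p / suc q)} {λ′} {const (nat M)} p/q≤λ λ<M))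
      p≤Mq : suc p ℕ.≤ M ℕ.* suc q
      p≤Mq = ℤₚ.drop‿+≤+ (subst₂ ℤ._≤_ (ℤₚ.*-identityʳ (+ suc p)) (sym (ℤₚ.pos-* M (suc q)))
        (/-cancel-≤ (+ suc p) (+ M) (suc q) 1 p/q≤M))

-- ℝ is the classical real line: excluded middle gives the integer part of every
-- real and the supremum of every nonempty bounded set of rationals.
module Completeness (em : ExcludedMiddle 0ℓ) where

  abstract

    jump : (P : ℤ → Set) (lo : ℤ) (d : ℕ) → P lo → ¬ P (lo ℤ.+ + d) →
           ∃[ z ] P z × ¬ P (z ℤ.+ + 1)
    jump P lo zero    p ¬q = contradiction (subst P (sym (ℤₚ.+-identityʳ lo)) p) ¬q
    jump P lo (suc d) p ¬q with em {P (lo ℤ.+ + 1)}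
    ... | yes p′ = jump P (lo ℤ.+ + 1) d p′ λ q → ¬q (subst P (ℤₚ.+-assoc lo (+ 1) (+ d)) q)
    ... | no ¬p′ = lo , p , ¬p′

    -B+[B+C] : ∀ B C → (ℤ.- + B) ℤ.+ + (B ℕ.+ C) ≡ + C
    -B+[B+C] B C = trans (sym (ℤₚ.+-assoc (ℤ.- + B) (+ B) (+ C)))
      (trans (cong (ℤ._+ + C) (ℤₚ.+-inverseˡ (+ B))) (ℤₚ.+-identityˡ (+ C)))

    integer-part : ∀ x → ∃[ z ] const (ι z) ≤ᴿ x × x <ᴿ const (ι (z ℤ.+ + 1))
    integer-part x =
      let (B , -B<x) = lower-bound x
          (C , x<C)  = upper-bound x
          (z , z≤x , z+1≰x) = jump (λ z → const (ι z) ≤ᴿ x) (ℤ.- + B) (B ℕ.+ C)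
            (subst (λ q → const q ≤ᴿ x) (sym (ι-neg B)) (<ᴿ⇒≤ᴿ {const (- nat B)} {x} -B<x))
            (λ C≤x → C≤x (subst (λ z → x <ᴿ const (ι z)) (sym (-B+[B+C] B C)) x<C))
      in z , z≤x , decide z+1≰x
      where
      decide : ∀ {P : Set} → ¬ ¬ P → P
      decide {P} ¬¬p with em {P}
      ... | yes p = p
      ... | no ¬p = contradiction ¬p ¬¬p

    module _ (P : ℚ → Set) (P₀ : ∃ P) (bounded : ∃[ b ] ∀ y → P y → y ≤ b) where

      private
        y₀ = proj₁ P₀
        A  = proj₁ (natural-bound (- y₀))
        B  = suc (proj₁ (natural-bound (proj₁ bounded)))

        Below : ℕ → ℤ → Set
        Below k z = ∃[ y ] P y × ι z * unit k ≤ y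

        scale : ∀ k n → nat (suc k ℕ.* n) * unit k ≡ nat n
        scale k n = trans (cong (_* unit k) (trans (cong ι (ℤₚ.pos-* (suc k) n)) (sym (ι-* (+ suc k) (+ n)))))
          (trans (solve 3 (λ a b c → (a :* b) :* c := a :* (c :* b)) refl (nat (suc k)) (nat n) (unit k))
            (cancel-unit k (nat n)))
          where open +-*-Solver

        y<B : ∀ y → P y → y < nat B
        y<B y Py = ℚₚ.≤-<-trans (ℚₚ.≤-trans (proj₂ bounded y Py) (proj₂ (natural-bound (proj₁ bounded))))
          (<-gap 1ℚ (ℚₚ.positive⁻¹ 1ℚ)
            (trans (ι-+ (+ b) (+ 1)) (cong nat (ℕₚ.+-comm b 1))))
          where b = proj₁ (natural-bound (proj₁ bounded))

        below-A : ∀ k → Below k (ℤ.- + (suc k ℕ.* A))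
        below-A k = y₀ , proj₂ P₀ ,
          subst (_≤ y₀) (sym (trans (cong (_* unit k) (ι-neg (suc k ℕ.* A)))
            (trans (sym (ℚₚ.neg-distribˡ-* (nat (suc k ℕ.* A)) (unit k))) (cong -_ (scale k A)))))
            (≤-gap (nat A - - y₀) (0≤b-a (proj₂ (natural-bound (- y₀))))
              (solve 2 (λ a y → :- a :+ (a :- :- y) := y) refl (nat A) y₀))
          where open +-*-Solver

        not-below-B : ∀ k → ¬ Below k ((ℤ.- + (suc k ℕ.* A)) ℤ.+ + (suc k ℕ.* A ℕ.+ suc k ℕ.* B))
        not-below-B k (y , Py , le) = ℚₚ.<-irrefl refl (ℚₚ.<-≤-trans (y<B y Py)
          (subst (_≤ y) (trans (cong (λ z → ι z * unit k) (-B+[B+C] (suc k ℕ.* A) (suc k ℕ.* B))) (scale k B)) le))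

        grid : ∀ k → ∃[ z ] Below k z × ¬ Below k (z ℤ.+ + 1)
        grid k = jump (Below k) (ℤ.- + (suc k ℕ.* A)) (suc k ℕ.* A ℕ.+ suc k ℕ.* B) (below-A k) (not-below-B k)

        s : ℕ → ℚ
        s k = ι (proj₁ (grid k)) * unit k

        P<s+unit : ∀ k y → P y → y < s k + unit k
        P<s+unit k y Py = ℚₚ.≰⇒> λ le → proj₂ (proj₂ (grid k)) (y , Py , subst (_≤ y) next le)
          where
          z = proj₁ (grid k)
          open +-*-Solver
          next : s k + unit k ≡ ι (z ℤ.+ + 1) * unit k
          next = trans (solve 2 (λ a u → a :* u :+ u := (a :+ con 1ℚ) :* u) refl (ι z) (unit k))
                       (cong (_* unit k) (ι-+ z (+ 1)))

        s-cauchy : Cauchy s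
        s-cauchy ε 0<ε = K , λ m n K≤m K≤n → dist< (close m n K≤n) (close n m K≤m)
          where
          K = proj₁ (archimedean 0<ε)
          close : ∀ m n → K ℕ.≤ n → s m < s n + ε
          close m n K≤n = let (y , Py , sm≤y) = proj₁ (proj₂ (grid m)) in
            ℚₚ.<-≤-trans (ℚₚ.≤-<-trans sm≤y (P<s+unit n y Py))
              (ℚₚ.+-monoʳ-≤ (s n) (ℚₚ.≤-trans (unit-anti K≤n) (proj₂ (archimedean 0<ε))))

      supremum : ∃ (IsSupremum P)
      supremum = (s , s-cauchy) , is-upper , is-least
        where
        is-upper : ∀ y → P y → const y ≤ᴿ (s , s-cauchy)
        is-upper y Py (ε , 0<ε , N , s+ε≤y) = ℚₚ.<-irrefl refl
          (ℚₚ.<-≤-trans (P<s+unit n y Py)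
            (ℚₚ.≤-trans (ℚₚ.+-monoʳ-≤ (s n) (ℚₚ.≤-trans (unit-anti (ℕₚ.m≤n⊔m N K)) (proj₂ (archimedean 0<ε))))
                        (s+ε≤y n (ℕₚ.m≤m⊔n N K))))
          where
          K = proj₁ (archimedean 0<ε)
          n = N ℕ.⊔ K
        is-least : ∀ u → (∀ y → P y → const y ≤ᴿ u) → (s , s-cauchy) ≤ᴿ u
        is-least u P≤u (ε , 0<ε , N , u+ε≤s) =
          P≤u y Py (½ * ε , 0<½* 0<ε , n , λ m n≤m → ℚₚ.≤-trans
            (ℚₚ.+-monoˡ-≤ (½ * ε) (ℚₚ.<⇒≤ (dist-upper (seq u m) (seq u n) (½ * ε) (c m n (ℕₚ.≤-trans (ℕₚ.m≤n⊔m N K) n≤m) (ℕₚ.m≤n⊔m N K)))))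
            (subst (_≤ y) (sym (trans (ℚₚ.+-assoc (seq u n) (½ * ε) (½ * ε)) (cong (λ q → seq u n + q) (halves ε))))
              (ℚₚ.≤-trans (u+ε≤s n (ℕₚ.m≤m⊔n N K)) s≤y)))
          where
          K = proj₁ (cauchy u (½ * ε) (0<½* 0<ε))
          c = proj₂ (cauchy u (½ * ε) (0<½* 0<ε))
          n = N ℕ.⊔ K
          y = proj₁ (proj₁ (proj₂ (grid n)))
          Py = proj₁ (proj₂ (proj₁ (proj₂ (grid n))))
          s≤y = proj₂ (proj₂ (proj₁ (proj₂ (grid n))))

module _ (em : ExcludedMiddle 0ℓ) where

  open Completeness em

  ⌊_⌋ᴿ : ℝ → ℤ
  ⌊ x ⌋ᴿ = proj₁ (integer-part x)

  power : ∀ n λ′ → 0ᴿ <ᴿ λ′ → ∃ (IsSupremum (RationalPowersBelow n λ′))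
  power n λ′ 0<λ = supremum (RationalPowersBelow n λ′) (Powers.inhabited n λ′ 0<λ)
    (let (M , λ<M) = upper-bound λ′ in nat (suc n ℕ.^ M) , Powers.upper n λ′ M λ<M)

  infixr 8 _^ᴿ_

  _^ᴿ_ : ℕ → ℝ⁺ → ℝ
  n ^ᴿ (λ′ , 0<λ) = proj₁ (power n λ′ 0<λ)

  ⌊^⌋-polynomiallyBounded : ∀ λ⁺ → PolynomiallyBounded (λ n → ⌊ n ^ᴿ λ⁺ ⌋ᴿ)
  ⌊^⌋-polynomiallyBounded λ⁺@(λ′ , 0<λ) = M , λ n →
    abs-bound (⌊ n ^ᴿ λ⁺ ⌋ᴿ) (nonneg n) (ι-cancel {⌊ n ^ᴿ λ⁺ ⌋ᴿ} {+ (suc n ℕ.^ M)} (const-≤⁻¹ {ι ⌊ n ^ᴿ λ⁺ ⌋ᴿ} {nat (suc n ℕ.^ M)}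
      (≤ᴿ-trans {const (ι ⌊ n ^ᴿ λ⁺ ⌋ᴿ)} {n ^ᴿ λ⁺} {const (nat (suc n ℕ.^ M))}
        (proj₁ (proj₂ (integer-part (n ^ᴿ λ⁺)))) (n^λ≤ n))))
    where
    M = proj₁ (upper-bound λ′)
    n^λ≤ : ∀ n → n ^ᴿ λ⁺ ≤ᴿ const (nat (suc n ℕ.^ M))
    n^λ≤ n = proj₂ (proj₂ (power n λ′ 0<λ)) (const (nat (suc n ℕ.^ M)))
      λ y Py → const-≤ {y} {nat (suc n ℕ.^ M)} (Powers.upper n λ′ M (proj₂ (upper-bound λ′)) y Py)
    nonneg : ∀ n → ℤ.0ℤ ℤ.≤ ⌊ n ^ᴿ λ⁺ ⌋ᴿ
    nonneg n = subst (ℤ.0ℤ ℤ.≤_) (pred-suc ⌊ n ^ᴿ λ⁺ ⌋ᴿ) (ℤₚ.i<j⇒i≤pred[j] (ι-cancel-< {+ 0} {⌊ n ^ᴿ λ⁺ ⌋ᴿ ℤ.+ + 1} (const-<⁻¹ {0ℚ} {ι (⌊ n ^ᴿ λ⁺ ⌋ᴿ ℤ.+ + 1)}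
      (≤ᴿ-<ᴿ-trans {0ᴿ} {n ^ᴿ λ⁺} {const (ι (⌊ n ^ᴿ λ⁺ ⌋ᴿ ℤ.+ + 1))}
        (≤ᴿ-trans {0ᴿ} {const y} {n ^ᴿ λ⁺} (const-≤ {0ℚ} {y} (proj₁ Py)) (proj₁ (proj₂ (power n λ′ 0<λ)) y Py))
        (proj₂ (proj₂ (integer-part (n ^ᴿ λ⁺))))))))
      where
      y  = proj₁ (Powers.inhabited n λ′ 0<λ)
      Py = proj₂ (Powers.inhabited n λ′ 0<λ)
      pred-suc : ∀ z → ℤ.pred (z ℤ.+ + 1) ≡ z
      pred-suc z = trans (cong ℤ.pred (ℤₚ.+-comm z (+ 1))) (ℤₚ.pred-suc z)
    abs-bound : ∀ z → ℤ.0ℤ ℤ.≤ z → ∀ {B} → z ℤ.≤ + B → ℤ.∣ z ∣ ℕ.≤ B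
    abs-bound (+ n) _ (ℤ.+≤+ n≤B) = n≤B

  S : ℝ⁺ → ℝ
  S λ⁺ = ∑[ (λ n → ⌊ n ^ᴿ λ⁺ ⌋ᴿ) /n!] (⌊^⌋-polynomiallyBounded λ⁺)

-- Linear independence over ℚ of a family v, where _≈ᴵ_ is the equality of
-- indices: distinct indices count as distinct members of the family.
LinearlyIndependent : {I : Set} → Rel I 0ℓ → (I → ℝ) → Set
LinearlyIndependent {I} _≈ᴵ_ v =
  ∀ m (i : Fin m → I) → Injective _≡_ _≈ᴵ_ i →
  ∀ (c : Fin m → ℚ) → sumᴿ (λ k → c k · v (i k)) ≈ 0ᴿ → ∀ k → c k ≡ 0ℚ

NonIntegral : ℝ → Set
NonIntegral x = ¬ (∃[ z ] x ≈ const (ι z))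

data Index : Set where
  one euler : Index
  exponent  : (λ⁺ : ℝ⁺) → NonIntegral (proj₁ λ⁺) → Index

data _≈ᴵ_ : Rel Index 0ℓ where
  one≈      : one ≈ᴵ one
  euler≈    : euler ≈ᴵ euler
  exponent≈ : ∀ {λ⁺ μ⁺ p q} → proj₁ λ⁺ ≈ proj₁ μ⁺ → exponent λ⁺ p ≈ᴵ exponent μ⁺ q

member : ExcludedMiddle 0ℓ → Index → ℝ
member em one             = 1ᴿ
member em euler           = e
member em (exponent λ⁺ _) = S em λ⁺

{-# OPTIONS --safe #-}

-- Let ∑ g(n)/n! = -a₀ be a linear relation with denominators cleared, so that g = a₁ + ∑ b_λ [n^λ] has integral
-- values. The integers r(n) = n! (a₀ + ∑_{j ≤ n} g(j)/j!) satisfy r(n+1) = (n+1) r(n) + g(n+1) and r(n)/n! → 0,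
-- hence grow polynomially only. A high difference of g is bounded: n^λ is uniformly close, on any given window, to
-- samples at multiples of a large step Q of a sequence proportional to Γ(N+p/q)/Γ(N), all of whose differences are
-- explicit. Each difference of the recurrence lowers the growth exponent of the differences of r by one, so some
-- difference of r tends to 0; being integral it vanishes eventually, and g is eventually a polynomial. But the
-- largest λ with b_λ ≠ 0 would then be the degree of g, hence an integer. So no λ occurs, g is constant, r is
-- bounded, and r(n+1) = (n+1) r(n) + a₁ forces r = 0 and a₁ = 0.
module Submission where

open import Algebra.Bundles using (CommutativeRing)
import Algebra.Properties.Semiring.Exp as Exp
open import Axiom.ExcludedMiddle using (ExcludedMiddle)
open import Data.Empty using (⊥; ⊥-elim)
open import Data.Fin.Base using (Fin; zero; suc)
open import Data.Integer.Base as ℤ using (ℤ; +_; -[1+_])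
import Data.Integer.Properties as ℤₚ
import Data.Integer.Tactic.RingSolver as ℤ-Ring
open import Data.Nat.Base
open import Data.Nat.DivMod using (m/n*n≤m; m*n/n≡m; /-monoˡ-≤)
open import Data.Nat.Properties
open import Data.Nat.Tactic.RingSolver using (solve-∀)
open import Data.Product.Base using (Σ; ∃; ∃-syntax; _×_; _,_; proj₁; proj₂)
open import Data.Rational.Base as ℚ using (ℚ; 0ℚ; 1ℚ; mkℚ)
import Data.Rational.Properties as ℚₚ
import Data.Rational.Solver as ℚ-Solver
open import Data.Sum.Base using (_⊎_; inj₁; inj₂)
open import Data.Unit.Base using (⊤; tt)
open import Data.Vec.Functional using (foldr)
open import Function.Base using (_∘_)
open import Function.Definitions using (Injective)
open import Level using (0ℓ)
open import Relation.Binary.PropositionalEquality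
open import Relation.Nullary using (¬_; Dec; yes; no; contradiction)
open import Defs

-- The obstacle is the smoothness of n^λ: for irrational λ this number is known only through the
-- rational exponents p/q ≤ λ, so its differences cannot be read off from derivatives. The quotient
-- Γ(N+a)/Γ(N) is a discrete substitute for N^a: its i-th difference is a(a-1)...(a-i+1)
-- Γ(N+a)/Γ(N+i), and with a = p/q this needs only a first-order recurrence with integer
-- coefficients. Sampling with step Q multiplies the bound on an M-th difference by Q^M, and this is
-- exactly the factor Q^(-M) that the M-th difference of the quotient gains near N = Q; what remains
-- is M^M. The exponent p/q, the step Q and the sequence all depend on the window, but this bound
-- does not. Rounding costs at most 2 per value, hence `2 ^ M * 2` in an M-th difference. Growth
-- exponents are also compared without roots. A sequence is tested on the q-th powers n = t^q, where
-- n^(p/q) is the integer t^p; a bound of this kind with p/q < x is the relation `_≺_`.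

-- Bernoulli inequalities and the comparison of Γ-quotients with powers

bernoulli : ∀ a c n → a ^ n * (a + n * c) ≤ (a + c) ^ n * a
bernoulli a c zero    = ≤-reflexive (base a c)
  where
  base : ∀ a c → 1 * (a + 0 * c) ≡ 1 * a
  base = solve-∀
bernoulli a c (suc n) = begin
  a * a ^ n * (a + (c + n * c))           ≡⟨ split a c n (a ^ n) ⟩
  a * (a ^ n * (a + n * c)) + a * c * a ^ n
    ≤⟨ +-mono-≤ (*-monoʳ-≤ a (bernoulli a c n)) (*-monoʳ-≤ (a * c) (^-monoˡ-≤ n (m≤m+n a c))) ⟩
  a * ((a + c) ^ n * a) + a * c * (a + c) ^ n ≡⟨ join a c ((a + c) ^ n) ⟩
  (a + c) * (a + c) ^ n * a               ∎
  where
  open ≤-Reasoning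
  split : ∀ a c n x → a * x * (a + (c + n * c)) ≡ a * (x * (a + n * c)) + a * c * x
  split = solve-∀
  join : ∀ a c x → a * (x * a) + a * c * x ≡ (a + c) * x * a
  join = solve-∀

-- (1 - c/(a+c))ⁿ ≥ 1 - nc/(a+c) with denominators cleared.
bernoulli⁻ : ∀ a c n → (a + c) ^ n * (a + c) ≤ a ^ n * (a + c) + n * c * (a + c) ^ n
bernoulli⁻ a c zero    = ≤-reflexive (base a c)
  where
  base : ∀ a c → 1 * (a + c) ≡ 1 * (a + c) + 0 * c * 1
  base = solve-∀
bernoulli⁻ a c (suc n) = begin
  (a + c) * s * (a + c)                       ≡⟨ *-assoc (a + c) s (a + c) ⟩
  (a + c) * (s * (a + c))                     ≤⟨ *-monoʳ-≤ (a + c) (bernoulli⁻ a c n) ⟩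
  (a + c) * (a ^ n * (a + c) + n * c * s)     ≡⟨ split a c n (a ^ n) s ⟩
  a * a ^ n * (a + c) + n * c * ((a + c) * s) + c * (a + c) * a ^ n
    ≤⟨ +-monoʳ-≤ _ (*-monoʳ-≤ (c * (a + c)) (^-monoˡ-≤ n (m≤m+n a c))) ⟩
  a * a ^ n * (a + c) + n * c * ((a + c) * s) + c * (a + c) * s ≡⟨ join a c n (a ^ n) s ⟩
  a * a ^ n * (a + c) + suc n * c * ((a + c) * s) ∎
  where
  open ≤-Reasoning
  s = (a + c) ^ n
  split : ∀ a c n x s → (a + c) * (x * (a + c) + n * c * s) ≡ a * x * (a + c) + n * c * ((a + c) * s) + c * (a + c) * x
  split = solve-∀
  join : ∀ a c n x s → a * x * (a + c) + n * c * ((a + c) * s) + c * (a + c) * s ≡ a * x * (a + c) + suc n * c * ((a + c) * s)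
  join = solve-∀

^-cancelˡ-≤ℕ : ∀ {a b} n → a ^ suc n ≤ b ^ suc n → a ≤ b
^-cancelˡ-≤ℕ {a} {b} n le = ≮⇒≥ λ b<a → <⇒≱ (^-monoˡ-< (suc n) b<a) le

-- ((N+p)/(N+p-1))^p ≤ (1 + p/(qN))^q
ratio-lower : ∀ N q p .{{_ : NonZero N}} .{{_ : NonZero q}} →
  suc (N + p) ^ suc p * (q * N) ^ q ≤ (q * N + suc p) ^ q * (N + p) ^ suc p
ratio-lower N q p = *-cancelʳ-≤ (X * V) (W * Y) (N * (N + suc p)) {{m*n≢0 N (N + suc p)}} (begin
  X * V * (N * (N + suc p))     ≡⟨ regroup X V N (N + suc p) ⟩
  X * N * (V * (N + suc p))     ≤⟨ *-mono-≤ X≤ V≤ ⟩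
  Y * (N + suc p) * (W * N)     ≡⟨ regroup′ Y (N + suc p) W N ⟩
  W * Y * (N * (N + suc p))     ∎)
  where
  open ≤-Reasoning
  instance
    N+p≢0 : NonZero (N + suc p)
    N+p≢0 = >-nonZero (≤-trans (>-nonZero⁻¹ N) (m≤m+n N (suc p)))
  X = suc (N + p) ^ suc p
  Y = (N + p) ^ suc p
  V = (q * N) ^ q
  W = (q * N + suc p) ^ q
  regroup : ∀ x v n m → x * v * (n * m) ≡ x * n * (v * m)
  regroup = solve-∀
  regroup′ : ∀ y m w n → y * m * (w * n) ≡ w * y * (n * m)
  regroup′ = solve-∀
  r₁ : ∀ v n p q → v * (n + suc p) * q ≡ v * (q * n + q * suc p)
  r₁ = solve-∀
  r₂ : ∀ w n q → w * (q * n) ≡ w * n * q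
  r₂ = solve-∀
  r₃ : ∀ x n p → x * n + suc p * x ≡ x * (n + p + 1)
  r₃ = solve-∀
  r₄ : ∀ y n p x → y * (n + p + 1) + suc p * 1 * x ≡ y * (n + suc p) + suc p * x
  r₄ = solve-∀
  -- Both ratios are compared with `(N + suc p) / N`: Bernoulli's inequality puts the q-th power
  -- above it, and `X≤` puts the power with exponent `suc p` below it.
  V≤ : V * (N + suc p) ≤ W * N
  V≤ = *-cancelʳ-≤ (V * (N + suc p)) (W * N) q (begin
    V * (N + suc p) * q         ≡⟨ r₁ V N p q ⟩
    V * (q * N + q * suc p)     ≤⟨ bernoulli (q * N) (suc p) q ⟩
    W * (q * N)                 ≡⟨ r₂ W N q ⟩
    W * N * q                   ∎)
  X≤ : X * N ≤ Y * (N + suc p)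
  X≤ = +-cancelʳ-≤ (suc p * X) (X * N) (Y * (N + suc p)) (begin
    X * N + suc p * X           ≡⟨ r₃ X N p ⟩
    X * (N + p + 1)             ≡⟨ cong (λ s → s ^ suc p * (N + p + 1)) (sym (+-comm (N + p) 1)) ⟩
    (N + p + 1) ^ suc p * (N + p + 1) ≤⟨ bernoulli⁻ (N + p) 1 (suc p) ⟩
    Y * (N + p + 1) + suc p * 1 * (N + p + 1) ^ suc p ≡⟨ cong (λ s → Y * (N + p + 1) + suc p * 1 * s ^ suc p) (+-comm (N + p) 1) ⟩
    Y * (N + p + 1) + suc p * 1 * X ≡⟨ r₄ Y N p X ⟩
    Y * (N + suc p) + suc p * X ∎)

-- (1 + p/(qN))^q ≤ ((N-p+1)/(N-p))^p, where k = N - p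
ratio-upper : ∀ k q p .{{_ : NonZero p}} →
  (q * (k + p) + p) ^ q * k ^ p ≤ suc k ^ p * (q * (k + p)) ^ q
ratio-upper k q p = *-cancelʳ-≤ (W * K) (L * V) D {{m*n≢0 (q * k + p) (k + p) {{>-nonZero (≤-trans (>-nonZero⁻¹ p) (m≤n+m p (q * k)))}} {{>-nonZero (≤-trans (>-nonZero⁻¹ p) (m≤n+m p k))}}}} (begin
  W * K * D                           ≡⟨ regroup W K (q * k + p) (k + p) ⟩
  W * (q * k + p) * (K * (k + p))     ≤⟨ *-mono-≤ W≤ K≤ ⟩
  V * (q * (k + p) + p) * (L * k)     ≡⟨ r₁ V L q p k ⟩
  -- The bound (q(k+p)+p)/(qk+p) from `W≤` does not meet the bound (k+p)/k from `K≤`; after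
  -- cross-multiplication it falls short by exactly p².
  L * V * (q * k * k + q * k * p + p * k)   ≤⟨ *-monoʳ-≤ (L * V) (m≤m+n _ (p * p)) ⟩
  L * V * (q * k * k + q * k * p + p * k + p * p) ≡⟨ cong (L * V *_) (expand q k p) ⟩
  L * V * D                           ∎)
  where
  open ≤-Reasoning
  W = (q * (k + p) + p) ^ q
  V = (q * (k + p)) ^ q
  K = k ^ p
  L = suc k ^ p
  D = (q * k + p) * (k + p)
  regroup : ∀ w k a b → w * k * (a * b) ≡ w * a * (k * b)
  regroup = solve-∀
  expand : ∀ q k p → q * k * k + q * k * p + p * k + p * p ≡ (q * k + p) * (k + p)
  expand = solve-∀
  r₁ : ∀ v l q p k → v * (q * (k + p) + p) * (l * k) ≡ l * v * (q * k * k + q * k * p + p * k)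
  r₁ = solve-∀
  r₂ : ∀ w q k p → w * (q * k + p) + q * p * w ≡ w * (q * (k + p) + p)
  r₂ = solve-∀
  K≤ : K * (k + p) ≤ L * k
  K≤ = begin
    K * (k + p)       ≡⟨ cong (λ x → K * (k + x)) (sym (*-identityʳ p)) ⟩
    K * (k + p * 1)   ≤⟨ bernoulli k 1 p ⟩
    (k + 1) ^ p * k   ≡⟨ cong (λ x → x ^ p * k) (+-comm k 1) ⟩
    L * k             ∎
  W≤ : W * (q * k + p) ≤ V * (q * (k + p) + p)
  W≤ = +-cancelʳ-≤ (q * p * W) (W * (q * k + p)) (V * (q * (k + p) + p)) (begin
    W * (q * k + p) + q * p * W         ≡⟨ r₂ W q k p ⟩
    W * (q * (k + p) + p)               ≤⟨ bernoulli⁻ (q * (k + p)) p q ⟩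
    V * (q * (k + p) + p) + q * p * W   ∎)

^-distribʳ-*ℕ : ∀ m n k → (m * n) ^ k ≡ m ^ k * n ^ k
^-distribʳ-*ℕ m n zero    = refl
^-distribʳ-*ℕ m n (suc k) = trans (cong (m * n *_) (^-distribʳ-*ℕ m n k)) (interchange m n (m ^ k) (n ^ k))
  where
  interchange : ∀ a b c d → a * b * (c * d) ≡ a * c * (b * d)
  interchange = solve-∀

-- B t is a multiple of Γ(N + p/q)/Γ(N) at N = t + k + p: the differences of this sequence are explicit,
-- and its values along an arithmetic progression of large step approximate those of N ↦ N^(p/q).
module Gamma (p′ q′ k′ : ℕ) (B : ℕ → ℕ) (T : ℕ) where

  open ≤-Reasoning

  p q k : ℕ
  p = suc p′
  q = suc q′
  k = suc k′

  -- Starting above p makes N - p available as `t + k`, the base of the powers in `ratio-upper`.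
  N : ℕ → ℕ
  N t = t + k + p

  N≢0 : ∀ t → NonZero (N t)
  N≢0 t = >-nonZero (≤-trans (s≤s z≤n) (m≤n+m p (t + k)))

  module _ (rec : ∀ t → t < T → q * N t * B (suc t) ≡ (q * N t + p) * B t) where

    private
      V W : ℕ → ℕ
      V t = (q * N t) ^ q
      W t = (q * N t + p) ^ q

      V≢0 : ∀ t → NonZero (V t)
      V≢0 t = m^n≢0 (q * N t) q {{m*n≢0 q (N t) {{_}} {{N≢0 t}}}}

      rec^ : ∀ t → t < T → V t * B (suc t) ^ q ≡ W t * B t ^ q
      rec^ t t<T = trans (sym (^-distribʳ-*ℕ (q * N t) (B (suc t)) q))
        (trans (cong (_^ q) (rec t t<T)) (^-distribʳ-*ℕ (q * N t + p) (B t) q))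

      swap : ∀ a b c → a * (b * c) ≡ b * a * c
      swap = solve-∀
      assoc′ : ∀ a b c → a * b * c ≡ a * c * b
      assoc′ = solve-∀

    -- By `ratio-lower` the quotient of `B t ^ q` by `(N t + p′) ^ p` is nondecreasing in t.
    lower-bound-^ : ∀ t → t ≤ T → (N t + p′) ^ p * B 0 ^ q ≤ B t ^ q * (N 0 + p′) ^ p
    lower-bound-^ zero    _   = ≤-reflexive (*-comm ((N 0 + p′) ^ p) (B 0 ^ q))
    lower-bound-^ (suc t) t<T = *-cancelˡ-≤ (V t) {{V≢0 t}} (begin
      V t * (suc (N t + p′) ^ p * B 0 ^ q)      ≡⟨ swap (V t) (suc (N t + p′) ^ p) (B 0 ^ q) ⟩
      suc (N t + p′) ^ p * V t * B 0 ^ q        ≤⟨ *-monoˡ-≤ (B 0 ^ q) (ratio-lower (N t) q p′ {{N≢0 t}}) ⟩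
      W t * (N t + p′) ^ p * B 0 ^ q            ≡⟨ *-assoc (W t) _ _ ⟩
      W t * ((N t + p′) ^ p * B 0 ^ q)          ≤⟨ *-monoʳ-≤ (W t) (lower-bound-^ t (<⇒≤ t<T)) ⟩
      W t * (B t ^ q * (N 0 + p′) ^ p)          ≡⟨ *-assoc (W t) _ _ ⟨
      W t * B t ^ q * (N 0 + p′) ^ p            ≡⟨ cong (_* (N 0 + p′) ^ p) (rec^ t t<T) ⟨
      V t * B (suc t) ^ q * (N 0 + p′) ^ p      ≡⟨ *-assoc (V t) _ _ ⟩
      V t * (B (suc t) ^ q * (N 0 + p′) ^ p)    ∎)

    -- By `ratio-upper` the quotient of `B t ^ q` by `(t + k) ^ p` is nonincreasing in t.
    upper-bound-^ : ∀ t → t ≤ T → B t ^ q * k ^ p ≤ (t + k) ^ p * B 0 ^ q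
    upper-bound-^ zero    _   = ≤-reflexive (*-comm (B 0 ^ q) (k ^ p))
    upper-bound-^ (suc t) t<T = *-cancelˡ-≤ (V t) {{V≢0 t}} (begin
      V t * (B (suc t) ^ q * k ^ p)             ≡⟨ *-assoc (V t) _ _ ⟨
      V t * B (suc t) ^ q * k ^ p               ≡⟨ cong (_* k ^ p) (rec^ t t<T) ⟩
      W t * B t ^ q * k ^ p                     ≡⟨ *-assoc (W t) _ _ ⟩
      W t * (B t ^ q * k ^ p)                   ≤⟨ *-monoʳ-≤ (W t) (upper-bound-^ t (<⇒≤ t<T)) ⟩
      W t * ((t + k) ^ p * B 0 ^ q)             ≡⟨ *-assoc (W t) _ _ ⟨
      W t * (t + k) ^ p * B 0 ^ q               ≤⟨ *-monoˡ-≤ (B 0 ^ q) (ratio-upper (t + k) q p) ⟩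
      suc (t + k) ^ p * V t * B 0 ^ q           ≡⟨ swap (V t) (suc (t + k) ^ p) (B 0 ^ q) ⟨
      V t * (suc (t + k) ^ p * B 0 ^ q)         ∎)

    -- The quotient of `B t` by `N t ^ M` is nonincreasing, because 1 + p/(qN) ≤ 1 + M/N ≤ (1 +
    -- 1/N)^M.
    growth : ∀ M → p ≤ M * q → ∀ t → t ≤ T → N 0 ^ M * B t ≤ N t ^ M * B 0
    growth M p≤Mq zero    _   = ≤-refl
    growth M p≤Mq (suc t) t<T = *-cancelˡ-≤ (q * N t) {{m*n≢0 q (N t) {{_}} {{N≢0 t}}}} (begin
      q * N t * (N 0 ^ M * B (suc t))           ≡⟨ swap′ (q * N t) (N 0 ^ M) (B (suc t)) ⟩
      N 0 ^ M * (q * N t * B (suc t))           ≡⟨ cong (N 0 ^ M *_) (rec t t<T) ⟩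
      N 0 ^ M * ((q * N t + p) * B t)           ≡⟨ swap′ (N 0 ^ M) (q * N t + p) (B t) ⟩
      (q * N t + p) * (N 0 ^ M * B t)           ≤⟨ *-mono-≤ (+-monoʳ-≤ (q * N t) p≤Mq) (growth M p≤Mq t (<⇒≤ t<T)) ⟩
      (q * N t + M * q) * (N t ^ M * B 0)       ≡⟨ factor q (N t) M (N t ^ M) (B 0) ⟩
      q * (N t ^ M * (N t + M * 1)) * B 0       ≤⟨ *-monoˡ-≤ (B 0) (*-monoʳ-≤ q (bernoulli (N t) 1 M)) ⟩
      q * ((N t + 1) ^ M * N t) * B 0           ≡⟨ cong (λ n → q * (n ^ M * N t) * B 0) (+-comm (N t) 1) ⟩
      q * (N (suc t) ^ M * N t) * B 0           ≡⟨ factor′ q (N (suc t) ^ M) (N t) (B 0) ⟩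
      q * N t * (N (suc t) ^ M * B 0)           ∎)
      where
      swap′ : ∀ a b c → a * (b * c) ≡ b * (a * c)
      swap′ = solve-∀
      factor : ∀ q n m x b → (q * n + m * q) * (x * b) ≡ q * (x * (n + m * 1)) * b
      factor = solve-∀
      factor′ : ∀ q x n b → q * (x * n) * b ≡ q * n * (x * b)
      factor′ = solve-∀

    module _ (x′ : ℕ) where

      private
        x = suc x′
        c = p * x′
        -- Chosen so that `N t` is `N 0 * x`; thus `B t / B 0` approximates x^(p/q).
        t = N 0 * x′

      module _ (t≤T : t ≤ T) (large : p * c * suc x ^ p ≤ k) where

        private
          c≤k : c ≤ k
          c≤k = ≤-trans (m≤n*m c p) (≤-trans (m≤m*n (p * c) (suc x ^ p) {{m^n≢0 (suc x) p}}) large)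

          t+k≡ : t + k ≡ k * x + c
          t+k≡ = expand p x′ k
            where
            expand : ∀ p x′ k → (k + p) * x′ + k ≡ k * suc x′ + p * x′
            expand = solve-∀

          N+p′≡ : N t + p′ + p′ * x′ ≡ (N 0 + p′) * x
          N+p′≡ = expand p′ x′ k
            where
            expand : ∀ p′ x′ k → (k + suc p′) * x′ + k + suc p′ + p′ + p′ * x′ ≡ (k + suc p′ + p′) * suc x′
            expand = solve-∀

          -- (x + c/k)^p ≤ x^p + 1
          numerator≤ : (k * x + c) ^ p ≤ (x ^ p + 1) * k ^ p
          numerator≤ = *-cancelʳ-≤ (s ^ p) ((x ^ p + 1) * k ^ p) s (begin
            s ^ p * s                               ≤⟨ bernoulli⁻ (k * x) c p ⟩
            (k * x) ^ p * s + p * c * s ^ p         ≤⟨ +-monoʳ-≤ _ (*-monoʳ-≤ (p * c) (^-monoˡ-≤ p s≤)) ⟩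
            (k * x) ^ p * s + p * c * (k * suc x) ^ p
              ≡⟨ cong₂ (λ u v → u * s + p * c * v) (^-distribʳ-*ℕ k x p) (^-distribʳ-*ℕ k (suc x) p) ⟩
            k ^ p * x ^ p * s + p * c * (k ^ p * suc x ^ p) ≡⟨ regroup (k ^ p) (x ^ p) s (p * c) (suc x ^ p) ⟩
            k ^ p * (x ^ p * s + p * c * suc x ^ p) ≤⟨ *-monoʳ-≤ (k ^ p) (+-monoʳ-≤ (x ^ p * s) (≤-trans large k≤s)) ⟩
            k ^ p * (x ^ p * s + s)                 ≡⟨ regroup′ (k ^ p) (x ^ p) s ⟩
            (x ^ p + 1) * k ^ p * s                 ∎)
            where
            s = k * x + c
            k≤s : k ≤ s
            k≤s = ≤-trans (m≤m*n k x) (m≤m+n (k * x) c)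
            s≤ : s ≤ k * suc x
            s≤ = ≤-trans (+-monoʳ-≤ (k * x) c≤k) (≤-reflexive (trans (+-comm (k * x) k) (sym (*-suc k x))))
            instance
              s≢0 : NonZero s
              s≢0 = >-nonZero (≤-trans (s≤s z≤n) k≤s)
            regroup : ∀ a b s d e → a * b * s + d * (a * e) ≡ a * (b * s + d * e)
            regroup = solve-∀
            regroup′ : ∀ a b s → a * (b * s + s) ≡ (b + 1) * a * s
            regroup′ = solve-∀

          -- (x - d/a)^p ≥ x^p - 1
          denominator≤ : x ^ p * (N 0 + p′) ^ p ≤ (N t + p′) ^ p + (N 0 + p′) ^ p
          denominator≤ = *-cancelʳ-≤ (x ^ p * a ^ p) (b ^ p + a ^ p) (a * x) (begin
            x ^ p * a ^ p * (a * x)                 ≡⟨ cong (_* (a * x)) (trans (*-comm (x ^ p) (a ^ p)) (sym (^-distribʳ-*ℕ a x p))) ⟩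
            (a * x) ^ p * (a * x)                   ≡⟨ cong (λ s → s ^ p * s) N+p′≡ ⟨
            (b + d) ^ p * (b + d)                   ≤⟨ bernoulli⁻ b d p ⟩
            b ^ p * (b + d) + p * d * (b + d) ^ p   ≡⟨ cong (λ s → b ^ p * s + p * d * s ^ p) N+p′≡ ⟩
            b ^ p * (a * x) + p * d * (a * x) ^ p   ≡⟨ cong (λ s → b ^ p * (a * x) + p * d * s) (^-distribʳ-*ℕ a x p) ⟩
            b ^ p * (a * x) + p * d * (a ^ p * x ^ p) ≤⟨ +-monoʳ-≤ _ tail≤ ⟩
            b ^ p * (a * x) + a ^ p * (a * x)       ≡⟨ *-distribʳ-+ (a * x) (b ^ p) (a ^ p) ⟨
            (b ^ p + a ^ p) * (a * x)               ∎)
            where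
            a = N 0 + p′
            b = N t + p′
            d = p′ * x′
            swap′ : ∀ a b c → a * (b * c) ≡ b * (a * c)
            swap′ = solve-∀
            tail≤ : p * d * (a ^ p * x ^ p) ≤ a ^ p * (a * x)
            tail≤ = begin
              p * d * (a ^ p * x ^ p)               ≡⟨ swap′ (p * d) (a ^ p) (x ^ p) ⟩
              a ^ p * (p * d * x ^ p)               ≤⟨ *-monoʳ-≤ (a ^ p) (*-mono-≤ (*-monoʳ-≤ p (*-monoˡ-≤ x′ (n≤1+n p′))) (^-monoˡ-≤ p (n≤1+n x))) ⟩
              a ^ p * (p * c * suc x ^ p)           ≤⟨ *-monoʳ-≤ (a ^ p) large ⟩
              a ^ p * k                             ≤⟨ *-monoʳ-≤ (a ^ p) (≤-trans (≤-trans (m≤m+n k p) (m≤m+n (k + p) p′)) (m≤m*n a x)) ⟩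
              a ^ p * (a * x)                       ∎

        -- The error 1 of `numerator≤` is absorbed because a strict inequality between integers
        -- leaves a gap of at least 1.
        upper-value : ∀ φ → x ^ p < suc φ ^ q → B t ≤ suc φ * B 0
        upper-value φ x^p<φ^q = ^-cancelˡ-≤ℕ q′ (*-cancelʳ-≤ (B t ^ q) ((suc φ * B 0) ^ q) (k ^ p) {{m^n≢0 k p}} (begin
          B t ^ q * k ^ p                     ≤⟨ upper-bound-^ t t≤T ⟩
          (t + k) ^ p * B 0 ^ q               ≡⟨ cong (λ s → s ^ p * B 0 ^ q) t+k≡ ⟩
          (k * x + c) ^ p * B 0 ^ q           ≤⟨ *-monoˡ-≤ (B 0 ^ q) numerator≤ ⟩
          (x ^ p + 1) * k ^ p * B 0 ^ q       ≤⟨ *-monoˡ-≤ (B 0 ^ q) (*-monoˡ-≤ (k ^ p) (subst (_≤ suc φ ^ q) (sym (+-comm (x ^ p) 1)) x^p<φ^q)) ⟩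
          suc φ ^ q * k ^ p * B 0 ^ q         ≡⟨ assoc′ (suc φ ^ q) (k ^ p) (B 0 ^ q) ⟩
          suc φ ^ q * B 0 ^ q * k ^ p         ≡⟨ cong (_* k ^ p) (^-distribʳ-*ℕ (suc φ) (B 0) q) ⟨
          (suc φ * B 0) ^ q * k ^ p           ∎))

        -- The error 1 of `denominator≤` is absorbed by the passage from v to `suc v`, whose q-th
        -- powers differ by at least 1; this costs one unit of the value.
        lower-value : ∀ v → suc v ^ q ≤ x ^ p → v * B 0 ≤ B t
        lower-value v v^q≤x^p = ^-cancelˡ-≤ℕ q′ (*-cancelʳ-≤ ((v * B 0) ^ q) (B t ^ q) (a ^ p) {{m^n≢0 a p}} (begin
          (v * B 0) ^ q * a ^ p               ≡⟨ cong (_* a ^ p) (^-distribʳ-*ℕ v (B 0) q) ⟩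
          v ^ q * B 0 ^ q * a ^ p             ≡⟨ assoc′ (v ^ q) (B 0 ^ q) (a ^ p) ⟩
          v ^ q * a ^ p * B 0 ^ q             ≤⟨ *-monoˡ-≤ (B 0 ^ q) v^qa^p≤ ⟩
          (N t + p′) ^ p * B 0 ^ q            ≤⟨ lower-bound-^ t t≤T ⟩
          B t ^ q * a ^ p                     ∎))
          where
          a = N 0 + p′
          v^qa^p≤ : v ^ q * a ^ p ≤ (N t + p′) ^ p
          v^qa^p≤ = +-cancelʳ-≤ (a ^ p) (v ^ q * a ^ p) ((N t + p′) ^ p) (begin
            v ^ q * a ^ p + a ^ p             ≡⟨ +-comm (v ^ q * a ^ p) (a ^ p) ⟩
            suc (v ^ q) * a ^ p               ≤⟨ *-monoˡ-≤ (a ^ p) (≤-trans (^-monoˡ-< q (n<1+n v)) v^q≤x^p) ⟩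
            x ^ p * a ^ p                     ≤⟨ denominator≤ ⟩
            (N t + p′) ^ p + a ^ p            ∎)

-- Finite differences of integer sequences

Δ : (ℕ → ℤ) → ℕ → ℤ
Δ f n = f (suc n) ℤ.- f n

Δ^ : ℕ → (ℕ → ℤ) → ℕ → ℤ
Δ^ zero    f = f
Δ^ (suc m) f = Δ (Δ^ m f)

Δ^-cong : ∀ {f h} m t → (∀ j → j ≤ m → f (j + t) ≡ h (j + t)) → Δ^ m f t ≡ Δ^ m h t
Δ^-cong zero t f≗h = f≗h 0 z≤n
Δ^-cong {f} {h} (suc m) t f≗h = cong₂ ℤ._-_
  (Δ^-cong m (suc t) λ j j≤m → subst (λ s → f s ≡ h s) (sym (+-suc j t)) (f≗h (suc j) (s≤s j≤m)))
  (Δ^-cong m t λ j j≤m → f≗h j (m≤n⇒m≤1+n j≤m))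

Δ^-cong-∀ : ∀ {f h} → (∀ n → f n ≡ h n) → ∀ m t → Δ^ m f t ≡ Δ^ m h t
Δ^-cong-∀ f≗h m t = Δ^-cong m t λ j _ → f≗h (j + t)

Δ^-Δ : ∀ f m t → Δ^ m (Δ f) t ≡ Δ^ (suc m) f t
Δ^-Δ f zero    t = refl
Δ^-Δ f (suc m) t = cong₂ ℤ._-_ (Δ^-Δ f m (suc t)) (Δ^-Δ f m t)

Δ^-shift : ∀ f s m t → Δ^ m (λ n → f (s + n)) t ≡ Δ^ m f (s + t)
Δ^-shift f s zero    t = refl
Δ^-shift f s (suc m) t = cong₂ ℤ._-_
  (trans (Δ^-shift f s m (suc t)) (cong (Δ^ m f) (+-suc s t))) (Δ^-shift f s m t)

Δ^-+ : ∀ f h m t → Δ^ m (λ n → f n ℤ.+ h n) t ≡ Δ^ m f t ℤ.+ Δ^ m h t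
Δ^-+ f h zero    t = refl
Δ^-+ f h (suc m) t = trans (cong₂ ℤ._-_ (Δ^-+ f h m (suc t)) (Δ^-+ f h m t))
  (interchange (Δ^ m f (suc t)) (Δ^ m h (suc t)) (Δ^ m f t) (Δ^ m h t))
  where
  interchange : ∀ a b c d → (a ℤ.+ b) ℤ.- (c ℤ.+ d) ≡ (a ℤ.- c) ℤ.+ (b ℤ.- d)
  interchange = ℤ-Ring.solve-∀

Δ^-* : ∀ c f m t → Δ^ m (λ n → c ℤ.* f n) t ≡ c ℤ.* Δ^ m f t
Δ^-* c f zero    t = refl
Δ^-* c f (suc m) t = trans (cong₂ ℤ._-_ (Δ^-* c f m (suc t)) (Δ^-* c f m t))
  (distrib c (Δ^ m f (suc t)) (Δ^ m f t))
  where
  distrib : ∀ c a b → c ℤ.* a ℤ.- c ℤ.* b ≡ c ℤ.* (a ℤ.- b)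
  distrib = ℤ-Ring.solve-∀

∣+∣≤ : ∀ {a b A B} → ℤ.∣ a ∣ ≤ A → ℤ.∣ b ∣ ≤ B → ℤ.∣ a ℤ.+ b ∣ ≤ A + B
∣+∣≤ {a} {b} p q = ≤-trans (ℤₚ.∣i+j∣≤∣i∣+∣j∣ a b) (+-mono-≤ p q)

∣-∣≤ : ∀ {a b A B} → ℤ.∣ a ∣ ≤ A → ℤ.∣ b ∣ ≤ B → ℤ.∣ a ℤ.- b ∣ ≤ A + B
∣-∣≤ {a} {b} p q = ≤-trans (ℤₚ.∣i-j∣≤∣i∣+∣j∣ a b) (+-mono-≤ p q)

∣*∣≤ : ∀ {A} c {a} → ℤ.∣ a ∣ ≤ A → ℤ.∣ c ℤ.* a ∣ ≤ ℤ.∣ c ∣ * A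
∣*∣≤ c {a} p = ≤-trans (≤-reflexive (ℤₚ.∣i*j∣≡∣i∣*∣j∣ c a)) (*-monoʳ-≤ ℤ.∣ c ∣ p)

Δ^-bound : ∀ {f K} m t → (∀ j → j ≤ m → ℤ.∣ f (j + t) ∣ ≤ K) → ℤ.∣ Δ^ m f t ∣ ≤ 2 ^ m * K
Δ^-bound {K = K} zero t bound = ≤-trans (bound 0 z≤n) (≤-reflexive (sym (*-identityˡ K)))
Δ^-bound {f} {K} (suc m) t bound = ≤-trans
  (∣-∣≤ {Δ^ m f (suc t)} {Δ^ m f t}
    (Δ^-bound m (suc t) λ j j≤m → subst (λ s → ℤ.∣ f s ∣ ≤ K) (sym (+-suc j t)) (bound (suc j) (s≤s j≤m)))
    (Δ^-bound m t λ j j≤m → bound j (m≤n⇒m≤1+n j≤m)))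
  (≤-reflexive (double (2 ^ m) K))
  where
  double : ∀ a K → a * K + a * K ≡ 2 * a * K
  double = solve-∀

-- The factor u is affine with slope s, so of the Leibniz rule for higher differences only two terms
-- survive. Used for the recurrence of the Γ-quotient and for that of the remainders r.
leibniz : ∀ (u h : ℕ → ℤ) s → (∀ n → u (suc n) ≡ u n ℤ.+ s) → ∀ m n →
  Δ^ (suc m) (λ n → u n ℤ.* h n) n ≡ u n ℤ.* Δ^ (suc m) h n ℤ.+ + suc m ℤ.* s ℤ.* Δ^ m h (suc n)
leibniz u h s u-step zero n = trans (cong (λ v → v ℤ.* h (suc n) ℤ.- u n ℤ.* h n) (u-step n))
  (expand (u n) s (h (suc n)) (h n))
  where
  expand : ∀ u s a b → (u ℤ.+ s) ℤ.* a ℤ.- u ℤ.* b ≡ u ℤ.* (a ℤ.- b) ℤ.+ + 1 ℤ.* s ℤ.* a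
  expand = ℤ-Ring.solve-∀
leibniz u h s u-step (suc m) n = trans
  (cong₂ ℤ._-_ (leibniz u h s u-step m (suc n)) (leibniz u h s u-step m n))
  (trans (cong (λ v → v ℤ.* Δ^ (suc m) h (suc n) ℤ.+ + suc m ℤ.* s ℤ.* E₂ ℤ.- (u n ℤ.* Δ^ (suc m) h n ℤ.+ + suc m ℤ.* s ℤ.* E₁)) (u-step n))
    (trans (expand (u n) s (+ suc m) (Δ^ m h (suc (suc n))) (Δ^ m h (suc n)) (Δ^ m h n))
      (cong (λ c → u n ℤ.* Δ^ (suc (suc m)) h n ℤ.+ c ℤ.* s ℤ.* Δ^ (suc m) h (suc n)) (ℤₚ.+-comm (+ suc m) (+ 1)))))
  where
  E₂ = Δ^ m h (suc (suc n))
  E₁ = Δ^ m h (suc n)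
  expand : ∀ u s k c b a →
    (u ℤ.+ s) ℤ.* (c ℤ.- b) ℤ.+ k ℤ.* s ℤ.* c ℤ.- (u ℤ.* (b ℤ.- a) ℤ.+ k ℤ.* s ℤ.* b) ≡
    u ℤ.* ((c ℤ.- b) ℤ.- (b ℤ.- a)) ℤ.+ (k ℤ.+ + 1) ℤ.* s ℤ.* (c ℤ.- b)
  expand = ℤ-Ring.solve-∀

window : (ℕ → ℤ) → ℕ → ℕ → ℤ
window f zero    t = ℤ.0ℤ
window f (suc s) t = window f s t ℤ.+ f (s + t)

telescope : ∀ f s t → f (s + t) ℤ.- f t ≡ window (Δ f) s t
telescope f zero    t = ℤₚ.+-inverseʳ (f t)
telescope f (suc s) t = trans (split (f (suc s + t)) (f (s + t)) (f t)) (cong (ℤ._+ Δ f (s + t)) (telescope f s t))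
  where
  split : ∀ a b c → a ℤ.- c ≡ (b ℤ.- c) ℤ.+ (a ℤ.- b)
  split = ℤ-Ring.solve-∀

Δ^-window-bound : ∀ {f K} m s t → (∀ l → l < s → ℤ.∣ Δ^ m f (l + t) ∣ ≤ K) → ℤ.∣ Δ^ m (window f s) t ∣ ≤ s * K
Δ^-window-bound m zero t bound = ≤-reflexive (cong ℤ.∣_∣ (Δ^-zero m t))
  where
  Δ^-zero : ∀ m t → Δ^ m (λ _ → ℤ.0ℤ) t ≡ ℤ.0ℤ
  Δ^-zero zero    t = refl
  Δ^-zero (suc m) t = cong₂ ℤ._-_ (Δ^-zero m (suc t)) (Δ^-zero m t)
Δ^-window-bound {f} {K} m (suc s) t bound = begin
  ℤ.∣ Δ^ m (window f (suc s)) t ∣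
    ≡⟨ cong ℤ.∣_∣ (trans (Δ^-+ (window f s) (λ n → f (s + n)) m t) (cong (λ d → Δ^ m (window f s) t ℤ.+ d) (Δ^-shift f s m t))) ⟩
  ℤ.∣ Δ^ m (window f s) t ℤ.+ Δ^ m f (s + t) ∣
    ≤⟨ ∣+∣≤ {Δ^ m (window f s) t} {Δ^ m f (s + t)} (Δ^-window-bound m s t λ l l<s → bound l (m≤n⇒m≤1+n l<s)) (bound s ≤-refl) ⟩
  s * K + K  ≡⟨ +-comm (s * K) K ⟩
  K + s * K  ∎
  where open ≤-Reasoning

-- By telescoping, a difference of step Q is a sum of Q consecutive differences, and m such steps
-- give `Q ^ m` values of `Δ^ m f`. Their offsets i are at most (Q-1)m, written without subtraction;
-- the range matters because the Γ-like sequence satisfies its recurrence only up to T.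
subsample-bound : ∀ Q m {f K} x → (∀ i → i + m ≤ Q * m → ℤ.∣ Δ^ m f (i + Q * x) ∣ ≤ K) →
  ℤ.∣ Δ^ m (λ n → f (Q * n)) x ∣ ≤ Q ^ m * K
subsample-bound Q zero {K = K} x bound = ≤-trans (bound 0 z≤n) (≤-reflexive (sym (*-identityˡ K)))
subsample-bound Q (suc m) {f} {K} x bound = begin
  ℤ.∣ Δ^ (suc m) (λ n → f (Q * n)) x ∣
    ≡⟨ cong ℤ.∣_∣ (trans (sym (Δ^-Δ (λ n → f (Q * n)) m x)) (Δ^-cong-∀ step m x)) ⟩
  ℤ.∣ Δ^ m (λ n → window (Δ f) Q (Q * n)) x ∣
    ≤⟨ subsample-bound Q m x (λ i i+m≤ → Δ^-window-bound {Δ f} m Q (i + Q * x) λ l l<Q →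
         subst (λ d → ℤ.∣ d ∣ ≤ K) (trans (cong (Δ^ (suc m) f) (+-assoc l i (Q * x))) (sym (Δ^-Δ f m (l + (i + Q * x)))))
           (bound (l + i) (≤-trans (≤-reflexive (rearrange l i m)) (≤-trans (+-mono-≤ l<Q i+m≤) (≤-reflexive (sym (*-suc Q m))))))) ⟩
  Q ^ m * (Q * K)   ≡⟨ regroup (Q ^ m) Q K ⟩
  Q * Q ^ m * K     ∎
  where
  open ≤-Reasoning
  step : ∀ n → Δ (λ n → f (Q * n)) n ≡ window (Δ f) Q (Q * n)
  step n = trans (cong (λ s → f s ℤ.- f (Q * n)) (*-suc Q n)) (telescope f Q (Q * n))
  regroup : ∀ a b c → a * (b * c) ≡ b * a * c
  regroup = solve-∀
  rearrange : ∀ l i m → l + i + suc m ≡ suc l + (i + m)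
  rearrange = solve-∀

∣+-+∣≤ : ∀ {a b A} → a ≤ A → b ≤ A → ℤ.∣ + a ℤ.- + b ∣ ≤ A
∣+-+∣≤ {a} {b} a≤A b≤A = subst (_≤ _) (cong ℤ.∣_∣ (sym (ℤₚ.m-n≡m⊖n a b)))
  (≤-trans (ℤₚ.∣m⊝n∣≤m⊔n a b) (⊔-lub a≤A b≤A))

∣+-+∣≤-difference : ∀ {a b c} → a ≤ b + c → b ≤ a + c → ℤ.∣ + a ℤ.- + b ∣ ≤ c
∣+-+∣≤-difference {a} {b} {c} a≤b+c b≤a+c = subst (_≤ c) (cong ℤ.∣_∣ (sym (ℤₚ.m-n≡m⊖n a b))) (bound (≤-total a b))
  where
  bound : a ≤ b ⊎ b ≤ a → ℤ.∣ a ℤ.⊖ b ∣ ≤ c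
  bound (inj₁ a≤b) = subst (_≤ c) (sym (ℤₚ.∣⊖∣-≤ a≤b)) (m≤n+o⇒m∸n≤o b a b≤a+c)
  bound (inj₂ b≤a) = subst (_≤ c) (sym (trans (ℤₚ.∣m⊖n∣≡∣n⊖m∣ a b) (ℤₚ.∣⊖∣-≤ b≤a))) (m≤n+o⇒m∸n≤o a b a≤b+c)

-- Bounded differences of power-like integer sequences

module _ (p′ q′ k′ : ℕ) (B : ℕ → ℕ) (T : ℕ) where

  open Gamma p′ q′ k′ B T

  module _ (rec : ∀ t → t < T → q * N t * B (suc t) ≡ (q * N t + p) * B t) where

    private
      β u : ℕ → ℤ
      β t = + B t
      u t = + (q * N t)

      u-step : ∀ t → u (suc t) ≡ u t ℤ.+ + q
      u-step t = cong +_ (trans (*-suc q (N t)) (+-comm q (q * N t)))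

      recᶻ : ∀ t → t < T → u t ℤ.* Δ β t ≡ + p ℤ.* β t
      recᶻ t t<T = trans (expand (u t) (β (suc t)) (β t))
        (trans (cong (ℤ._- u t ℤ.* β t) (trans (sym (ℤₚ.pos-* (q * N t) (B (suc t)))) (trans (cong +_ (rec t t<T))
          (ℤₚ.pos-* (q * N t + p) (B t)))))
        (collect (u t) (+ p) (β t)))
        where
        expand : ∀ u a b → u ℤ.* (a ℤ.- b) ≡ u ℤ.* a ℤ.- u ℤ.* b
        expand = ℤ-Ring.solve-∀
        collect : ∀ u p b → (u ℤ.+ p) ℤ.* b ℤ.- u ℤ.* b ≡ p ℤ.* b
        collect = ℤ-Ring.solve-∀

      -- For Γ(N+a)/Γ(N) with a = p/q the i-th difference is a constant times Γ(N+a)/Γ(N+i), and its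
      -- difference is the same with the factor (a-i)/(N+i). The proof applies `leibniz` to i
      -- differences of `recᶻ`, which has no need of Γ itself.
      Δ^-rec : ∀ i t → i + t < T → + (q * (N t + i)) ℤ.* Δ^ (suc i) β t ≡ (+ p ℤ.- + (i * q)) ℤ.* Δ^ i β t
      Δ^-rec zero t t<T = trans (cong (λ n → + (q * n) ℤ.* Δ β t) (+-identityʳ (N t)))
        (trans (recᶻ t t<T) (cong (ℤ._* β t) (sym (ℤₚ.+-identityʳ (+ p)))))
      Δ^-rec (suc i) t i+t<T = finish
        (u t) (+ q) (+ suc i) (+ p) (Δ^ (suc (suc i)) β t) (Δ^ (suc i) β t) (Δ^ (suc i) β (suc t))
        coefficient₁ (ℤₚ.pos-* (suc i) q) refl
        (begin
          u t ℤ.* Δ^ (suc (suc i)) β t ℤ.+ + suc i ℤ.* + q ℤ.* Δ^ (suc i) β (suc t)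
            ≡⟨ cong₂ (λ a b → u t ℤ.* a ℤ.+ + suc i ℤ.* + q ℤ.* b) (sym (Δ^-Δ β (suc i) t)) (sym (Δ^-Δ β i (suc t))) ⟩
          u t ℤ.* Δ^ (suc i) (Δ β) t ℤ.+ + suc i ℤ.* + q ℤ.* Δ^ i (Δ β) (suc t)
            ≡⟨ leibniz u (Δ β) (+ q) u-step i t ⟨
          Δ^ (suc i) (λ n → u n ℤ.* Δ β n) t
            ≡⟨ Δ^-cong (suc i) t (λ j j≤ → recᶻ (j + t) (≤-<-trans (+-monoˡ-≤ t j≤) i+t<T)) ⟩
          Δ^ (suc i) (λ n → + p ℤ.* β n) t
            ≡⟨ Δ^-* (+ p) β (suc i) t ⟩
          + p ℤ.* Δ^ (suc i) β t ∎)
        where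
        open ≡-Reasoning
        coefficient₁ : + (q * (N t + suc i)) ≡ u t ℤ.+ + q ℤ.* + suc i
        coefficient₁ = trans (cong +_ (*-distribˡ-+ q (N t) (suc i))) (cong (λ c → u t ℤ.+ c) (ℤₚ.pos-* q (suc i)))
        finish : ∀ {c e} u q i p D₂ D₁ D₁′ → c ≡ u ℤ.+ q ℤ.* i → e ≡ i ℤ.* q → D₂ ≡ D₁′ ℤ.- D₁ →
          u ℤ.* D₂ ℤ.+ i ℤ.* q ℤ.* D₁′ ≡ p ℤ.* D₁ → c ℤ.* D₂ ≡ (p ℤ.- e) ℤ.* D₁
        finish u q i p D₂ D₁ D₁′ refl refl refl eq = trans (lhs u q i D₁ D₁′) (trans (cong (ℤ._- i ℤ.* q ℤ.* D₁) eq) (rhs q i p D₁))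
          where
          lhs : ∀ u q i a b → (u ℤ.+ q ℤ.* i) ℤ.* (b ℤ.- a) ≡ u ℤ.* (b ℤ.- a) ℤ.+ i ℤ.* q ℤ.* b ℤ.- i ℤ.* q ℤ.* a
          lhs = ℤ-Ring.solve-∀
          rhs : ∀ q i p a → p ℤ.* a ℤ.- i ℤ.* q ℤ.* a ≡ (p ℤ.- i ℤ.* q) ℤ.* a
          rhs = ℤ-Ring.solve-∀

      module _ (M : ℕ) (p≤Mq : p ≤ M * q) where

        open ≤-Reasoning

        Δ^-step : ∀ i t → i ≤ M → i + t < T → N t * ℤ.∣ Δ^ (suc i) β t ∣ ≤ M * ℤ.∣ Δ^ i β t ∣
        Δ^-step i t i≤M i+t<T = *-cancelˡ-≤ q (begin
          q * (N t * a)                   ≤⟨ *-monoʳ-≤ q (*-monoˡ-≤ a (m≤m+n (N t) i)) ⟩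
          q * ((N t + i) * a)             ≡⟨ *-assoc q (N t + i) a ⟨
          q * (N t + i) * a               ≡⟨ ℤₚ.∣i*j∣≡∣i∣*∣j∣ (+ (q * (N t + i))) (Δ^ (suc i) β t) ⟨
          ℤ.∣ + (q * (N t + i)) ℤ.* Δ^ (suc i) β t ∣ ≡⟨ cong ℤ.∣_∣ (Δ^-rec i t i+t<T) ⟩
          ℤ.∣ (+ p ℤ.- + (i * q)) ℤ.* Δ^ i β t ∣ ≡⟨ ℤₚ.∣i*j∣≡∣i∣*∣j∣ (+ p ℤ.- + (i * q)) (Δ^ i β t) ⟩
          ℤ.∣ + p ℤ.- + (i * q) ∣ * b     ≤⟨ *-monoˡ-≤ b (∣+-+∣≤ {p} {i * q} p≤Mq (*-monoˡ-≤ q i≤M)) ⟩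
          M * q * b                       ≡⟨ regroup M q b ⟩
          q * (M * b)                     ∎)
          where
          a = ℤ.∣ Δ^ (suc i) β t ∣
          b = ℤ.∣ Δ^ i β t ∣
          regroup : ∀ m q b → m * q * b ≡ q * (m * b)
          regroup = solve-∀

        Δ^-bound-local : ∀ i t → i ≤ M → i + t ≤ T → N t ^ i * ℤ.∣ Δ^ i β t ∣ ≤ M ^ i * B t
        Δ^-bound-local zero    t _   _     = ≤-refl
        Δ^-bound-local (suc i) t i<M i+t<T = begin
          N t * N t ^ i * a         ≡⟨ regroup (N t) (N t ^ i) a ⟩
          N t ^ i * (N t * a)       ≤⟨ *-monoʳ-≤ (N t ^ i) (Δ^-step i t (<⇒≤ i<M) i+t<T) ⟩
          N t ^ i * (M * b)         ≡⟨ regroup′ (N t ^ i) M b ⟩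
          M * (N t ^ i * b)         ≤⟨ *-monoʳ-≤ M (Δ^-bound-local i t (<⇒≤ i<M) (<⇒≤ i+t<T)) ⟩
          M * (M ^ i * B t)         ≡⟨ *-assoc M (M ^ i) (B t) ⟨
          M * M ^ i * B t           ∎
          where
          a = ℤ.∣ Δ^ (suc i) β t ∣
          b = ℤ.∣ Δ^ i β t ∣
          regroup : ∀ n x a → n * x * a ≡ x * (n * a)
          regroup = solve-∀
          regroup′ : ∀ x m b → x * (m * b) ≡ m * (x * b)
          regroup′ = solve-∀

        -- The local bound has `B t / N t ^ M` on its right, and by `growth` this is largest at t =
        -- 0.
        Δ^-bound-uniform : ∀ t → M + t ≤ T → N 0 ^ M * ℤ.∣ Δ^ M β t ∣ ≤ M ^ M * B 0
        Δ^-bound-uniform t M+t≤T = *-cancelˡ-≤ (N t ^ M) {{m^n≢0 (N t) M {{N≢0 t}}}} (begin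
          N t ^ M * (N 0 ^ M * a)   ≡⟨ regroup (N t ^ M) (N 0 ^ M) a ⟩
          N 0 ^ M * (N t ^ M * a)   ≤⟨ *-monoʳ-≤ (N 0 ^ M) (Δ^-bound-local M t ≤-refl M+t≤T) ⟩
          N 0 ^ M * (M ^ M * B t)   ≡⟨ regroup (N 0 ^ M) (M ^ M) (B t) ⟩
          M ^ M * (N 0 ^ M * B t)   ≤⟨ *-monoʳ-≤ (M ^ M) (growth rec M p≤Mq t (m+n≤o⇒n≤o M M+t≤T)) ⟩
          M ^ M * (N t ^ M * B 0)   ≡⟨ regroup (M ^ M) (N t ^ M) (B 0) ⟩
          N t ^ M * (M ^ M * B 0)   ∎)
          where
          a = ℤ.∣ Δ^ M β t ∣
          regroup : ∀ x y z → x * (y * z) ≡ y * (x * z)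
          regroup = solve-∀

    -- The step is `N 0`, so the factor `N 0 ^ M` lost in `subsample-bound` cancels the one gained
    -- in `Δ^-bound-uniform`.
    Δ^-bound-subsampled : ∀ M → p ≤ M * q → ∀ x → N 0 * (M + x) ≤ T →
      ℤ.∣ Δ^ M (λ n → + B (N 0 * n)) x ∣ ≤ M ^ M * B 0
    Δ^-bound-subsampled M p≤Mq x fits = ≤-trans
      (subsample-bound (N 0) M {β} x λ i i+M≤ →
        -- `subsample-bound` wants an integral bound, for which the integer quotient of
        -- `M ^ M * B 0` by `Q^M` serves; multiplied by `Q^M` again it does not exceed the dividend.
        ≤-trans (≤-reflexive (sym (m*n/n≡m ℤ.∣ Δ^ M β (i + N 0 * x) ∣ Q^M)))
          (/-monoˡ-≤ Q^M (≤-trans (≤-reflexive (*-comm ℤ.∣ Δ^ M β (i + N 0 * x) ∣ Q^M))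
            (Δ^-bound-uniform M p≤Mq (i + N 0 * x)
              (≤-trans (≤-reflexive (rearrange M i (N 0 * x)))
                (≤-trans (+-monoˡ-≤ (N 0 * x) i+M≤) (≤-trans (≤-reflexive (sym (*-distribˡ-+ (N 0) M x))) fits)))))))
      (≤-trans (≤-reflexive (*-comm Q^M _)) (m/n*n≤m (M ^ M * B 0) Q^M))
      where
      Q^M = N 0 ^ M
      instance
        Q^M≢0 : NonZero Q^M
        Q^M≢0 = m^n≢0 (N 0) M {{N≢0 0}}
      rearrange : ∀ m i y → m + (i + y) ≡ i + m + y
      rearrange = solve-∀

-- The recurrence divides by q(t+N₀) at each step. Multiplying by all denominators up to T in
-- advance keeps the values integral: `product t` is the product of q(s+N₀)+p over s < t times that
-- of q(s+N₀) over t ≤ s < T.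
module GammaProduct (p q N₀ T : ℕ) .{{_ : NonZero q}} .{{_ : NonZero N₀}} where

  private
    numerator : ℕ → ℕ
    numerator zero    = 1
    numerator (suc t) = (q * (t + N₀) + p) * numerator t

    denominator : ℕ → ℕ → ℕ
    denominator t zero    = 1
    denominator t (suc s) = q * (t + N₀) * denominator (suc t) s

  product : ℕ → ℕ
  product t = numerator t * denominator t (T ∸ t)

  product-rec : ∀ t → t < T → q * (t + N₀) * product (suc t) ≡ (q * (t + N₀) + p) * product t
  product-rec t t<T = trans
    (regroup (q * (t + N₀)) (q * (t + N₀) + p) (numerator t) (denominator (suc t) (T ∸ suc t)))
    (cong (λ s → (q * (t + N₀) + p) * (numerator t * denominator t s)) (sym (+-∸-assoc 1 t<T)))
    where
    regroup : ∀ a b n d → a * (b * n * d) ≡ b * (n * (a * d))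
    regroup = solve-∀

  product-zero-positive : 0 < product 0
  product-zero-positive = subst (0 <_) (sym (*-identityˡ (denominator 0 T))) (positive 0 T)
    where
    positive : ∀ t s → 0 < denominator t s
    positive t zero    = z<s
    positive t (suc s) = *-mono-< {0} {q * (t + N₀)} {0} (*-mono-< {0} {q} {0} (>-nonZero⁻¹ q) (≤-trans (>-nonZero⁻¹ N₀) (m≤n+m N₀ t))) (positive (suc t) s)

-- One exponent p/q has to serve the whole window n, …, n + M.
PowerLike : ℕ → (ℕ → ℕ) → Set
PowerLike M φ = ∀ n → ∃[ p′ ] ∃[ q′ ] suc p′ ≤ M * suc q′ ×
  (∀ j → j ≤ M → suc (j + n) ^ suc p′ < suc (φ (j + n)) ^ suc q′ × pred (φ (j + n)) ^ suc q′ ≤ suc (j + n) ^ suc p′)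

-- On the window, `B 0 * φ j` is `B (N 0 * j)` up to `2 * B 0`. The main term contributes `M ^ M`,
-- the M-fold difference of the errors `2 ^ M * 2`; the factor `B 0`, which depends on the window,
-- cancels.
powerLike-Δ^-bound : ∀ M φ → PowerLike M φ → ∀ n → ℤ.∣ Δ^ M (λ j → + φ j) n ∣ ≤ M ^ M + 2 ^ M * 2
powerLike-Δ^-bound M φ pl n with pl n
... | p′ , q′ , p≤Mq , near = *-cancelˡ-≤ (B 0) {{>-nonZero product-zero-positive}} (begin
  B 0 * ℤ.∣ Δ^ M (λ j → + φ j) n ∣                          ≡⟨ ℤₚ.∣i*j∣≡∣i∣*∣j∣ (+ B 0) (Δ^ M (λ j → + φ j) n) ⟨
  ℤ.∣ + B 0 ℤ.* Δ^ M (λ j → + φ j) n ∣                      ≡⟨ cong ℤ.∣_∣ (Δ^-* (+ B 0) (λ j → + φ j) M n) ⟨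
  ℤ.∣ Δ^ M (λ j → + B 0 ℤ.* + φ j) n ∣                      ≡⟨ cong ℤ.∣_∣ (trans (Δ^-cong-∀ split M n) (Δ^-+ (λ j → + B (N 0 * j)) error M n)) ⟩
  ℤ.∣ Δ^ M (λ j → + B (N 0 * j)) n ℤ.+ Δ^ M error n ∣
    ≤⟨ ∣+∣≤ {Δ^ M (λ j → + B (N 0 * j)) n} {Δ^ M error n} (Δ^-bound-subsampled p′ q′ k′ B T product-rec′ M p≤Mq n ≤-refl)
         (Δ^-bound {error} M n error≤) ⟩
  M ^ M * B 0 + 2 ^ M * (2 * B 0)                           ≡⟨ collect (M ^ M) (B 0) (2 ^ M) ⟩
  B 0 * (M ^ M + 2 ^ M * 2)                                 ∎)
  where
  open ≤-Reasoning
  p = suc p′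
  q = suc q′
  X = M + n
  -- The hypothesis `large` at the last sample X, which implies it at all others; `T` is the last
  -- index sampled.
  k′ = p * (p * X) * suc (suc X) ^ p
  N₀ = suc k′ + p
  T = N₀ * (M + n)
  open GammaProduct p q N₀ T
  B : ℕ → ℕ
  B = product
  open Gamma p′ q′ k′ B T using (N)
  N≡ : ∀ t → N t ≡ t + N₀
  N≡ t = +-assoc t (suc k′) p
  product-rec′ : ∀ t → t < T → q * N t * B (suc t) ≡ (q * N t + p) * B t
  product-rec′ t t<T = subst (λ m → q * m * B (suc t) ≡ (q * m + p) * B t) (sym (N≡ t)) (product-rec t t<T)
  error : ℕ → ℤ
  error j = + (B 0 * φ j) ℤ.- + B (N 0 * j)
  split : ∀ j → + B 0 ℤ.* + φ j ≡ + B (N 0 * j) ℤ.+ error j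
  split j = trans (sym (ℤₚ.pos-* (B 0) (φ j))) (cancel (+ (B 0 * φ j)) (+ B (N 0 * j)))
    where
    cancel : ∀ a b → a ≡ b ℤ.+ (a ℤ.- b)
    cancel = ℤ-Ring.solve-∀
  collect : ∀ a b c → a * b + c * (2 * b) ≡ b * (a + c * 2)
  collect = solve-∀
  error≤ : ∀ j → j ≤ M → ℤ.∣ error (j + n) ∣ ≤ 2 * B 0
  error≤ j j≤M = ∣+-+∣≤-difference {B 0 * φ x′} {B (N 0 * x′)} (from-below (φ x′) refl) from-above
    where
    x′ = j + n
    x′≤X : x′ ≤ X
    x′≤X = +-monoˡ-≤ n j≤M
    fits : N 0 * x′ ≤ T
    fits = *-monoʳ-≤ N₀ x′≤X
    large : p * (p * x′) * suc (suc x′) ^ p ≤ suc k′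
    large = ≤-trans (*-mono-≤ (*-monoʳ-≤ p (*-monoʳ-≤ p x′≤X)) (^-monoˡ-≤ p (s≤s (s≤s x′≤X)))) (n≤1+n k′)
    from-above : B (N 0 * x′) ≤ B 0 * φ x′ + 2 * B 0
    from-above = begin
      B (N 0 * x′)           ≤⟨ Gamma.upper-value p′ q′ k′ B T product-rec′ x′ fits large (φ x′) (proj₁ (near j j≤M)) ⟩
      suc (φ x′) * B 0       ≤⟨ m≤m+n _ (B 0) ⟩
      suc (φ x′) * B 0 + B 0 ≡⟨ rearrange (φ x′) (B 0) ⟩
      B 0 * φ x′ + 2 * B 0   ∎
      where
      rearrange : ∀ a b → suc a * b + b ≡ b * a + 2 * b
      rearrange = solve-∀
    from-below : ∀ a → φ x′ ≡ a → B 0 * φ x′ ≤ B (N 0 * x′) + 2 * B 0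
    -- `PowerLike` bounds only the predecessor of the value and `lower-value` loses another unit,
    -- hence the allowance `2 * B 0`; it covers the values 0 and 1 trivially.
    from-below (suc (suc v)) eq = begin
      B 0 * φ x′             ≡⟨ cong (B 0 *_) eq ⟩
      B 0 * suc (suc v)      ≡⟨ rearrange v (B 0) ⟩
      v * B 0 + 2 * B 0      ≤⟨ +-monoˡ-≤ (2 * B 0) (Gamma.lower-value p′ q′ k′ B T product-rec′ x′ fits large v
                                  (subst (λ a → pred a ^ q ≤ suc x′ ^ p) eq (proj₂ (near j j≤M)))) ⟩
      B (N 0 * x′) + 2 * B 0 ∎
      where
      rearrange : ∀ v b → b * suc (suc v) ≡ v * b + 2 * b
      rearrange = solve-∀
    from-below zero eq = ≤-trans (≤-reflexive (trans (cong (B 0 *_) eq) (*-zeroʳ (B 0)))) z≤n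
    from-below (suc zero) eq = ≤-trans (≤-reflexive (trans (cong (B 0 *_) eq) (*-identityʳ (B 0))))
      (≤-trans (m≤n*m (B 0) 2) (m≤n+m (2 * B 0) (B (N 0 * x′))))

-- Integer solutions of r(n+1) = (n+1) r(n) + g(n)

BoundedDifference : ℕ → (ℕ → ℤ) → Set
BoundedDifference m f = ∃[ C ] ∀ n → ℤ.∣ Δ^ m f n ∣ ≤ C

boundedDifference-raise : ∀ {f m} d → BoundedDifference m f → BoundedDifference (d + m) f
boundedDifference-raise         zero    b = b
boundedDifference-raise {f} {m} (suc d) b with boundedDifference-raise {f} d b
... | C , bound = C + C , λ n → ∣-∣≤ {Δ^ (d + m) f (suc n)} {Δ^ (d + m) f n} (bound (suc n)) (bound n)

EventuallyPolynomial : (ℕ → ℤ) → Set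
EventuallyPolynomial f = ∃[ m ] ∃[ L ] ∀ n → L ≤ n → Δ^ m f n ≡ ℤ.0ℤ

k+n≤k*n : ∀ k n → suc k + n ≤ suc k * suc n
k+n≤k*n k n = subst (suc k + n ≤_) (sym (*-suc (suc k) n)) (+-monoʳ-≤ (suc k) (m≤n*m n (suc k)))

∣i∣<1⇒i≡0 : ∀ {i} → ℤ.∣ i ∣ < 1 → i ≡ ℤ.0ℤ
∣i∣<1⇒i≡0 lt = ℤₚ.∣i∣≡0⇒i≡0 (n<1⇒n≡0 lt)

module Recurrence (r g : ℕ → ℤ) (rec : ∀ n → r (suc n) ≡ + suc n ℤ.* r n ℤ.+ g n)
  (vanishing : ∀ c → ∃[ L ] ∀ n → L ≤ n → c * ℤ.∣ r n ∣ < n !) where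

  open ≤-Reasoning

  private
    scaled-≤ : ∀ n → suc n * ℤ.∣ r n ∣ ≤ ℤ.∣ r (suc n) ∣ + ℤ.∣ g n ∣
    scaled-≤ n = begin
      suc n * ℤ.∣ r n ∣           ≡⟨ ℤₚ.∣i*j∣≡∣i∣*∣j∣ (+ suc n) (r n) ⟨
      ℤ.∣ + suc n ℤ.* r n ∣       ≡⟨ cong ℤ.∣_∣ (trans (cancel (+ suc n ℤ.* r n) (g n)) (cong (ℤ._- g n) (sym (rec n)))) ⟩
      ℤ.∣ r (suc n) ℤ.- g n ∣     ≤⟨ ℤₚ.∣i-j∣≤∣i∣+∣j∣ (r (suc n)) (g n) ⟩
      ℤ.∣ r (suc n) ∣ + ℤ.∣ g n ∣ ∎
      where
      cancel : ∀ a b → a ≡ (a ℤ.+ b) ℤ.- b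
      cancel = ℤ-Ring.solve-∀

  module _ (K s : ℕ) (g≤ : ∀ n → ℤ.∣ g n ∣ ≤ K * suc (suc n) ^ s) where

    private
      W : ℕ → ℕ
      -- A supersolution of the recurrence. Raising n by one costs at most the factor `2 ^ s`, so
      -- for n ≥ `2 ^ s` the coefficient 2K leaves room for the source: K + 2K · 2^s ≤ 2K(n+1).
      W n = 2 * K * suc (suc n) ^ s

      W-rec : ∀ n → 2 ^ s ≤ n → ℤ.∣ g n ∣ + W (suc n) ≤ suc n * W n
      W-rec n 2^s≤n = begin
        ℤ.∣ g n ∣ + W (suc n)                 ≤⟨ +-mono-≤ (g≤ n) (*-monoʳ-≤ (2 * K) (^-monoˡ-≤ s (k+n≤k*n 1 (suc n)))) ⟩
        K * y + 2 * K * (2 * suc (suc n)) ^ s ≡⟨ cong (λ z → K * y + 2 * K * z) (^-distribʳ-*ℕ 2 (suc (suc n)) s) ⟩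
        K * y + 2 * K * (2 ^ s * y)           ≡⟨ collect K (2 ^ s) y ⟩
        (1 + 2 * 2 ^ s) * (K * y)             ≤⟨ *-monoˡ-≤ (K * y) (s≤s (≤-trans (*-monoʳ-≤ 2 2^s≤n) (n≤1+n (2 * n)))) ⟩
        (2 + 2 * n) * (K * y)                 ≡⟨ regroup n K y ⟩
        suc n * W n                           ∎
        where
        y = suc (suc n) ^ s
        collect : ∀ k t y → k * y + 2 * k * (t * y) ≡ (1 + 2 * t) * (k * y)
        collect = solve-∀
        regroup : ∀ n k y → (2 + 2 * n) * (k * y) ≡ suc n * (2 * k * y)
        regroup = solve-∀

      -- Once |r| exceeds W it grows like n!.
      runaway : ∀ n → 2 ^ s ≤ n → W n < ℤ.∣ r n ∣ → ∀ j → n ! * W (j + n) + (j + n) ! ≤ n ! * ℤ.∣ r (j + n) ∣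
      runaway n _ W<r zero = begin
        n ! * W n + n !       ≡⟨ trans (+-comm (n ! * W n) (n !)) (sym (*-suc (n !) (W n))) ⟩
        n ! * suc (W n)       ≤⟨ *-monoʳ-≤ (n !) W<r ⟩
        n ! * ℤ.∣ r n ∣       ∎
      runaway n 2^s≤n W<r (suc j) = +-cancelʳ-≤ (n ! * ℤ.∣ g m ∣) _ _ (begin
        n ! * W (suc m) + suc m * m ! + n ! * ℤ.∣ g m ∣ ≡⟨ regroup (n !) (W (suc m)) (suc m * m !) ℤ.∣ g m ∣ ⟩
        n ! * (ℤ.∣ g m ∣ + W (suc m)) + suc m * m !     ≤⟨ +-monoˡ-≤ (suc m * m !) (*-monoʳ-≤ (n !) (W-rec m (≤-trans 2^s≤n (m≤n+m n j)))) ⟩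
        n ! * (suc m * W m) + suc m * m !               ≡⟨ regroup′ (n !) (suc m) (W m) (m !) ⟩
        suc m * (n ! * W m + m !)                       ≤⟨ *-monoʳ-≤ (suc m) (runaway n 2^s≤n W<r j) ⟩
        suc m * (n ! * ℤ.∣ r m ∣)                       ≡⟨ swap (suc m) (n !) ℤ.∣ r m ∣ ⟩
        n ! * (suc m * ℤ.∣ r m ∣)                       ≤⟨ *-monoʳ-≤ (n !) (scaled-≤ m) ⟩
        n ! * (ℤ.∣ r (suc m) ∣ + ℤ.∣ g m ∣)             ≡⟨ *-distribˡ-+ (n !) ℤ.∣ r (suc m) ∣ ℤ.∣ g m ∣ ⟩
        n ! * ℤ.∣ r (suc m) ∣ + n ! * ℤ.∣ g m ∣         ∎)
        where
        m = j + n
        regroup : ∀ f w t g → f * w + t + f * g ≡ f * (g + w) + t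
        regroup = solve-∀
        regroup′ : ∀ f m w t → f * (m * w) + m * t ≡ m * (f * w + t)
        regroup′ = solve-∀
        swap : ∀ a b c → a * (b * c) ≡ b * (a * c)
        swap = solve-∀

    -- An excess of |r| over W is multiplied by at least n+1 at each step, so a single excess would
    -- force |r(m)| ≥ m!/n! for all m ≥ n. This contradicts `vanishing` for c = n!.
    remainder-bound : ∀ n → 2 ^ s ≤ n → ℤ.∣ r n ∣ ≤ 2 * K * suc (suc n) ^ s
    remainder-bound n 2^s≤n = ≮⇒≥ λ W<r → let (L , small) = vanishing (n !) in
      <⇒≱ (small (L + n) (m≤m+n L n)) (≤-trans (m≤n+m _ (n ! * W (L + n))) (runaway n 2^s≤n W<r L))

  private
    Growth : ℕ → ℕ → Set
    Growth m s = ∃[ A ] ∃[ L ] ∀ n → L ≤ n → ℤ.∣ Δ^ m r n ∣ ≤ A * suc n ^ s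

    Δ^-rec : ∀ m n → + suc n ℤ.* Δ^ (suc m) r n ≡
      Δ^ (suc m) r (suc n) ℤ.- (Δ^ (suc m) g n ℤ.+ + suc m ℤ.* Δ^ m r (suc n))
    Δ^-rec m n = solve-for (+ suc n ℤ.* Δ^ (suc m) r n) (+ suc m) (Δ^ m r (suc n)) (Δ^ (suc m) g n) (trans
      (cong (ℤ._+ Δ^ (suc m) g n) (sym (leibniz (λ n → + suc n) r (+ 1) (λ n → cong +_ (+-comm 1 (suc n))) m n)))
      (trans (sym (Δ^-+ (λ n → + suc n ℤ.* r n) g (suc m) n))
        (trans (Δ^-cong-∀ (λ n → sym (rec n)) (suc m) n) (Δ^-shift r 1 (suc m) n))))
      where
      solve-for : ∀ a k b c {d} → (a ℤ.+ k ℤ.* + 1 ℤ.* b) ℤ.+ c ≡ d → a ≡ d ℤ.- (c ℤ.+ k ℤ.* b)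
      solve-for a k b c refl = identity a k b c
        where
        identity : ∀ a k b c → a ≡ ((a ℤ.+ k ℤ.* + 1 ℤ.* b) ℤ.+ c) ℤ.- (c ℤ.+ k ℤ.* b)
        identity = ℤ-Ring.solve-∀

    -- The right side of `Δ^-rec` consists of a bounded term and of values of `Δ^ m r` at n+1 and
    -- n+2, so it has order n^s; the left side carries the additional factor n+1, and this is the
    -- exponent gained.
    Δ^-growth : ∀ m s → BoundedDifference (suc m) g → Growth m s →
      ∃[ A ] ∃[ L ] ∀ n → L ≤ n → suc n * ℤ.∣ Δ^ (suc m) r n ∣ ≤ A * suc n ^ s
    Δ^-growth m s (C , g≤C) (A , L , r≤) = A * 3 ^ s + A * 3 ^ s + (C + suc m * (A * 3 ^ s)) , L , λ n L≤n →
      let y = suc n ^ s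
          r₁≤ = bound 1 (s≤s z≤n) n L≤n
          r₂≤ = bound 2 ≤-refl n L≤n
      in begin
        suc n * ℤ.∣ Δ^ (suc m) r n ∣     ≡⟨ ℤₚ.∣i*j∣≡∣i∣*∣j∣ (+ suc n) (Δ^ (suc m) r n) ⟨
        ℤ.∣ + suc n ℤ.* Δ^ (suc m) r n ∣ ≡⟨ cong ℤ.∣_∣ (Δ^-rec m n) ⟩
        ℤ.∣ Δ^ (suc m) r (suc n) ℤ.- (Δ^ (suc m) g n ℤ.+ + suc m ℤ.* Δ^ m r (suc n)) ∣
          ≤⟨ ∣-∣≤ {Δ^ (suc m) r (suc n)} (∣-∣≤ {Δ^ m r (suc (suc n))} {Δ^ m r (suc n)} r₂≤ r₁≤)
               (∣+∣≤ {Δ^ (suc m) g n} (≤-trans (g≤C n) (m≤m*n C y {{m^n≢0 (suc n) s}})) (∣*∣≤ (+ suc m) {Δ^ m r (suc n)} r₁≤)) ⟩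
        (A * 3 ^ s * y + A * 3 ^ s * y) + (C * y + suc m * (A * 3 ^ s * y)) ≡⟨ collect (A * 3 ^ s) y C (suc m) ⟩
        (A * 3 ^ s + A * 3 ^ s + (C + suc m * (A * 3 ^ s))) * y ∎
      where
      collect : ∀ a y c m → (a * y + a * y) + (c * y + m * (a * y)) ≡ (a + a + (c + m * a)) * y
      collect = solve-∀
      bound : ∀ i → i ≤ 2 → ∀ n → L ≤ n → ℤ.∣ Δ^ m r (i + n) ∣ ≤ A * 3 ^ s * suc n ^ s
      bound i i≤2 n L≤n = begin
        ℤ.∣ Δ^ m r (i + n) ∣      ≤⟨ r≤ (i + n) (≤-trans L≤n (m≤n+m n i)) ⟩
        -- For i ≤ 2 the base is at most `3 * suc n`, the origin of `3 ^ s`.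
        A * suc (i + n) ^ s       ≤⟨ *-monoʳ-≤ A (^-monoˡ-≤ s (≤-trans (s≤s (+-monoˡ-≤ n i≤2)) (k+n≤k*n 2 n))) ⟩
        A * (3 * suc n) ^ s       ≡⟨ cong (A *_) (^-distribʳ-*ℕ 3 (suc n) s) ⟩
        A * (3 ^ s * suc n ^ s)   ≡⟨ *-assoc A (3 ^ s) (suc n ^ s) ⟨
        A * 3 ^ s * suc n ^ s     ∎

    lower-growth : ∀ s m → BoundedDifference m g → Growth m s → EventuallyPolynomial r
    lower-growth zero m b growth with Δ^-growth m 0 (boundedDifference-raise {g} {m} 1 b) growth
    ... | A , L , small = suc m , L ⊔ A , λ n L⊔A≤n → ∣i∣<1⇒i≡0 (≰⇒> λ 1≤∣Δ^r∣ → <⇒≱ (n<1+n n)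
      (begin
        suc n                             ≤⟨ m≤m*n (suc n) _ {{>-nonZero 1≤∣Δ^r∣}} ⟩
        suc n * ℤ.∣ Δ^ (suc m) r n ∣      ≤⟨ small n (m⊔n≤o⇒m≤o L A L⊔A≤n) ⟩
        A * 1                             ≡⟨ *-identityʳ A ⟩
        A                                 ≤⟨ m⊔n≤o⇒n≤o L A L⊔A≤n ⟩
        n                                 ∎))
    lower-growth (suc s) m b growth with Δ^-growth m (suc s) (boundedDifference-raise {g} {m} 1 b) growth
    ... | A , L , bound = lower-growth s (suc m) (boundedDifference-raise {g} {m} 1 b)
      (A , L , λ n L≤n → *-cancelˡ-≤ (suc n) (≤-trans (bound n L≤n) (≤-reflexive (swap A (suc n) (suc n ^ s)))))
      where
      swap : ∀ a b c → a * (b * c) ≡ b * (a * c)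
      swap = solve-∀

    Δ^-growth₀ : ∀ m s → Growth 0 s → Growth m s
    Δ^-growth₀ zero    s growth = growth
    Δ^-growth₀ (suc m) s growth with Δ^-growth₀ m s growth
    ... | A , L , bound = A * 2 ^ s + A , L , λ n L≤n → begin
      ℤ.∣ Δ^ m r (suc n) ℤ.- Δ^ m r n ∣
        ≤⟨ ∣-∣≤ {Δ^ m r (suc n)} {Δ^ m r n} (bound (suc n) (m≤n⇒m≤1+n L≤n)) (bound n L≤n) ⟩
      A * suc (suc n) ^ s + A * suc n ^ s       ≤⟨ +-monoˡ-≤ _ (*-monoʳ-≤ A (^-monoˡ-≤ s (k+n≤k*n 1 n))) ⟩
      A * (2 * suc n) ^ s + A * suc n ^ s       ≡⟨ cong (λ y → A * y + A * suc n ^ s) (^-distribʳ-*ℕ 2 (suc n) s) ⟩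
      A * (2 ^ s * suc n ^ s) + A * suc n ^ s   ≡⟨ collect A (2 ^ s) (suc n ^ s) ⟩
      (A * 2 ^ s + A) * suc n ^ s               ∎
      where
      collect : ∀ a t y → a * (t * y) + a * y ≡ (a * t + a) * y
      collect = solve-∀

  -- In `Δ^-rec` the term `Δ^ (suc m) g n` is determined by `Δ^ m r` at n, n+1 and n+2, so it
  -- vanishes once these do.
  source-eventuallyPolynomial : ∀ K s → (∀ n → ℤ.∣ g n ∣ ≤ K * suc (suc n) ^ s) → ∀ M → BoundedDifference M g → EventuallyPolynomial g
  source-eventuallyPolynomial K s g≤ M b = suc m , L , λ n L≤n →
    solve-for (+ suc n) (+ suc m) (Δ^ m r (suc (suc n))) (Δ^ m r (suc n)) (Δ^ m r n) (Δ^ (suc m) g n) (Δ^-rec m n)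
      (Δ^r≡0 (suc (suc n)) (m≤n⇒m≤1+n (m≤n⇒m≤1+n L≤n))) (Δ^r≡0 (suc n) (m≤n⇒m≤1+n L≤n)) (Δ^r≡0 n L≤n)
    where
    polynomial : EventuallyPolynomial r
    polynomial = lower-growth s M b (Δ^-growth₀ M s (2 * K * 2 ^ s , 2 ^ s , λ n 2^s≤n → begin
      ℤ.∣ r n ∣                       ≤⟨ remainder-bound K s g≤ n 2^s≤n ⟩
      2 * K * suc (suc n) ^ s         ≤⟨ *-monoʳ-≤ (2 * K) (^-monoˡ-≤ s (k+n≤k*n 1 n)) ⟩
      2 * K * (2 * suc n) ^ s         ≡⟨ cong (2 * K *_) (^-distribʳ-*ℕ 2 (suc n) s) ⟩
      2 * K * (2 ^ s * suc n ^ s)     ≡⟨ *-assoc (2 * K) (2 ^ s) (suc n ^ s) ⟨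
      2 * K * 2 ^ s * suc n ^ s       ∎))
    m = proj₁ polynomial
    L = proj₁ (proj₂ polynomial)
    Δ^r≡0 = proj₂ (proj₂ polynomial)
    solve-for : ∀ n k c b a d → n ℤ.* (b ℤ.- a) ≡ (c ℤ.- b) ℤ.- (d ℤ.+ k ℤ.* b) →
      c ≡ ℤ.0ℤ → b ≡ ℤ.0ℤ → a ≡ ℤ.0ℤ → d ≡ ℤ.0ℤ
    solve-for n k _ _ _ d eq refl refl refl = trans (isolate d k) (trans (cong ℤ.-_ (sym eq)) (annihilate n))
      where
      isolate : ∀ d k → d ≡ ℤ.- ((ℤ.0ℤ ℤ.- ℤ.0ℤ) ℤ.- (d ℤ.+ k ℤ.* ℤ.0ℤ))
      isolate = ℤ-Ring.solve-∀
      annihilate : ∀ n → ℤ.- (n ℤ.* (ℤ.0ℤ ℤ.- ℤ.0ℤ)) ≡ ℤ.0ℤ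
      annihilate = ℤ-Ring.solve-∀

  constant-source : ∀ a → (∀ n → g n ≡ a) → a ≡ ℤ.0ℤ × r 0 ≡ ℤ.0ℤ
  constant-source a g≡a = a≡0 , descend L (r≡0 L ≤-refl)
    where
    A = ℤ.∣ a ∣
    -- From here on n exceeds the bound for |r(n+1)| + |g(n)|, which dominates (n+1)|r(n)|.
    L = suc (2 * (A * 1) + A)
    g≤ : ∀ n → ℤ.∣ g n ∣ ≤ A * 1
    g≤ n = ≤-reflexive (trans (cong ℤ.∣_∣ (g≡a n)) (sym (*-identityʳ A)))
    r≡0 : ∀ n → L ≤ n → r n ≡ ℤ.0ℤ
    r≡0 n L≤n = ∣i∣<1⇒i≡0 (≰⇒> λ 1≤∣r∣ → <⇒≱ (s≤s (≤-trans (n≤1+n _) L≤n)) (begin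
      suc n                          ≤⟨ m≤m*n (suc n) _ {{>-nonZero 1≤∣r∣}} ⟩
      suc n * ℤ.∣ r n ∣              ≤⟨ scaled-≤ n ⟩
      ℤ.∣ r (suc n) ∣ + ℤ.∣ g n ∣    ≤⟨ +-mono-≤ (remainder-bound A 0 g≤ (suc n) (s≤s z≤n)) (≤-reflexive (cong ℤ.∣_∣ (g≡a n))) ⟩
      2 * A * 1 + A                  ≡⟨ cong (_+ A) (*-assoc 2 A 1) ⟩
      2 * (A * 1) + A                ∎))
    a≡0 : a ≡ ℤ.0ℤ
    a≡0 = trans (sym (g≡a L)) (trans (isolate (+ suc L) (g L))
      (trans (cong (λ x → (+ suc L ℤ.* x ℤ.+ g L) ℤ.- + suc L ℤ.* x) (sym (r≡0 L ≤-refl)))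
        (trans (cong (ℤ._- + suc L ℤ.* r L) (sym (rec L)))
          (trans (cong₂ (λ x y → x ℤ.- + suc L ℤ.* y) (r≡0 (suc L) (n≤1+n L)) (r≡0 L ≤-refl)) (annihilate (+ suc L))))))
      where
      isolate : ∀ n g → g ≡ (n ℤ.* ℤ.0ℤ ℤ.+ g) ℤ.- n ℤ.* ℤ.0ℤ
      isolate = ℤ-Ring.solve-∀
      annihilate : ∀ n → ℤ.0ℤ ℤ.- n ℤ.* ℤ.0ℤ ≡ ℤ.0ℤ
      annihilate = ℤ-Ring.solve-∀
    descend : ∀ n → r n ≡ ℤ.0ℤ → r 0 ≡ ℤ.0ℤ
    descend zero    r0≡0 = r0≡0
    descend (suc n) rn≡0 = descend n (ℤₚ.*-cancelˡ-≡ (+ suc n) (r n) ℤ.0ℤ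
      (trans (sym (ℤₚ.+-identityʳ (+ suc n ℤ.* r n)))
        (trans (cong (λ y → + suc n ℤ.* r n ℤ.+ y) (sym (trans (g≡a n) a≡0))) (trans (sym (rec n)) (trans rn≡0 (sym (ℤₚ.*-zeroʳ (+ suc n))))))))

-- Growth of eventually polynomial sequences

record GrowsLike (e : ℕ) (f : ℕ → ℤ) : Set where
  constructor growsLike
  field
    {A C L} : ℕ
    value   : ∀ n → L ≤ n → ∃[ k ] f n ≡ + k × n ^ e ≤ A * k × k ≤ C * n ^ e

m≤m^1+n : ∀ m n → m ≤ m ^ suc n
m≤m^1+n zero    n = z≤n
m≤m^1+n (suc m) n = m≤m*n (suc m) (suc m ^ n) {{m^n≢0 (suc m) n}}

+-dominated : ∀ c s → ℤ.∣ c ∣ ≤ s → ∃[ k ] c ℤ.+ + s ≡ + k × k ≤ s + ℤ.∣ c ∣ × s ≤ k + ℤ.∣ c ∣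
+-dominated (+ m)    s _   = m + s , refl , ≤-reflexive (+-comm m s) , ≤-trans (m≤n+m s m) (m≤m+n (m + s) m)
+-dominated -[1+ m ] s m<s = s ∸ suc m , ℤₚ.⊖-≥ m<s , ≤-trans (m∸n≤m s (suc m)) (m≤m+n s (suc m)) , ≤-reflexive (sym (m∸n+n≡m m<s))

-- The discrete derivative of n^(e+1) has order n^e; hence summing increments of order n^e yields at
-- least a multiple of n^(e+1).
power-increment : ∀ e n .{{_ : NonZero n}} → suc n ^ suc e ≤ n ^ suc e + suc e * 2 ^ e * n ^ e
power-increment e n = *-cancelʳ-≤ (suc n ^ suc e) (n ^ suc e + suc e * 2 ^ e * n ^ e) (suc n) (begin
  suc n ^ suc e * suc n                                   ≡⟨ cong (λ m → m ^ suc e * m) (+-comm n 1) ⟨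
  (n + 1) ^ suc e * (n + 1)                               ≤⟨ bernoulli⁻ n 1 (suc e) ⟩
  n ^ suc e * (n + 1) + suc e * 1 * (n + 1) ^ suc e       ≡⟨ cong (λ m → n ^ suc e * m + suc e * 1 * m ^ suc e) (+-comm n 1) ⟩
  n ^ suc e * suc n + suc e * 1 * (suc n * suc n ^ e)     ≤⟨ +-monoʳ-≤ (n ^ suc e * suc n) (*-monoʳ-≤ (suc e * 1) (*-monoʳ-≤ (suc n) suc^≤)) ⟩
  n ^ suc e * suc n + suc e * 1 * (suc n * (2 ^ e * n ^ e)) ≡⟨ collect (n ^ suc e) n (suc e) (2 ^ e) (n ^ e) ⟩
  (n ^ suc e + suc e * 2 ^ e * n ^ e) * suc n             ∎)
  where
  open ≤-Reasoning
  suc^≤ : suc n ^ e ≤ 2 ^ e * n ^ e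
  suc^≤ = ≤-trans (^-monoˡ-≤ e (≤-trans (+-monoˡ-≤ n (>-nonZero⁻¹ n)) (≤-reflexive (cong (λ m → n + m) (sym (+-identityʳ n))))))
    (≤-reflexive (^-distribʳ-*ℕ 2 n e))
  collect : ∀ a n e t b → a * suc n + e * 1 * (suc n * (t * b)) ≡ (a + e * t * b) * suc n
  collect = solve-∀

growsLike-sum : ∀ {e f} → GrowsLike e (Δ f) → GrowsLike (suc e) f
growsLike-sum {e} {f} (growsLike {A} {C} {L₀} increment) = growsLike {A = 2 * A′} {C = C + c} {L = L + 2 * suc K}
  λ n L+2K≤n → let j = n ∸ L
                   j+L≡n = m∸n+n≡m {n} {L} (≤-trans (m≤m+n L (2 * suc K)) L+2K≤n)
                   2K<n = ≤-trans (m≤n+m (2 * suc K) L) L+2K≤n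
               in subst (λ n → 2 * suc K ≤ n → ∃[ k ] f n ≡ + k × n ^ suc e ≤ 2 * A′ * k × k ≤ (C + c) * n ^ suc e) j+L≡n
                    (conclude j) 2K<n
  where
  open ≤-Reasoning
  -- Positive, as `power-increment` requires.
  L = suc L₀
  A′ = suc e * 2 ^ e * A
  c = ℤ.∣ f L ∣
  -- All that depends on the starting point, including a possibly negative f(L). From n ≥ 2(K+1) on,
  -- 2K is at most n^(e+1), so y ≤ A′k + K gives y ≤ 2A′k.
  K = A′ * c + L ^ suc e
  partial-sum : ∀ j → ∃[ s ] f (j + L) ≡ f L ℤ.+ + s × (j + L) ^ suc e ≤ A′ * s + L ^ suc e × s ≤ C * (j + L) ^ suc e
  partial-sum zero = 0 , sym (ℤₚ.+-identityʳ (f L)) , m≤n+m (L ^ suc e) (A′ * 0) , z≤n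
  partial-sum (suc j) with partial-sum j | increment (j + L) (≤-trans (n≤1+n L₀) (m≤n+m L j))
  ... | s , f≡ , s≥ , s≤ | d , Δf≡ , d≥ , d≤ = s + d , value , lower , upper
    where
    n = j + L
    instance
      n≢0 : NonZero n
      n≢0 = >-nonZero (≤-trans (s≤s z≤n) (m≤n+m L j))
    value : f (suc n) ≡ f L ℤ.+ + (s + d)
    value = trans (split (f (suc n)) (f n)) (trans (cong₂ ℤ._+_ f≡ Δf≡) (ℤₚ.+-assoc (f L) (+ s) (+ d)))
      where
      split : ∀ a b → a ≡ b ℤ.+ (a ℤ.- b)
      split = ℤ-Ring.solve-∀
    lower : suc n ^ suc e ≤ A′ * (s + d) + L ^ suc e
    lower = begin
      suc n ^ suc e                                       ≤⟨ power-increment e n ⟩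
      n ^ suc e + suc e * 2 ^ e * n ^ e                   ≤⟨ +-mono-≤ s≥ (*-monoʳ-≤ (suc e * 2 ^ e) d≥) ⟩
      A′ * s + L ^ suc e + suc e * 2 ^ e * (A * d)        ≡⟨ collect (suc e * 2 ^ e) A s d (L ^ suc e) ⟩
      A′ * (s + d) + L ^ suc e                            ∎
      where
      collect : ∀ b A s d l → b * A * s + l + b * (A * d) ≡ b * A * (s + d) + l
      collect = solve-∀
    upper : s + d ≤ C * suc n ^ suc e
    upper = begin
      s + d                           ≤⟨ +-mono-≤ s≤ d≤ ⟩
      C * n ^ suc e + C * n ^ e       ≡⟨ collect C n (n ^ e) ⟩
      C * (suc n * n ^ e)             ≤⟨ *-monoʳ-≤ C (*-monoʳ-≤ (suc n) (^-monoˡ-≤ e (n≤1+n n))) ⟩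
      C * (suc n * suc n ^ e)         ∎
      where
      collect : ∀ C n y → C * (n * y) + C * y ≡ C * (suc n * y)
      collect = solve-∀
  conclude : ∀ j → 2 * suc K ≤ j + L → ∃[ k ] f (j + L) ≡ + k × (j + L) ^ suc e ≤ 2 * A′ * k × k ≤ (C + c) * (j + L) ^ suc e
  conclude j 2K<n with partial-sum j
  ... | s , f≡ , s≥ , s≤ with +-dominated (f L) s c≤s
    where
    c≤s : c ≤ s
    c≤s = ≮⇒≥ λ s<c → <⇒≱ (n<1+n K) (begin
      suc K                   ≤⟨ m≤n*m (suc K) 2 ⟩
      2 * suc K               ≤⟨ 2K<n ⟩
      j + L                   ≤⟨ m≤m^1+n (j + L) e ⟩
      (j + L) ^ suc e         ≤⟨ s≥ ⟩
      A′ * s + L ^ suc e      ≤⟨ +-monoˡ-≤ (L ^ suc e) (*-monoʳ-≤ A′ (<⇒≤ s<c)) ⟩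
      K                       ∎)
  ... | k , value , k≤ , s≤k = k , trans f≡ value , lower , upper
    where
    n = j + L
    y = n ^ suc e
    lower : y ≤ 2 * A′ * k
    lower = +-cancelʳ-≤ y y (2 * A′ * k) (begin
      y + y                                     ≤⟨ +-mono-≤ s≥′ s≥′ ⟩
      (A′ * k + K) + (A′ * k + K)               ≡⟨ collect (A′ * k) K A′ k refl ⟩
      2 * A′ * k + 2 * K                        ≤⟨ +-monoʳ-≤ (2 * A′ * k) (≤-trans (*-monoʳ-≤ 2 (n≤1+n K)) (≤-trans 2K<n (m≤m^1+n n e))) ⟩
      2 * A′ * k + y                            ∎)
      where
      collect : ∀ x K a k → x ≡ a * k → (x + K) + (x + K) ≡ 2 * a * k + 2 * K
      collect _ K a k refl = identity K a k
        where
        identity : ∀ K a k → (a * k + K) + (a * k + K) ≡ 2 * a * k + 2 * K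
        identity = solve-∀
      s≥′ : y ≤ A′ * k + K
      s≥′ = begin
        y                             ≤⟨ s≥ ⟩
        A′ * s + L ^ suc e            ≤⟨ +-monoˡ-≤ (L ^ suc e) (*-monoʳ-≤ A′ s≤k) ⟩
        A′ * (k + c) + L ^ suc e      ≡⟨ trans (cong (_+ L ^ suc e) (*-distribˡ-+ A′ k c)) (+-assoc (A′ * k) (A′ * c) (L ^ suc e)) ⟩
        A′ * k + K                    ∎
    upper : k ≤ (C + c) * y
    upper = begin
      k               ≤⟨ k≤ ⟩
      s + c           ≤⟨ +-mono-≤ s≤ (m≤m*n c y {{>-nonZero (≤-trans (s≤s z≤n) (≤-trans (≤-trans (s≤s z≤n) 2K<n) (m≤m^1+n n e)))}}) ⟩
      C * y + c * y   ≡⟨ *-distribʳ-+ y C c ⟨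
      (C + c) * y     ∎

growsLike-cong : ∀ {e f h} → (∀ n → f n ≡ h n) → GrowsLike e f → GrowsLike e h
growsLike-cong f≗h (growsLike {A} {C} {L} value) = growsLike {A = A} {C} {L} λ n L≤n →
  let (k , f≡ , bounds) = value n L≤n in k , trans (sym (f≗h n)) f≡ , bounds

growsLike-constant : ∀ {f c L} → 0 < c → (∀ n → L ≤ n → f n ≡ + c) → GrowsLike 0 f
growsLike-constant {f} {c} {L} 0<c f≡c = growsLike {A = 1} {C = c} {L = L} λ n L≤n →
  c , f≡c n L≤n , ≤-trans 0<c (≤-reflexive (sym (*-identityˡ c))) , ≤-reflexive (sym (*-identityʳ c))

constant-from : ∀ f L → (∀ n → L ≤ n → Δ f n ≡ ℤ.0ℤ) → ∀ n → L ≤ n → f n ≡ f L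
constant-from f L Δf≡0 n L≤n = subst (λ n → f n ≡ f L) (m∸n+n≡m L≤n) (from (n ∸ L))
  where
  from : ∀ j → f (j + L) ≡ f L
  from zero    = refl
  from (suc j) = trans (ℤₚ.i-j≡0⇒i≡j (f (suc (j + L))) (f (j + L)) (Δf≡0 (j + L) (m≤n+m L j))) (from j)

polynomial-growth : ∀ m f L → (∀ n → L ≤ n → Δ^ m f n ≡ ℤ.0ℤ) →
  (∃[ L′ ] ∀ n → L′ ≤ n → f n ≡ ℤ.0ℤ) ⊎ (∃[ e ] (GrowsLike e f ⊎ GrowsLike e (λ n → ℤ.- f n)))
polynomial-growth zero    f L f≡0 = inj₁ (L , f≡0)
polynomial-growth (suc m) f L Δ^f≡0
  with polynomial-growth m (Δ f) L (λ n L≤n → trans (Δ^-Δ f m n) (Δ^f≡0 n L≤n))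
... | inj₂ (e , inj₁ growth) = inj₂ (suc e , inj₁ (growsLike-sum growth))
... | inj₂ (e , inj₂ growth) = inj₂ (suc e , inj₂ (growsLike-sum (growsLike-cong (λ n → negate (f (suc n)) (f n)) growth)))
  where
  negate : ∀ a b → ℤ.- (a ℤ.- b) ≡ ℤ.- a ℤ.- ℤ.- b
  negate = ℤ-Ring.solve-∀
... | inj₁ (L′ , Δf≡0) with f L′ in fL′≡ | constant-from f L′ Δf≡0
... | + zero    | f≡ = inj₁ (L′ , λ n L′≤n → f≡ n L′≤n)
... | + suc c   | f≡ = inj₂ (0 , inj₁ (growsLike-constant {c = suc c} z<s λ n L′≤n → f≡ n L′≤n))
... | -[1+ c ]  | f≡ = inj₂ (0 , inj₂ (growsLike-constant {c = suc c} z<s λ n L′≤n → cong ℤ.-_ (f≡ n L′≤n)))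

-- An eventually zero sequence admits no lower bound and receives e = 0 by default, whence the
-- alternative. Later it does no harm, since no positive λ lies below 0.
polynomial-degree : ∀ f → EventuallyPolynomial f →
  ∃[ e ] ∃[ A ] ∃[ L ] (∀ n → L ≤ n → ℤ.∣ f n ∣ ≤ A * n ^ e) × (e ≡ 0 ⊎ (∀ n → L ≤ n → n ^ e ≤ A * ℤ.∣ f n ∣))
polynomial-degree f (m , L , Δ^f≡0) with polynomial-growth m f L Δ^f≡0
... | inj₁ (L′ , f≡0) = 0 , 0 , L′ , (λ n L′≤n → ≤-reflexive (cong ℤ.∣_∣ (f≡0 n L′≤n))) , inj₁ refl
... | inj₂ (e , growth) = e , degree growth
  where
  bounds : ∀ {h} → (∀ n → ℤ.∣ h n ∣ ≡ ℤ.∣ f n ∣) → GrowsLike e h →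
    ∃[ A ] ∃[ L ] (∀ n → L ≤ n → ℤ.∣ f n ∣ ≤ A * n ^ e) × (e ≡ 0 ⊎ (∀ n → L ≤ n → n ^ e ≤ A * ℤ.∣ f n ∣))
  bounds {h} ∣h∣≡∣f∣ (growsLike {A} {C} {L} value) = A + C , L ,
    (λ n L≤n → let (k , h≡ , _ , k≤) = value n L≤n in
      subst (_≤ (A + C) * n ^ e) (abs n h≡) (≤-trans k≤ (*-monoˡ-≤ (n ^ e) (m≤n+m C A)))) ,
    inj₂ (λ n L≤n → let (k , h≡ , ≤k , _) = value n L≤n in
      subst (λ a → n ^ e ≤ (A + C) * a) (abs n h≡) (≤-trans ≤k (*-monoˡ-≤ k (m≤m+n A C))))
    where
    abs : ∀ n {k} → h n ≡ + k → k ≡ ℤ.∣ f n ∣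
    abs n h≡ = trans (cong ℤ.∣_∣ (sym h≡)) (∣h∣≡∣f∣ n)
  degree : GrowsLike e f ⊎ GrowsLike e (λ n → ℤ.- f n) →
    ∃[ A ] ∃[ L ] (∀ n → L ≤ n → ℤ.∣ f n ∣ ≤ A * n ^ e) × (e ≡ 0 ⊎ (∀ n → L ≤ n → n ^ e ≤ A * ℤ.∣ f n ∣))
  degree (inj₁ growth) = bounds (λ _ → refl) growth
  degree (inj₂ growth) = bounds (λ n → ℤₚ.∣-i∣≡∣i∣ (f n)) growth

-- Reals and integer parts of powers

open ℚ-Lemmas hiding (^-monoˡ-≤)
open ℝ-Lemmas

module ℚ^ = Exp (CommutativeRing.semiring ℚₚ.+-*-commutativeRing)

near : ∀ x y {η} → 0ℚ ℚ.< η → ∃[ A ] ∀ n → A ≤ n →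
  ℚ.∣ ℝ.seq x n ℚ.- ℝ.seq x A ∣ ℚ.< η × ℚ.∣ ℝ.seq y n ℚ.- ℝ.seq y A ∣ ℚ.< η
near x y 0<η with ℝ.cauchy x _ 0<η | ℝ.cauchy y _ 0<η
... | M , x-close | N , y-close = M ⊔ N , λ n M⊔N≤n →
  x-close n (M ⊔ N) (m⊔n≤o⇒m≤o M N M⊔N≤n) (m≤m⊔n M N) ,
  y-close n (M ⊔ N) (m⊔n≤o⇒n≤o M N M⊔N≤n) (m≤n⊔m M N)

-- Take a stage A after which both sequences move by less than η. A gap of 4η there would give a
-- strict inequality by `spread`, so the later terms differ by less than 6η, which is below ε = 8η.
≮≯⇒≈ : ∀ x y → ¬ x <ᴿ y → ¬ y <ᴿ x → x ≈ y
≮≯⇒≈ x y x≮y y≮x ε 0<ε with eighth 0<ε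
... | η , 0<η , 8η≡ε with near x y 0<η
... | A , close = A , λ n A≤n → dist<
  (chain (ℝ.seq x n) (ℝ.seq x A) (ℝ.seq y n) (ℝ.seq y A)
    (dist-upper _ _ η (proj₁ (close n A≤n)))
    (ℚₚ.≰⇒> λ le → y≮x (η ℚ.+ η , double-positive 0<η , A , λ m A≤m →
      spread (ℝ.seq y A) (ℝ.seq y m) (ℝ.seq x A) (ℝ.seq x m) η (dist-upper _ _ η (proj₂ (close m A≤m))) le (dist-lower (ℝ.seq x m) _ η (proj₁ (close m A≤m)))))
    (dist-lower (ℝ.seq y n) _ η (proj₂ (close n A≤n))))
  (chain (ℝ.seq y n) (ℝ.seq y A) (ℝ.seq x n) (ℝ.seq x A)
    (dist-upper _ _ η (proj₂ (close n A≤n)))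
    (ℚₚ.≰⇒> λ le → x≮y (η ℚ.+ η , double-positive 0<η , A , λ m A≤m →
      spread (ℝ.seq x A) (ℝ.seq x m) (ℝ.seq y A) (ℝ.seq y m) η (dist-upper _ _ η (proj₁ (close m A≤m))) le (dist-lower (ℝ.seq y m) _ η (proj₂ (close m A≤m)))))
    (dist-lower (ℝ.seq x n) _ η (proj₁ (close n A≤n))))
  where
  open ℚ-Solver.+-*-Solver
  chain : ∀ a a′ b b′ → a ℚ.< a′ ℚ.+ η → a′ ℚ.< b′ ℚ.+ ((η ℚ.+ η) ℚ.+ (η ℚ.+ η)) → b′ ℚ.< b ℚ.+ η → a ℚ.< b ℚ.+ ε
  chain a a′ b b′ p q r = subst (λ ε → a ℚ.< b ℚ.+ ε) 8η≡ε
    (<-gap (((a′ ℚ.+ η) ℚ.- a) ℚ.+ ((b′ ℚ.+ ((η ℚ.+ η) ℚ.+ (η ℚ.+ η))) ℚ.- a′) ℚ.+ ((b ℚ.+ η) ℚ.- b′) ℚ.+ (η ℚ.+ η))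
      (ℚₚ.+-mono-< (ℚₚ.+-mono-< (ℚₚ.+-mono-< (0<b-a p) (0<b-a q)) (0<b-a r)) (double-positive 0<η))
      (solve 5 (λ a a′ b b′ η → a :+ ((((a′ :+ η) :- a) :+ ((b′ :+ ((η :+ η) :+ (η :+ η))) :- a′)) :+ ((b :+ η) :- b′) :+ (η :+ η))
                   := b :+ (((η :+ η) :+ (η :+ η)) :+ ((η :+ η) :+ (η :+ η)))) refl a a′ b b′ η))

density : ∀ {x y} → x <ᴿ y → ∃[ c ] x <ᴿ const c × const c <ᴿ y
density {x} {y} (ε , 0<ε , N , x+ε≤y) with eighth 0<ε
... | η , 0<η , 8η≡ε = c ,
  (η ℚ.+ η , double-positive 0<η , A , λ n A≤n →
    spread (ℝ.seq x A) (ℝ.seq x n) c c η (x-close n A≤n) ℚₚ.≤-refl c<c+η) ,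
  (η ℚ.+ η , double-positive 0<η , A , λ n A≤n →
    spread c c (ℝ.seq y A) (ℝ.seq y n) η c<c+η c+4η≤y (y-close n A≤n))
  where
  open ℚ-Solver.+-*-Solver
  near-x = ℝ.cauchy x η 0<η
  near-y = ℝ.cauchy y η 0<η
  A = N ⊔ (proj₁ near-x ⊔ proj₁ near-y)
  x≤A : proj₁ near-x ≤ A
  x≤A = ≤-trans (m≤m⊔n (proj₁ near-x) (proj₁ near-y)) (m≤n⊔m N _)
  y≤A : proj₁ near-y ≤ A
  y≤A = ≤-trans (m≤n⊔m (proj₁ near-x) (proj₁ near-y)) (m≤n⊔m N _)
  x-close : ∀ n → A ≤ n → ℝ.seq x n ℚ.< ℝ.seq x A ℚ.+ η
  x-close n A≤n = dist-upper _ _ η (proj₂ near-x n A (≤-trans x≤A A≤n) x≤A)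
  y-close : ∀ n → A ≤ n → ℝ.seq y A ℚ.< ℝ.seq y n ℚ.+ η
  y-close n A≤n = dist-lower (ℝ.seq y n) _ η (proj₂ near-y n A (≤-trans y≤A A≤n) y≤A)
  4η = (η ℚ.+ η) ℚ.+ (η ℚ.+ η)
  -- Halfway in the gap of 8η, so that `spread` applies on both sides.
  c = ℝ.seq x A ℚ.+ 4η
  c<c+η : c ℚ.< c ℚ.+ η
  c<c+η = <-gap η 0<η refl
  c+4η≤y : c ℚ.+ 4η ℚ.≤ ℝ.seq y A
  c+4η≤y = subst (ℚ._≤ ℝ.seq y A) (trans (cong (ℝ.seq x A ℚ.+_) (sym 8η≡ε)) (sym (ℚₚ.+-assoc (ℝ.seq x A) 4η 4η)))
    (x+ε≤y A (m≤m⊔n N _))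

-- Opaque, since the normalisation of a quotient p/q with variable p and q is slow.
abstract
  ratio : ℕ → ℕ → ℚ
  ratio p q = + suc p ℚ./ suc q

  ratio≡/ : ∀ p q → ratio p q ≡ + suc p ℚ./ suc q
  ratio≡/ p q = refl

  positive-ratio : ∀ c → 0ℚ ℚ.< c → ∃[ p ] ∃[ q ] c ≡ ratio p q
  positive-ratio c@(mkℚ (+ suc p) q _) 0<c = p , q , sym (ℚₚ.↥p/↧p≡p c)
  positive-ratio (mkℚ (+ zero) q _) 0<c = contradiction (ℚ.positive 0<c) λ ()
  positive-ratio (mkℚ -[1+ p ] q _) 0<c = contradiction (ℚ.positive 0<c) λ ()

  ratio-between : ∀ {x y} → 0ᴿ ≤ᴿ x → x <ᴿ y → ∃[ p ] ∃[ q ] x <ᴿ const (ratio p q) × const (ratio p q) <ᴿ y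
  ratio-between {x} {y} 0≤x x<y =
    let (c , x<c , c<y) = density {x} {y} x<y
        (p , q , c≡p/q) = positive-ratio c (const-<⁻¹ (≤ᴿ-<ᴿ-trans {0ᴿ} {x} {const c} 0≤x x<c))
    in p , q , subst (λ c → x <ᴿ const c) c≡p/q x<c , subst (λ c → const c <ᴿ y) c≡p/q c<y

  ratio-≤ : ∀ {p q p′ q′} → ratio p q ℚ.≤ ratio p′ q′ → suc p * suc q′ ≤ suc p′ * suc q
  ratio-≤ {p} {q} {p′} {q′} le = ℤₚ.drop‿+≤+ (/-cancel-≤ (+ suc p) (+ suc p′) (suc q) (suc q′) le)

  ratio-mono : ∀ {p q p′ q′} → suc p * suc q′ ≤ suc p′ * suc q → ratio p q ℚ.≤ ratio p′ q′
  ratio-mono {p} {q} {p′} {q′} le = /-mono-≤ (+ suc p) (+ suc p′) (suc q) (suc q′) (ℤ.+≤+ le)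

  ratio-≤-nat : ∀ {p q} n → ratio p q ℚ.≤ nat n → suc p ≤ n * suc q
  ratio-≤-nat {p} {q} n le = ℤₚ.drop‿+≤+ (subst₂ ℤ._≤_ (ℤₚ.*-identityʳ (+ suc p)) (sym (ℤₚ.pos-* n (suc q)))
    (/-cancel-≤ (+ suc p) (+ n) (suc q) 1 le))

  nat-≤-ratio : ∀ {p q} n → nat n ℚ.≤ ratio p q → n * suc q ≤ suc p
  nat-≤-ratio {p} {q} n le = ℤₚ.drop‿+≤+ (subst₂ ℤ._≤_ (sym (ℤₚ.pos-* n (suc q))) (ℤₚ.*-identityʳ (+ suc p))
    (/-cancel-≤ (+ n) (+ suc p) 1 (suc q) le))

  nat-mono-ratio : ∀ {p q} n → n * suc q ≤ suc p → nat n ℚ.≤ ratio p q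
  nat-mono-ratio {p} {q} n le = /-mono-≤ (+ n) (+ suc p) 1 (suc q)
    (subst₂ ℤ._≤_ (ℤₚ.pos-* n (suc q)) (sym (ℤₚ.*-identityʳ (+ suc p))) (ℤ.+≤+ le))

  0≤ratio : ∀ p q → 0ℚ ℚ.≤ ratio p q
  0≤ratio p q = ℚₚ.nonNegative⁻¹ (ratio p q) {{ℚₚ.normalize-nonNeg (suc p) (suc q)}}

PowersBelow : ℕ → ℝ → ℚ → Set
PowersBelow n x y = 0ℚ ℚ.≤ y × ∃[ p ] ∃[ q ] const (ratio p q) ≤ᴿ x × y ℚ^.^ suc q ℚ.≤ nat n ℚ^.^ suc p

abstract
  powersBelow⁺ : ∀ n x y → RationalPowersBelow n x y → PowersBelow n x y
  powersBelow⁺ n x y (0≤y , p , q , p/q≤x , y^q≤n^p) = 0≤y , p , q , subst (λ c → const c ≤ᴿ x) (sym (ratio≡/ p q)) p/q≤x , y^q≤n^p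

  powersBelow⁻ : ∀ n x y → PowersBelow n x y → RationalPowersBelow n x y
  powersBelow⁻ n x y (0≤y , p , q , p/q≤x , y^q≤n^p) = 0≤y , p , q , subst (λ c → const c ≤ᴿ x) (ratio≡/ p q) p/q≤x , y^q≤n^p

-- u ≤ x^(p/q) ≤ x^(p′/q′)
raise-exponent : ∀ {u x} p q p′ q′ .{{_ : NonZero x}} → suc p * suc q′ ≤ suc p′ * suc q → u ^ suc q ≤ x ^ suc p → u ^ suc q′ ≤ x ^ suc p′
raise-exponent {u} {x} p q p′ q′ pq′≤p′q u^q≤x^p = ^-cancelˡ-≤ℕ q (begin
  (u ^ suc q′) ^ suc q    ≡⟨ ^-comm u (suc q′) (suc q) ⟩
  (u ^ suc q) ^ suc q′    ≤⟨ ^-monoˡ-≤ (suc q′) u^q≤x^p ⟩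
  (x ^ suc p) ^ suc q′    ≡⟨ ^-*-assoc x (suc p) (suc q′) ⟩
  x ^ (suc p * suc q′)    ≤⟨ ^-monoʳ-≤ x pq′≤p′q ⟩
  x ^ (suc p′ * suc q)    ≡⟨ ^-*-assoc x (suc p′) (suc q) ⟨
  (x ^ suc p′) ^ suc q    ∎)
  where
  open ≤-Reasoning
  ^-comm : ∀ a m n → (a ^ m) ^ n ≡ (a ^ n) ^ m
  ^-comm a m n = trans (^-*-assoc a m n) (trans (cong (a ^_) (*-comm m n)) (sym (^-*-assoc a n m)))

trichotomy : ExcludedMiddle 0ℓ → ∀ x y → x <ᴿ y ⊎ x ≈ y ⊎ y <ᴿ x
trichotomy em x y with em {x <ᴿ y} | em {y <ᴿ x}
... | yes x<y | _       = inj₁ x<y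
... | no _    | yes y<x = inj₂ (inj₂ y<x)
... | no x≮y  | no y≮x  = inj₂ (inj₁ (≮≯⇒≈ x y x≮y y≮x))

-- What the proof uses of the integer part of n^λ, expressed by the rationals below n^λ alone, so
-- that the real number n^λ itself no longer appears.
record IsFloorOfPower (λ′ : ℝ) (floor : ℕ → ℤ) : Set where
  field
    below-suc : ∀ n y → PowersBelow n λ′ y → y ℚ.< ι (floor n ℤ.+ + 1)
    least     : ∀ n b → (∀ y → PowersBelow n λ′ y → y ℚ.≤ ι b) → floor n ℤ.≤ b

supremum-below-suc-floor : ∀ {P : ℚ → Set} x z → IsSupremum P x → x <ᴿ const (ι (z ℤ.+ + 1)) → ∀ y → P y → y ℚ.< ι (z ℤ.+ + 1)
supremum-below-suc-floor x z sup x<z+1 y Py =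
  const-<⁻¹ (≤ᴿ-<ᴿ-trans {const y} {x} {const (ι (z ℤ.+ + 1))} (proj₁ sup y Py) x<z+1)

supremum-floor-least : ∀ {P : ℚ → Set} x z → IsSupremum P x → const (ι z) ≤ᴿ x → ∀ b → (∀ y → P y → y ℚ.≤ ι b) → z ℤ.≤ b
supremum-floor-least x z sup z≤x b P≤b = ι-cancel {z} {b} (const-≤⁻¹
  (≤ᴿ-trans {const (ι z)} {x} {const (ι b)} z≤x (proj₂ sup (const (ι b)) λ y Py → const-≤ (P≤b y Py))))

module FloorOfPower (em : ExcludedMiddle 0ℓ) (λ′ : ℝ) (0<λ : 0ᴿ <ᴿ λ′)
  (floor : ℕ → ℤ) (isFloor : IsFloorOfPower λ′ floor) where

  open IsFloorOfPower isFloor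

  φ : ℕ → ℕ
  φ n = ℤ.∣ floor n ∣

  private
    ≤-floor : ∀ n u → PowersBelow n λ′ (nat u) → + u ℤ.≤ floor n
    ≤-floor n u Pu = subst (+ u ℤ.≤_) (trans (cong ℤ.pred (ℤₚ.+-comm (floor n) (+ 1))) (ℤₚ.pred-suc (floor n)))
      (ℤₚ.i<j⇒i≤pred[j] (ι-cancel-< {+ u} {floor n ℤ.+ + 1} (below-suc n (nat u) Pu)))

    nat-below : ∀ n u p q → const (ratio p q) ≤ᴿ λ′ → u ^ suc q ≤ n ^ suc p → PowersBelow n λ′ (nat u)
    nat-below n u p q p/q≤λ u^q≤n^p = 0≤nat u , p , q , p/q≤λ ,
      subst₂ ℚ._≤_ (sym (nat-^ u (suc q))) (sym (nat-^ n (suc p))) (nat-mono u^q≤n^p)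

    abstract
      some-ratio : ∃[ p ] ∃[ q ] const (ratio p q) ≤ᴿ λ′
      some-ratio =
        let (p , q , _ , p/q<λ) = ratio-between {0ᴿ} {λ′} (const-≤ {0ℚ} {0ℚ} ℚₚ.≤-refl) 0<λ
        in p , q , <ᴿ⇒≤ᴿ {const (ratio p q)} {λ′} p/q<λ

    0≤floor : ∀ n p q → const (ratio p q) ≤ᴿ λ′ → ℤ.0ℤ ℤ.≤ floor n
    0≤floor n p q p/q≤λ = ≤-floor n 0 (nat-below n 0 p q p/q≤λ z≤n)

  abstract
    floor≡φ : ∀ n → floor n ≡ + φ n
    floor≡φ n = sym (ℤₚ.0≤i⇒+∣i∣≡i (0≤floor n (proj₁ some-ratio) (proj₁ (proj₂ some-ratio)) (proj₂ (proj₂ some-ratio))))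

  ≤-φ : ∀ {n u} p q → const (ratio p q) ≤ᴿ λ′ → u ^ suc q ≤ n ^ suc p → u ≤ φ n
  ≤-φ {n} {u} p q p/q≤λ u^q≤n^p = ℤₚ.drop‿+≤+ (subst (+ u ℤ.≤_) (floor≡φ n) (≤-floor n u (nat-below n u p q p/q≤λ u^q≤n^p)))

  private
    pred-≤ : ∀ n k → floor n ≡ + k → Dec (∃[ y ] PowersBelow n λ′ y × nat (pred k) ℚ.< y) →
      ∃[ p ] ∃[ q ] const (ratio p q) ≤ᴿ λ′ × pred k ^ suc q ≤ n ^ suc p
    pred-≤ n zero    _ _ = let (p , q , p/q≤λ) = some-ratio in p , q , p/q≤λ , z≤n
    pred-≤ n (suc a) _ (yes (y , (_ , p , q , p/q≤λ , y^q≤n^p) , a<y)) = p , q , p/q≤λ , ℤₚ.drop‿+≤+ (ι-cancel {+ (a ^ suc q)} {+ (n ^ suc p)}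
      (subst₂ ℚ._≤_ (nat-^ a (suc q)) (nat-^ n (suc p)) (ℚₚ.≤-trans (ℚ-Lemmas.^-monoˡ-≤ (0≤nat a) (ℚₚ.<⇒≤ a<y) (suc q)) y^q≤n^p)))
    pred-≤ n (suc a) floor≡ (no none) = contradiction (n<1+n a) (≤⇒≯ (ℤₚ.drop‿+≤+ (subst (ℤ._≤ + a) floor≡
      (least n (+ a) λ y Py → ℚₚ.≮⇒≥ λ a<y → none (y , Py , a<y)))))

  -- Rational exponents up to λ need not reach `φ n` itself: n^λ may be an integer with λ
  -- irrational, as 2^(log₂ 3) = 3. But `pred (φ n)` is not an upper bound of the rational powers
  -- below n^λ, because `floor n` is at most every integral upper bound; so some power exceeds it,
  -- unless `φ n` is 0.
  pred-φ-≤ : ∀ n → ∃[ p ] ∃[ q ] const (ratio p q) ≤ᴿ λ′ × pred (φ n) ^ suc q ≤ n ^ suc p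
  pred-φ-≤ n = pred-≤ n (φ n) (floor≡φ n) em

  φ-≤ : ∀ {n u} p q .{{_ : NonZero n}} → λ′ <ᴿ const (ratio p q) → n ^ suc p ≤ u ^ suc q → φ n ≤ u
  φ-≤ {n} {u} p q λ<p/q n^p≤u^q = ℤₚ.drop‿+≤+ (subst (ℤ._≤ + u) (floor≡φ n) (least n (+ u) bound))
    where
    bound : ∀ y → PowersBelow n λ′ y → y ℚ.≤ nat u
    -- The successor of `q + q₁ * suc q` is `suc q₁ * suc q`, the common denominator of the two
    -- exponents.
    bound y (0≤y , p₁ , q₁ , p₁/q₁≤λ , y^q₁≤n^p₁) = ^-cancelˡ-≤ (0≤nat u) (q + q₁ * suc q)
      (subst₂ ℚ._≤_ (ℚ^.^-assocʳ y (suc q₁) (suc q)) nat-u^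
        (ℚₚ.≤-trans (ℚ-Lemmas.^-monoˡ-≤ 0≤y^ y^q₁≤n^p₁ (suc q))
          (subst (ℚ._≤ nat ((u ^ suc q) ^ suc q₁)) (sym n^) (nat-mono chain))))
      where
      open ≤-Reasoning
      0≤y^ : 0ℚ ℚ.≤ y ℚ^.^ suc q₁
      0≤y^ = ^-nonNeg 0≤y (suc q₁)
      n^ : (nat n ℚ^.^ suc p₁) ℚ^.^ suc q ≡ nat ((n ^ suc p₁) ^ suc q)
      n^ = trans (cong (ℚ^._^ suc q) (nat-^ n (suc p₁))) (nat-^ (n ^ suc p₁) (suc q))
      nat-u^ : nat ((u ^ suc q) ^ suc q₁) ≡ nat u ℚ^.^ (suc q₁ * suc q)
      nat-u^ = trans (cong nat (trans (^-*-assoc u (suc q) (suc q₁)) (cong (u ^_) (*-comm (suc q) (suc q₁))))) (sym (nat-^ u (suc q₁ * suc q)))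
      chain : (n ^ suc p₁) ^ suc q ≤ (u ^ suc q) ^ suc q₁
      chain = begin
        (n ^ suc p₁) ^ suc q    ≡⟨ ^-*-assoc n (suc p₁) (suc q) ⟩
        n ^ (suc p₁ * suc q)    ≤⟨ ^-monoʳ-≤ n (ratio-≤ {p₁} {q₁} {p} {q} (ℚₚ.<⇒≤ (const-<⁻¹ (≤ᴿ-<ᴿ-trans {const (ratio p₁ q₁)} {λ′} {const (ratio p q)} p₁/q₁≤λ λ<p/q)))) ⟩
        n ^ (suc p * suc q₁)    ≡⟨ ^-*-assoc n (suc p) (suc q₁) ⟨
        (n ^ suc p) ^ suc q₁    ≤⟨ ^-monoˡ-≤ (suc q₁) n^p≤u^q ⟩
        (u ^ suc q) ^ suc q₁    ∎

  Fits : ℕ → ℕ → ℕ → ℕ → Set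
  Fits p q n j = pred (φ (suc (j + n))) ^ suc q ≤ suc (j + n) ^ suc p

  fits-raise : ∀ {n j} p q p′ q′ → suc p * suc q′ ≤ suc p′ * suc q → Fits p q n j → Fits p′ q′ n j
  fits-raise {n} {j} p q p′ q′ = raise-exponent {pred (φ (suc (j + n)))} {suc (j + n)} p q p′ q′

  -- Each point of the window has its own exponent below λ; raising an exponent preserves the
  -- inequality for bases at least 1, so the largest of these finitely many serves all points.
  window-ratio : ∀ n M → ∃[ p ] ∃[ q ] const (ratio p q) ≤ᴿ λ′ × (∀ j → j ≤ M → Fits p q n j)
  window-ratio n zero = let (p , q , p/q≤λ , fits) = pred-φ-≤ (suc n) in p , q , p/q≤λ , λ { zero _ → fits }
  window-ratio n (suc M) = combine (window-ratio n M) (pred-φ-≤ (suc (suc M + n)))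
    where
    extend : ∀ {p q} → (∀ j → j ≤ M → Fits p q n j) → Fits p q n (suc M) → ∀ j → j ≤ suc M → Fits p q n j
    extend {p} {q} fits last j j≤ = case (m≤n⇒m<n∨m≡n j≤)
      where
      case : j < suc M ⊎ j ≡ suc M → Fits p q n j
      case (inj₁ (s≤s j≤M)) = fits j j≤M
      case (inj₂ refl)      = last
    combine : (∃[ p ] ∃[ q ] const (ratio p q) ≤ᴿ λ′ × (∀ j → j ≤ M → Fits p q n j)) →
      (∃[ p ] ∃[ q ] const (ratio p q) ≤ᴿ λ′ × Fits p q n (suc M)) →
      ∃[ p ] ∃[ q ] const (ratio p q) ≤ᴿ λ′ × (∀ j → j ≤ suc M → Fits p q n j)
    combine (p , q , p/q≤λ , fits) (p′ , q′ , p′/q′≤λ , last) = larger (≤-total (suc p * suc q′) (suc p′ * suc q))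
      where
      larger : suc p * suc q′ ≤ suc p′ * suc q ⊎ suc p′ * suc q ≤ suc p * suc q′ →
        ∃[ p ] ∃[ q ] const (ratio p q) ≤ᴿ λ′ × (∀ j → j ≤ suc M → Fits p q n j)
      larger (inj₁ le) = p′ , q′ , p′/q′≤λ , extend {p′} {q′} (λ j j≤M → fits-raise {n} {j} p q p′ q′ le (fits j j≤M)) last
      larger (inj₂ le) = p , q , p/q≤λ , extend {p} {q} fits (fits-raise {n} {suc M} p′ q′ p q le last)

  -- The order M is any integer above λ. The sequence starts at base 1, since a larger exponent
  -- gives a larger power only for positive bases.
  floor-boundedDifference : ∃[ M ] BoundedDifference M (λ n → floor (suc n))
  floor-boundedDifference = M , M ^ M + 2 ^ M * 2 , λ n →
    subst (λ d → ℤ.∣ d ∣ ≤ M ^ M + 2 ^ M * 2) (Δ^-cong-∀ (λ j → sym (floor≡φ (suc j))) M n)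
      (powerLike-Δ^-bound M (λ j → φ (suc j)) powerLike n)
    where
    M = proj₁ (upper-bound λ′)
    λ<M = proj₂ (upper-bound λ′)
    powerLike : PowerLike M (λ j → φ (suc j))
    powerLike n =
      let (p , q , p/q≤λ , fits) = window-ratio n M
          p/q<M = const-<⁻¹ {ratio p q} {nat M} (≤ᴿ-<ᴿ-trans {const (ratio p q)} {λ′} {const (nat M)} p/q≤λ λ<M)
      in p , q , ratio-≤-nat {p} {q} M (ℚₚ.<⇒≤ p/q<M) , λ j j≤M →
        -- The upper half of `PowerLike` holds for every exponent p/q ≤ λ: otherwise `suc (φ _)`
        -- would be a power below n^λ and hence at most `φ _`.
        ≰⇒> (λ φ^≤ → <⇒≱ (n<1+n (φ (suc (j + n)))) (≤-φ p q p/q≤λ φ^≤)) , fits j j≤M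

-- Comparison of sequences with powers

-- With P/Q in place of an exponent, |h n| ≤ K n^(P/Q) is tested on the Q-th powers n = t^Q only, so that no roots occur.
record BoundedOnPowers (h : ℕ → ℤ) (P Q K t₀ : ℕ) : Set where
  constructor bounded
  field
    at : ∀ t → t₀ < t → ℤ.∣ h (t ^ Q) ∣ ≤ K * t ^ P

infix 4 _≺_

-- A strict bound x on the growth exponent. The rational p/q < x leaves a margin, so a sequence of
-- exact order n^μ satisfies it for x > μ and fails it at x = μ.
record _≺_ (h : ℕ → ℤ) (x : ℝ) : Set where
  constructor dominated
  field
    p q    : ℕ
    {K t₀} : ℕ
    p/q<x  : const (ratio p q) <ᴿ x
    bound  : BoundedOnPowers h (suc p) (suc q) K t₀

-- A power of exponent `Q * suc c` is the Q-th power of `t ^ suc c`, so the test on Q-th powers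
-- includes it. This brings tests with different Q to a common one.
scale-exponents : ∀ {h P Q K t₀} c → BoundedOnPowers h P Q K t₀ → BoundedOnPowers h (P * suc c) (Q * suc c) K t₀
scale-exponents {h} {P} {Q} {K} {t₀} c (bounded bound) = bounded λ t t₀<t → let power-swap = power-swap t in begin
  ℤ.∣ h (t ^ (Q * suc c)) ∣     ≡⟨ cong (λ n → ℤ.∣ h n ∣) (power-swap Q) ⟩
  ℤ.∣ h ((t ^ suc c) ^ Q) ∣     ≤⟨ bound (t ^ suc c) (<-≤-trans t₀<t (m≤m*n t (t ^ c) {{m^n≢0 t c {{>-nonZero (≤-<-trans z≤n t₀<t)}}}})) ⟩
  K * (t ^ suc c) ^ P           ≡⟨ cong (K *_) (power-swap P) ⟨
  K * t ^ (P * suc c)           ∎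
  where
  open ≤-Reasoning
  power-swap : ∀ t R → t ^ (R * suc c) ≡ (t ^ suc c) ^ R
  power-swap t R = trans (cong (t ^_) (*-comm R (suc c))) (sym (^-*-assoc t (suc c) R))

raise-power : ∀ {h P P′ Q K t₀} → P ≤ P′ → BoundedOnPowers h P Q K t₀ → BoundedOnPowers h P′ Q K t₀
raise-power {K = K} P≤P′ (bounded bound) = bounded λ t t₀<t →
  ≤-trans (bound t t₀<t) (*-monoʳ-≤ K (^-monoʳ-≤ t {{>-nonZero (≤-<-trans z≤n t₀<t)}} P≤P′))

combine-bounds : ∀ {f h P Q K₁ K₂ t₁ t₂} (_∙_ : ℤ → ℤ → ℤ) → (∀ a b → ℤ.∣ a ∙ b ∣ ≤ ℤ.∣ a ∣ + ℤ.∣ b ∣) →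
  BoundedOnPowers f P Q K₁ t₁ → BoundedOnPowers h P Q K₂ t₂ → BoundedOnPowers (λ n → f n ∙ h n) P Q (K₁ + K₂) (t₁ ⊔ t₂)
combine-bounds {f} {h} {P} {Q} {K₁} {K₂} {t₁} {t₂} _∙_ ∣∙∣≤ (bounded f≤) (bounded h≤) = bounded λ t t₀<t →
  ≤-trans (∣∙∣≤ (f (t ^ Q)) (h (t ^ Q))) (≤-trans
    (+-mono-≤ (f≤ t (≤-<-trans (m≤m⊔n t₁ t₂) t₀<t)) (h≤ t (≤-<-trans (m≤n⊔m t₁ t₂) t₀<t)))
    (≤-reflexive (sym (*-distribʳ-+ (t ^ P) K₁ K₂))))

ratio-scale : ∀ p q c → ratio (c + p * suc c) (c + q * suc c) ≡ ratio p q
ratio-scale p q c = ℚₚ.≤-antisym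
  (ratio-mono {c + p * suc c} {c + q * suc c} {p} {q} (≤-reflexive eq)) (ratio-mono {p} {q} {c + p * suc c} {c + q * suc c} (≤-reflexive (sym eq)))
  where
  eq : suc p * suc c * suc q ≡ suc p * (suc q * suc c)
  eq = trans (*-assoc (suc p) (suc c) (suc q)) (cong (suc p *_) (*-comm (suc c) (suc q)))

≺-combine : ∀ {f h x} (_∙_ : ℤ → ℤ → ℤ) → (∀ a b → ℤ.∣ a ∙ b ∣ ≤ ℤ.∣ a ∣ + ℤ.∣ b ∣) →
  f ≺ x → h ≺ x → (λ n → f n ∙ h n) ≺ x
≺-combine {f} {h} {x} _∙_ ∣∙∣≤ (dominated p q {K₁} {t₁} p/q<x f≤) (dominated p′ q′ {K₂} {t₂} p′/q′<x h≤)
  with ≤-total (suc p * suc q′) (suc p′ * suc q)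
-- The arguments are the predecessors of `suc p′ * suc q` and `suc q′ * suc q`: the larger exponent
-- p′/q′ over the common denominator.
... | inj₁ pq′≤p′q = dominated (q + p′ * suc q) (q + q′ * suc q) (subst (λ c → const c <ᴿ x) (sym (ratio-scale p′ q′ q)) p′/q′<x)
      (combine-bounds _∙_ ∣∙∣≤
        (subst (λ Q → BoundedOnPowers f (suc p′ * suc q) Q K₁ t₁) (*-comm (suc q) (suc q′)) (raise-power pq′≤p′q (scale-exponents q′ f≤)))
        (scale-exponents q h≤))
... | inj₂ p′q≤pq′ = dominated (q′ + p * suc q′) (q′ + q * suc q′) (subst (λ c → const c <ᴿ x) (sym (ratio-scale p q q′)) p/q<x)
      (combine-bounds _∙_ ∣∙∣≤
        (scale-exponents q′ f≤)
        (subst (λ Q → BoundedOnPowers h (suc p * suc q′) Q K₂ t₂) (*-comm (suc q′) (suc q)) (raise-power p′q≤pq′ (scale-exponents q h≤))))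

≺-dominated-by : ∀ {f h x} B L → (∀ n → L ≤ n → ℤ.∣ f n ∣ ≤ B * ℤ.∣ h n ∣) → h ≺ x → f ≺ x
≺-dominated-by {f} {h} {x} B L f≤ (dominated p q {K} {t₀} p/q<x (bounded h≤)) = dominated p q {B * K} {t₀ ⊔ L} p/q<x (bounded λ t lt →
  ≤-trans (f≤ (t ^ suc q) (≤-trans (≤-trans (m≤n⊔m t₀ L) (<⇒≤ lt)) (m≤m^1+n t q)))
    (≤-trans (*-monoʳ-≤ B (h≤ t (≤-<-trans (m≤m⊔n t₀ L) lt))) (≤-reflexive (sym (*-assoc B K (t ^ suc p))))))

no-domination : ∀ K {a b t} → b < a → K < t → ¬ (t ^ a ≤ K * t ^ b)
no-domination K {a} {b} {t} b<a K<t t^a≤ = <⇒≱ K<t (*-cancelʳ-≤ t K (t ^ b) {{m^n≢0 t b}} (≤-trans (^-monoʳ-≤ t b<a) t^a≤))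
  where
  instance
    t≢0 : NonZero t
    t≢0 = >-nonZero (≤-<-trans z≤n K<t)

private
  0≤nat-const : ∀ e → 0ᴿ ≤ᴿ const (nat e)
  0≤nat-const e = const-≤ {0ℚ} {nat e} (0≤nat e)

≺-power : ∀ {h x} e A L → (∀ n → L ≤ n → ℤ.∣ h n ∣ ≤ A * n ^ e) → const (nat e) <ᴿ x → h ≺ x
≺-power {h} {x} e A L h≤ e<x =
  let (p , q , e<p/q , p/q<x) = ratio-between {const (nat e)} {x} (0≤nat-const e) e<x
      eq≤p = nat-≤-ratio {p} {q} e (ℚₚ.<⇒≤ (const-<⁻¹ e<p/q))
  in dominated p q {A} {L} p/q<x (bounded λ t L<t → ≤-trans (h≤ (t ^ suc q) (≤-trans (<⇒≤ L<t) (m≤m^1+n t q)))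
       (*-monoʳ-≤ A (≤-trans (≤-reflexive (trans (^-*-assoc t (suc q) e) (cong (t ^_) (*-comm (suc q) e))))
         (^-monoʳ-≤ t {{>-nonZero (≤-<-trans z≤n L<t)}} eq≤p))))

⊀-power : ∀ {h} e A L → (∀ n → L ≤ n → n ^ e ≤ A * ℤ.∣ h n ∣) → ¬ h ≺ const (nat e)
⊀-power {h} e A L ≤h (dominated p q {K} {t₀} p/q<e (bounded h≤)) =
  no-domination (A * K) {e * suc q} {suc p} p<eq (s≤s (m≤n+m (A * K) (t₀ + L))) (begin
    t ^ (e * suc q)            ≡⟨ cong (t ^_) (*-comm e (suc q)) ⟩
    t ^ (suc q * e)            ≡⟨ ^-*-assoc t (suc q) e ⟨
    (t ^ suc q) ^ e            ≤⟨ ≤h (t ^ suc q) (≤-trans (≤-trans (m≤n+m L t₀) (≤-trans (m≤m+n (t₀ + L) (A * K)) (n≤1+n _))) (m≤m^1+n t q)) ⟩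
    A * ℤ.∣ h (t ^ suc q) ∣    ≤⟨ *-monoʳ-≤ A (h≤ t (s≤s (≤-trans (m≤m+n t₀ L) (m≤m+n (t₀ + L) (A * K))))) ⟩
    A * (K * t ^ suc p)        ≡⟨ *-assoc A K (t ^ suc p) ⟨
    A * K * t ^ suc p          ∎)
  where
  open ≤-Reasoning
  t = suc (t₀ + L + A * K)
  p<eq : suc p < e * suc q
  p<eq = ≰⇒> λ eq≤p → ℚₚ.<-irrefl refl (ℚₚ.<-≤-trans (const-<⁻¹ p/q<e)
    (nat-mono-ratio {p} {q} e eq≤p))

module _ (em : ExcludedMiddle 0ℓ) (λ′ : ℝ) (0<λ : 0ᴿ <ᴿ λ′)
  (floor : ℕ → ℤ) (isFloor : IsFloorOfPower λ′ floor) where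

  open FloorOfPower em λ′ 0<λ floor isFloor

  -- For a rational p/q between λ and x, the number n^(p/q) at n = t^q is the integer t^p and bounds
  -- the integer part there with constant 1.
  floor-≺ : ∀ {x} → λ′ <ᴿ x → floor ≺ x
  floor-≺ {x} λ<x =
    let (p , q , λ<p/q , p/q<x) = ratio-between {λ′} {x} (<ᴿ⇒≤ᴿ {0ᴿ} {λ′} 0<λ) λ<x
    in dominated p q {1} {0} p/q<x (bounded λ t 0<t → ≤-trans
         (φ-≤ p q {{m^n≢0 t (suc q) {{>-nonZero 0<t}}}} λ<p/q (≤-reflexive (power-swap t p q)))
         (≤-reflexive (sym (*-identityˡ (t ^ suc p)))))
    where
    power-swap : ∀ t p q → (t ^ suc q) ^ suc p ≡ (t ^ suc p) ^ suc q
    power-swap t p q = trans (^-*-assoc t (suc q) (suc p)) (trans (cong (t ^_) (*-comm (suc q) (suc p))) (sym (^-*-assoc t (suc p) (suc q))))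

  floor-polynomial-bound : ∃[ s ] ∀ n → ℤ.∣ floor (suc n) ∣ ≤ 1 * suc (suc n) ^ s
  floor-polynomial-bound =
    let (M , λ<M) = upper-bound λ′
        (p , q , λ<p/q , _) = ratio-between {λ′} {const (nat M)} (<ᴿ⇒≤ᴿ {0ᴿ} {λ′} 0<λ) λ<M
    in suc p , λ n → ≤-trans (φ-≤ p q λ<p/q (m≤m^1+n (suc n ^ suc p) q))
         (≤-trans (^-monoˡ-≤ (suc p) (n≤1+n (suc n))) (≤-reflexive (sym (*-identityˡ (suc (suc n) ^ suc p)))))

  -- Another rational p′/q′ fits strictly between p/q and λ. At n = t^(qq′) the integer part is at
  -- least t^(p′q), while the assumed bound is K t^(pq′) with a smaller exponent.
  floor-⊀ : ¬ floor ≺ λ′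
  floor-⊀ (dominated p q {K} {t₀} p/q<λ floor≤) =
    let (p′ , q′ , p/q<p′/q′ , p′/q′<λ) = ratio-between {const (ratio p q)} {λ′} (const-≤ {0ℚ} {ratio p q} (0≤ratio p q)) p/q<λ
        t = suc (t₀ + K)
        pq′<p′q : suc p * suc q′ < suc p′ * suc q
        pq′<p′q = ≰⇒> λ p′q≤pq′ → ℚₚ.<-irrefl refl (ℚₚ.<-≤-trans (const-<⁻¹ p/q<p′/q′) (ratio-mono {p′} {q′} {p} {q} p′q≤pq′))
    in no-domination K {suc p′ * suc q} {suc p * suc q′} pq′<p′q (s≤s (m≤n+m K t₀)) (≤-trans
         (≤-φ p′ q′ (<ᴿ⇒≤ᴿ {const (ratio p′ q′)} {λ′} p′/q′<λ) (≤-reflexive (power-identity t p′ q q′)))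
         (BoundedOnPowers.at (scale-exponents q′ floor≤) t (s≤s (m≤m+n t₀ K))))
    where
    power-identity : ∀ t p′ q q′ → (t ^ (suc p′ * suc q)) ^ suc q′ ≡ (t ^ (suc q * suc q′)) ^ suc p′
    power-identity t p′ q q′ = trans (^-*-assoc t (suc p′ * suc q) (suc q′))
      (trans (cong (t ^_) (rearrange (suc p′) (suc q) (suc q′))) (sym (^-*-assoc t (suc q * suc q′) (suc p′))))
      where
      rearrange : ∀ a b c → a * b * c ≡ b * c * a
      rearrange = solve-∀

-- Finite sums of sequences and the choice of a maximal exponent

Σᶻ : ∀ {m} → (Fin m → ℤ) → ℤ
Σᶻ = foldr ℤ._+_ ℤ.0ℤ

Σᶻ-cong : ∀ {m} {f h : Fin m → ℤ} → (∀ k → f k ≡ h k) → Σᶻ f ≡ Σᶻ h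
Σᶻ-cong {zero}  f≗h = refl
Σᶻ-cong {suc m} f≗h = cong₂ ℤ._+_ (f≗h zero) (Σᶻ-cong (f≗h ∘ suc))

Σᶻ-closed : (V : (ℕ → ℤ) → Set) → V (λ _ → ℤ.0ℤ) → (∀ {f h} → V f → V h → V (λ n → f n ℤ.+ h n)) →
  ∀ {m} (h : Fin m → ℕ → ℤ) → (∀ k → V (h k)) → V (λ n → Σᶻ λ k → h k n)
Σᶻ-closed V V0 V+ {zero}  h Vh = V0
Σᶻ-closed V V0 V+ {suc m} h Vh = V+ (Vh zero) (Σᶻ-closed V V0 V+ (h ∘ suc) (Vh ∘ suc))

-- Stated for a class V closed under sums and differences because it serves twice: for the growth
-- class `_≺ λ′` and for the class of zero sequences.
Σᶻ-isolate : (V : (ℕ → ℤ) → Set) → (∀ {f h} → (∀ n → f n ≡ h n) → V f → V h) → V (λ _ → ℤ.0ℤ) →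
  (∀ {f h} → V f → V h → V (λ n → f n ℤ.+ h n)) → (∀ {f h} → V f → V h → V (λ n → f n ℤ.- h n)) →
  ∀ {m} (h : Fin m → ℕ → ℤ) k₀ → (∀ k → k ≢ k₀ → V (h k)) → V (λ n → Σᶻ λ k → h k n) → V (h k₀)
Σᶻ-isolate V V-cong V0 V+ V- h zero others total = V-cong (λ n → cancel (h zero n) (Σᶻ λ k → h (suc k) n))
  (V- total (Σᶻ-closed V V0 V+ (h ∘ suc) λ k → others (suc k) λ ()))
  where
  cancel : ∀ a b → (a ℤ.+ b) ℤ.- b ≡ a
  cancel = ℤ-Ring.solve-∀
Σᶻ-isolate V V-cong V0 V+ V- h (suc k₀) others total = Σᶻ-isolate V V-cong V0 V+ V- (h ∘ suc) k₀
  (λ k k≢k₀ → others (suc k) λ { refl → k≢k₀ refl })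
  (V-cong (λ n → cancel (h zero n) (Σᶻ λ k → h (suc k) n)) (V- total (others zero λ ())))
  where
  cancel : ∀ a b → (a ℤ.+ b) ℤ.- a ≡ b
  cancel = ℤ-Ring.solve-∀

argmax : ExcludedMiddle 0ℓ → ∀ {m} (Good : Fin m → Set) (rank : Fin m → ℝ) → ∃ Good →
  ∃[ k₀ ] Good k₀ × (∀ k → Good k → rank k ≤ᴿ rank k₀)
argmax em {suc m} Good rank (k , good) with em {∃[ k ] Good (suc k)}
... | no none = k , good , λ { k′ good′ → subst₂ (λ a b → rank a ≤ᴿ rank b) (sym (is-zero k′ good′)) (sym (is-zero k good)) (≤-refl′ (rank zero)) }
  where
  is-zero : ∀ k → Good k → k ≡ zero
  is-zero zero    _    = refl
  is-zero (suc k) good = contradiction (k , good) none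
  ≤-refl′ : ∀ x → x ≤ᴿ x
  ≤-refl′ x x<x = <ᴿ⇒≤ᴿ {x} {x} x<x x<x
... | yes some with argmax em (Good ∘ suc) (rank ∘ suc) some
...   | k₁ , good₁ , max with em {Good zero × rank (suc k₁) <ᴿ rank zero}
...     | yes (good₀ , k₁<0) = zero , good₀ , λ
          { zero    _     x<x  → <ᴿ⇒≤ᴿ {rank zero} {rank zero} x<x x<x
          ; (suc k) good′ → ≤ᴿ-trans {rank (suc k)} {rank (suc k₁)} {rank zero} (max k good′) (<ᴿ⇒≤ᴿ {rank (suc k₁)} {rank zero} k₁<0) }
...     | no ¬best = suc k₁ , good₁ , λ
          { zero    good₀ k₁<0 → ¬best (good₀ , k₁<0)
          ; (suc k) good′ → max k good′ }

-- Linear relations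

CommonDenominator : ∀ {m} → (Fin m → ℚ) → Set
CommonDenominator {m} c = ∃[ d ] Σ (Fin m → ℤ) λ b → ∀ k → ι (b k) ≡ nat (suc d) ℚ.* c k

common-denominator : ∀ {m} (c : Fin m → ℚ) → CommonDenominator c
common-denominator {zero}  c = 0 , (λ ()) , λ ()
common-denominator {suc m} c = extend (c zero) refl (common-denominator (c ∘ suc))
  where
  extend : ∀ c₀ → c zero ≡ c₀ → CommonDenominator (c ∘ suc) → CommonDenominator c
  extend c₀@(mkℚ i d′ _) c≡ (d , b , b≡) = d′ + d * suc d′ ,
    (λ { zero → + suc d ℤ.* i ; (suc k) → + suc d′ ℤ.* b k }) ,
    λ { zero    → trans (sym (ι-* (+ suc d) i)) (trans (cong (nat (suc d) ℚ.*_) numerator)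
                    (trans (sym (ℚₚ.*-assoc (nat (suc d)) (nat (suc d′)) c₀)) (cong₂ ℚ._*_ nat-product (sym c≡))))
      ; (suc k) → trans (sym (ι-* (+ suc d′) (b k))) (trans (cong (nat (suc d′) ℚ.*_) (b≡ k))
                    (trans (sym (ℚₚ.*-assoc (nat (suc d′)) (nat (suc d)) (c (suc k))))
                      (cong (ℚ._* c (suc k)) (trans (ℚₚ.*-comm (nat (suc d′)) (nat (suc d))) nat-product)))) }
    where
    nat-product : nat (suc d) ℚ.* nat (suc d′) ≡ nat (suc d * suc d′)
    nat-product = trans (ι-* (+ suc d) (+ suc d′)) (cong ι (sym (ℤₚ.pos-* (suc d) (suc d′))))
    numerator : ι i ≡ nat (suc d′) ℚ.* c₀
    numerator = trans (ℚₚ.≤-antisym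
        (/-mono-≤ i (+ suc d′ ℤ.* i) 1 (1 * suc d′) (ℤₚ.≤-reflexive eq))
        (/-mono-≤ (+ suc d′ ℤ.* i) i (1 * suc d′) 1 (ℤₚ.≤-reflexive (sym eq))))
      (trans (sym (/-*-/ (+ suc d′) i 1 (suc d′))) (cong (nat (suc d′) ℚ.*_) (ℚₚ.↥p/↧p≡p c₀)))
      where
      eq : i ℤ.* + (1 * suc d′) ≡ (+ suc d′ ℤ.* i) ℤ.* + 1
      eq = trans (cong (λ n → i ℤ.* + n) (*-identityˡ (suc d′))) (trans (ℤₚ.*-comm i (+ suc d′)) (sym (ℤₚ.*-identityʳ (+ suc d′ ℤ.* i))))

factorial-*-/! : ∀ a n → nat (n !) ℚ.* (a /! n) ≡ ι a
factorial-*-/! a n = trans (/-*-/ (+ (n !)) a 1 (n !)) (ℚₚ.≤-antisym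
  (/-mono-≤ (+ (n !) ℤ.* a) a (1 * n !) 1 (ℤₚ.≤-reflexive eq))
  (/-mono-≤ a (+ (n !) ℤ.* a) 1 (1 * n !) (ℤₚ.≤-reflexive (sym eq))))
  where
  instance
    _ = n !≢0
    _ = m*n≢0 1 (n !)
  eq : (+ (n !) ℤ.* a) ℤ.* + 1 ≡ a ℤ.* + (1 * n !)
  eq = trans (ℤₚ.*-identityʳ (+ (n !) ℤ.* a)) (trans (ℤₚ.*-comm (+ (n !)) a) (cong (λ n → a ℤ.* + n) (sym (*-identityˡ (n !)))))

-- n! (z + ∑_{j ≤ n} a_j/j!)
scaled-sum : ℤ → (ℕ → ℤ) → ℕ → ℤ
scaled-sum z a zero    = z ℤ.+ a zero
scaled-sum z a (suc n) = + suc n ℤ.* scaled-sum z a n ℤ.+ a (suc n)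

ι-scaled-sum : ∀ z a n → ι (scaled-sum z a n) ≡ nat (n !) ℚ.* (ι z ℚ.+ sumTo (λ j → a j /! j) (suc n))
ι-scaled-sum z a zero = trans (sym (ι-+ z (a zero))) (trans (cong (ι z ℚ.+_) (sym (trans (sym (ℚₚ.*-identityˡ (a zero /! zero))) (factorial-*-/! (a zero) zero))))
  (unit-sum (ι z) (a zero /! zero)))
  where
  open ℚ-Solver.+-*-Solver
  unit-sum : ∀ z t → z ℚ.+ t ≡ 1ℚ ℚ.* (z ℚ.+ (0ℚ ℚ.+ t))
  unit-sum = solve 2 (λ z t → z :+ t := con 1ℚ :* (z :+ (con 0ℚ :+ t))) refl
ι-scaled-sum z a (suc n) = begin
  ι (+ suc n ℤ.* x ℤ.+ a (suc n))
    ≡⟨ ι-+ (+ suc n ℤ.* x) (a (suc n)) ⟨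
  ι (+ suc n ℤ.* x) ℚ.+ ι (a (suc n))
    ≡⟨ cong₂ ℚ._+_ (trans (sym (ι-* (+ suc n) x)) (cong (nat (suc n) ℚ.*_) (ι-scaled-sum z a n))) (sym (factorial-*-/! (a (suc n)) (suc n))) ⟩
  nat (suc n) ℚ.* (nat (n !) ℚ.* s) ℚ.+ nat (suc n !) ℚ.* t
    ≡⟨ cong (ℚ._+ nat (suc n !) ℚ.* t) (trans (sym (ℚₚ.*-assoc (nat (suc n)) (nat (n !)) s)) (cong (ℚ._* s) nat-factorial)) ⟩
  nat (suc n !) ℚ.* s ℚ.+ nat (suc n !) ℚ.* t
    ≡⟨ ℚₚ.*-distribˡ-+ (nat (suc n !)) s t ⟨
  nat (suc n !) ℚ.* (s ℚ.+ t)
    ≡⟨ cong (nat (suc n !) ℚ.*_) (ℚₚ.+-assoc (ι z) (sumTo (λ j → a j /! j) (suc n)) t) ⟩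
  nat (suc n !) ℚ.* (ι z ℚ.+ (sumTo (λ j → a j /! j) (suc n) ℚ.+ t)) ∎
  where
  open ≡-Reasoning
  x = scaled-sum z a n
  s = ι z ℚ.+ sumTo (λ j → a j /! j) (suc n)
  t = a (suc n) /! suc n
  nat-factorial : nat (suc n) ℚ.* nat (n !) ≡ nat (suc n !)
  nat-factorial = trans (ι-* (+ suc n) (+ (n !))) (cong ι (sym (ℤₚ.pos-* (suc n) (n !))))

-- D clears the denominators of the coefficients, and F, in the application n!, those of all partial
-- sums at once; so the partial sum of the relation itself becomes an integer.
integral-combination : ∀ {m} (b : Fin m → ℤ) (c : Fin m → ℚ) (v : Fin m → ℝ) (ρ : Fin m → ℤ) D F n →
  (∀ k → ι (b k) ≡ D ℚ.* c k) → (∀ k → ι (ρ k) ≡ F ℚ.* ℝ.seq (v k) n) →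
  ι (Σᶻ λ k → b k ℤ.* ρ k) ≡ (D ℚ.* F) ℚ.* ℝ.seq (sumᴿ λ k → c k · v k) n
integral-combination {zero}  b c v ρ D F n b≡ ρ≡ = sym (ℚₚ.*-zeroʳ (D ℚ.* F))
integral-combination {suc m} b c v ρ D F n b≡ ρ≡ = begin
  ι (b zero ℤ.* ρ zero ℤ.+ rest)
    ≡⟨ ι-+ (b zero ℤ.* ρ zero) rest ⟨
  ι (b zero ℤ.* ρ zero) ℚ.+ ι rest
    ≡⟨ cong₂ ℚ._+_ (trans (sym (ι-* (b zero) (ρ zero))) (cong₂ ℚ._*_ (b≡ zero) (ρ≡ zero)))
         (integral-combination (b ∘ suc) (c ∘ suc) (v ∘ suc) (ρ ∘ suc) D F n (b≡ ∘ suc) (ρ≡ ∘ suc)) ⟩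
  (D ℚ.* c zero) ℚ.* (F ℚ.* ℝ.seq (v zero) n) ℚ.+ (D ℚ.* F) ℚ.* tail
    ≡⟨ factor D (c zero) F (ℝ.seq (v zero) n) tail ⟩
  (D ℚ.* F) ℚ.* (c zero ℚ.* ℝ.seq (v zero) n ℚ.+ tail) ∎
  where
  open ≡-Reasoning
  rest = Σᶻ λ k → b (suc k) ℤ.* ρ (suc k)
  tail = ℝ.seq (sumᴿ λ k → c (suc k) · v (suc k)) n
  factor : ∀ D c F s t → (D ℚ.* c) ℚ.* (F ℚ.* s) ℚ.+ (D ℚ.* F) ℚ.* t ≡ (D ℚ.* F) ℚ.* (c ℚ.* s ℚ.+ t)
  factor = solve 5 (λ D c F s t → (D :* c) :* (F :* s) :+ (D :* F) :* t := (D :* F) :* (c :* s :+ t)) refl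
    where open ℚ-Solver.+-*-Solver

vanishing-numerators : ∀ d (r : ℕ → ℤ) (s : ℝ) → s ≈ 0ᴿ → (∀ n → ι (r n) ≡ (nat (suc d) ℚ.* nat (n !)) ℚ.* ℝ.seq s (suc n)) →
  ∀ c → ∃[ L ] ∀ n → L ≤ n → c * ℤ.∣ r n ∣ < n !
-- The tolerance is 1/(X+1) with X = c(d+1), because c|r(n)|/n! equals X times the absolute value of
-- the partial sum.
vanishing-numerators d r s s≈0 r≡ c with s≈0 (unit X) (0<unit X)
  where X = c * suc d
... | L , small = L , λ n L≤n → ℤₚ.drop‿+<+ (ι-cancel-< {+ (c * ℤ.∣ r n ∣)} {+ (n !)} (bound n L≤n))
  where
  X = c * suc d
  instance
    positive-factorial : ∀ {n} → ℚ.Positive (nat (n !))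
    positive-factorial {n} = ℚₚ.normalize-pos (n !) 1 {{_}} {{n !≢0}}
  bound : ∀ n → L ≤ n → nat (c * ℤ.∣ r n ∣) ℚ.< nat (n !)
  bound n L≤n = subst₂ ℚ._<_ (sym lhs) (trans (cong (nat (n !) ℚ.*_) (cancel-unit X 1ℚ)) (ℚₚ.*-identityʳ (nat (n !))))
    (ℚₚ.*-monoʳ-<-pos (nat (n !)) {{positive-factorial {n}}} (ℚₚ.≤-<-trans
      (*-mono (0≤nat X) (ℚₚ.0≤∣p∣ x) (nat-mono (n≤1+n X)) ℚₚ.≤-refl)
      (ℚₚ.*-monoʳ-<-pos (nat (suc X)) {{ℚₚ.normalize-pos (suc X) 1}} x<)))
    where
    x = ℝ.seq s (suc n)
    x< : ℚ.∣ x ∣ ℚ.< unit X ℚ.* 1ℚ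
    x< = subst₂ ℚ._<_ (cong ℚ.∣_∣ (ℚₚ.+-identityʳ x)) (sym (ℚₚ.*-identityʳ (unit X))) (small (suc n) (m≤n⇒m≤1+n L≤n))
    ∣r∣ : nat ℤ.∣ r n ∣ ≡ (nat (suc d) ℚ.* nat (n !)) ℚ.* ℚ.∣ x ∣
    ∣r∣ = trans (sym (Series.∣/∣ (r n) 1)) (trans (cong ℚ.∣_∣ (r≡ n)) (trans (ℚₚ.∣p*q∣≡∣p∣*∣q∣ (nat (suc d) ℚ.* nat (n !)) x)
      (cong (ℚ._* ℚ.∣ x ∣) (ℚₚ.0≤p⇒∣p∣≡p (*-nonNeg (0≤nat (suc d)) (0≤nat (n !)))))))
    nat-* : ∀ a b → nat (a * b) ≡ nat a ℚ.* nat b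
    nat-* a b = trans (cong ι (ℤₚ.pos-* a b)) (sym (ι-* (+ a) (+ b)))
    lhs : nat (c * ℤ.∣ r n ∣) ≡ nat (n !) ℚ.* (nat X ℚ.* ℚ.∣ x ∣)
    lhs = trans (nat-* c ℤ.∣ r n ∣) (trans (cong (nat c ℚ.*_) ∣r∣)
      (trans (regroup (nat c) (nat (suc d)) (nat (n !)) ℚ.∣ x ∣) (cong (λ y → nat (n !) ℚ.* (y ℚ.* ℚ.∣ x ∣)) (sym (nat-* c (suc d))))))
      where
      open ℚ-Solver.+-*-Solver
      regroup : ∀ c d f x → c ℚ.* ((d ℚ.* f) ℚ.* x) ≡ f ℚ.* ((c ℚ.* d) ℚ.* x)
      regroup = solve 4 (λ c d f x → c :* ((d :* f) :* x) := f :* ((c :* d) :* x)) refl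

isFloorOfPower : ∀ λ′ (x : ∀ n → ∃ (IsSupremum (RationalPowersBelow n λ′))) (z : ℕ → ℤ) →
  (∀ n → const (ι (z n)) ≤ᴿ proj₁ (x n) × proj₁ (x n) <ᴿ const (ι (z n ℤ.+ + 1))) → IsFloorOfPower λ′ z
isFloorOfPower λ′ x z part = record
  { below-suc = λ n y Py → supremum-below-suc-floor {RationalPowersBelow n λ′} (proj₁ (x n)) (z n) (proj₂ (x n)) (proj₂ (part n)) y (powersBelow⁻ n λ′ y Py)
  ; least     = λ n b P≤b → supremum-floor-least {RationalPowersBelow n λ′} (proj₁ (x n)) (z n) (proj₂ (x n)) (proj₁ (part n)) b λ y Py → P≤b y (powersBelow⁺ n λ′ y Py)
  }

-- Closure properties of growth bounds and bounded differences

PolynomialBound : (ℕ → ℤ) → Set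
PolynomialBound f = ∃[ K ] ∃[ s ] ∀ n → ℤ.∣ f n ∣ ≤ K * suc (suc n) ^ s

polynomialBound-0 : PolynomialBound (λ _ → ℤ.0ℤ)
polynomialBound-0 = 0 , 0 , λ _ → z≤n

polynomialBound-+ : ∀ {f h} → PolynomialBound f → PolynomialBound h → PolynomialBound (λ n → f n ℤ.+ h n)
polynomialBound-+ {f} {h} (K , s , f≤) (K′ , s′ , h≤) = K + K′ , s + s′ , λ n →
  ≤-trans (∣+∣≤ {f n} {h n}
    (≤-trans (f≤ n) (*-monoʳ-≤ K (^-monoʳ-≤ (suc (suc n)) (m≤m+n s s′))))
    (≤-trans (h≤ n) (*-monoʳ-≤ K′ (^-monoʳ-≤ (suc (suc n)) (m≤n+m s′ s)))))
  (≤-reflexive (sym (*-distribʳ-+ (suc (suc n) ^ (s + s′)) K K′)))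

polynomialBound-* : ∀ {f} c → PolynomialBound f → PolynomialBound (λ n → c ℤ.* f n)
polynomialBound-* {f} c (K , s , f≤) = ℤ.∣ c ∣ * K , s , λ n →
  ≤-trans (∣*∣≤ c {f n} (f≤ n)) (≤-reflexive (sym (*-assoc ℤ.∣ c ∣ K (suc (suc n) ^ s))))

SomeBoundedDifference : (ℕ → ℤ) → Set
SomeBoundedDifference f = ∃[ m ] BoundedDifference m f

someBoundedDifference-constant : ∀ c → SomeBoundedDifference (λ _ → c)
someBoundedDifference-constant c = 0 , ℤ.∣ c ∣ , λ _ → ≤-refl

someBoundedDifference-+ : ∀ {f h} → SomeBoundedDifference f → SomeBoundedDifference h → SomeBoundedDifference (λ n → f n ℤ.+ h n)
someBoundedDifference-+ {f} {h} (m , f≤) (m′ , h≤) =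
  let (C , f≤C) = boundedDifference-raise {f} {m} m′ f≤
      (C′ , h≤C′) = boundedDifference-raise {h} {m′} m h≤
  in m′ + m , C + C′ , λ n → ≤-trans (≤-reflexive (cong ℤ.∣_∣ (Δ^-+ f h (m′ + m) n)))
       (∣+∣≤ {Δ^ (m′ + m) f n} {Δ^ (m′ + m) h n} (f≤C n) (subst (λ m → ℤ.∣ Δ^ m h n ∣ ≤ C′) (+-comm m m′) (h≤C′ n)))

someBoundedDifference-* : ∀ {f} c → SomeBoundedDifference f → SomeBoundedDifference (λ n → c ℤ.* f n)
someBoundedDifference-* {f} c (m , C , f≤) = m , ℤ.∣ c ∣ * C , λ n →
  ≤-trans (≤-reflexive (cong ℤ.∣_∣ (Δ^-* c f m n))) (∣*∣≤ c {Δ^ m f n} (f≤ n))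

eventuallyPolynomial-unshift : ∀ f → EventuallyPolynomial (λ n → f (suc n)) → EventuallyPolynomial f
eventuallyPolynomial-unshift f (m , L , Δ^f≡0) = m , suc L , λ { (suc n) (s≤s L≤n) → trans (sym (Δ^-shift f 1 m n)) (Δ^f≡0 n L≤n) }

0ᶻ-≺ : ∀ {x} → 0ᴿ <ᴿ x → (λ _ → ℤ.0ℤ) ≺ x
0ᶻ-≺ {x} 0<x = ≺-power {λ _ → ℤ.0ℤ} {x} 0 0 0 (λ _ _ → z≤n) 0<x

≺-+ : ∀ {x f h} → f ≺ x → h ≺ x → (λ n → f n ℤ.+ h n) ≺ x
≺-+ = ≺-combine ℤ._+_ ℤₚ.∣i+j∣≤∣i∣+∣j∣

≺-- : ∀ {x f h} → f ≺ x → h ≺ x → (λ n → f n ℤ.- h n) ≺ x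
≺-- = ≺-combine ℤ._-_ ℤₚ.∣i-j∣≤∣i∣+∣j∣

≺-cong : ∀ {x f h} → (∀ n → f n ≡ h n) → f ≺ x → h ≺ x
≺-cong {x} {f} f≗h = ≺-dominated-by {h = f} 1 0 λ n _ → ≤-reflexive (trans (cong ℤ.∣_∣ (sym (f≗h n))) (sym (*-identityˡ ℤ.∣ f n ∣)))

Σᶻ-recurrence : ∀ {m} (b ρ a : Fin m → ℤ) N → Σᶻ (λ k → b k ℤ.* (N ℤ.* ρ k ℤ.+ a k)) ≡ N ℤ.* Σᶻ (λ k → b k ℤ.* ρ k) ℤ.+ Σᶻ (λ k → b k ℤ.* a k)
Σᶻ-recurrence {zero}  b ρ a N = sym (trans (ℤₚ.+-identityʳ (N ℤ.* ℤ.0ℤ)) (ℤₚ.*-zeroʳ N))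
Σᶻ-recurrence {suc m} b ρ a N = trans
  (cong (λ t → b zero ℤ.* (N ℤ.* ρ zero ℤ.+ a zero) ℤ.+ t) (Σᶻ-recurrence (b ∘ suc) (ρ ∘ suc) (a ∘ suc) N))
  (regroup (b zero) N (ρ zero) (a zero) (Σᶻ λ k → b (suc k) ℤ.* ρ (suc k)) (Σᶻ λ k → b (suc k) ℤ.* a (suc k)))
  where
  regroup : ∀ b N ρ a s t → b ℤ.* (N ℤ.* ρ ℤ.+ a) ℤ.+ (N ℤ.* s ℤ.+ t) ≡ N ℤ.* (b ℤ.* ρ ℤ.+ s) ℤ.+ (b ℤ.* a ℤ.+ t)
  regroup = ℤ-Ring.solve-∀

Σᶻ-only-term : ∀ {m} (f : Fin m → ℤ) k₀ → (∀ k → k ≢ k₀ → f k ≡ ℤ.0ℤ) → Σᶻ f ≡ ℤ.0ℤ → f k₀ ≡ ℤ.0ℤ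
Σᶻ-only-term f k₀ others total = Σᶻ-isolate (λ h → ∀ n → h n ≡ ℤ.0ℤ)
  (λ f≗h f≡0 n → trans (sym (f≗h n)) (f≡0 n)) (λ _ → refl)
  (λ f≡0 h≡0 n → cong₂ ℤ._+_ (f≡0 n) (h≡0 n)) (λ f≡0 h≡0 n → cong₂ ℤ._-_ (f≡0 n) (h≡0 n))
  (λ k _ → f k) k₀ (λ k k≢k₀ _ → others k k≢k₀) (λ _ → total) 0

sumTo-0 : ∀ n → sumTo (λ j → ℤ.0ℤ /! j) n ≡ 0ℚ
sumTo-0 zero    = refl
sumTo-0 (suc n) = trans (cong₂ ℚ._+_ (sumTo-0 n) (ℚₚ.0/n≡0 (n !) {{n !≢0}})) (ℚₚ.+-identityˡ 0ℚ)

-- The members of the family and the vanishing of their coefficients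

IsExponent : Index → Set
IsExponent one            = ⊥
IsExponent euler          = ⊥
IsExponent (exponent _ _) = ⊤

rank : Index → ℝ
rank one             = 0ᴿ
rank euler           = 0ᴿ
rank (exponent λ⁺ _) = proj₁ λ⁺

-- Every member is treated as an integer plus a series over n!. The number 1 is the integer 1 with
-- the zero series, and the other members have offset 0.
offset : Index → ℤ
offset one            = + 1
offset euler          = ℤ.0ℤ
offset (exponent _ _) = ℤ.0ℤ

-- The constant value that the terms of the member's series contribute once all exponents have
-- coefficient 0.
weight : Index → ℤ
weight one            = ℤ.0ℤ
weight euler          = + 1
weight (exponent _ _) = ℤ.0ℤ

module Independence (em : ExcludedMiddle 0ℓ) (value : Index → ℝ) (value≡ : value ≡ member em) where

  private
    value-seq≡ : ∀ j n → ℝ.seq (member em j) n ≡ ℝ.seq (value j) n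
    value-seq≡ j n = cong (λ v → ℝ.seq (v j) n) (sym value≡)

  private
    -- These take no classical argument, because em written as an argument is elaborated afresh at each
    -- occurrence, and comparing two such copies makes Agda unfold the supremum.
    powers : ∀ λ′ → 0ᴿ <ᴿ λ′ → ∀ n → ∃ (IsSupremum (RationalPowersBelow n λ′))
    powers λ′ 0<λ n = power em n λ′ 0<λ

    floorᴿ : ℝ → ℤ
    floorᴿ = ⌊_⌋ᴿ em

    floorᴿ-spec : ∀ x → const (ι (floorᴿ x)) ≤ᴿ x × x <ᴿ const (ι (floorᴿ x ℤ.+ + 1))
    floorᴿ-spec x = proj₂ (Completeness.integer-part em x)

  abstract
    floorPower : ∀ λ′ → 0ᴿ <ᴿ λ′ → ℕ → ℤ
    floorPower λ′ 0<λ n = floorᴿ (proj₁ (powers λ′ 0<λ n))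

    floorPower-spec : ∀ λ′ 0<λ → IsFloorOfPower λ′ (floorPower λ′ 0<λ)
    floorPower-spec λ′ 0<λ = isFloorOfPower λ′ (powers λ′ 0<λ) (floorPower λ′ 0<λ) (λ n → floorᴿ-spec (proj₁ (powers λ′ 0<λ n)))

    floorPower-sum : ∀ λ′ 0<λ p n → sumTo (λ l → floorPower λ′ 0<λ l /! l) n ≡ ℝ.seq (member em (exponent (λ′ , 0<λ) p)) n
    floorPower-sum λ′ 0<λ p n = refl

  coefficient : Index → ℕ → ℤ
  coefficient one            _ = ℤ.0ℤ
  coefficient euler          _ = + 1
  coefficient (exponent (λ′ , 0<λ) _) = floorPower λ′ 0<λ

  value-seq : ∀ j n → ι (offset j) ℚ.+ sumTo (λ l → coefficient j l /! l) n ≡ ℝ.seq (value j) n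
  value-seq one   n = trans (trans (cong (1ℚ ℚ.+_) (sumTo-0 n)) (ℚₚ.+-identityʳ 1ℚ)) (value-seq≡ one n)
  value-seq euler n = trans (ℚₚ.+-identityˡ (sumTo (λ l → (+ 1) /! l) n)) (value-seq≡ euler n)
  value-seq j@(exponent (λ′ , 0<λ) p) n = trans (ℚₚ.+-identityˡ (sumTo (λ l → floorPower λ′ 0<λ l /! l) n))
    (trans (floorPower-sum λ′ 0<λ p n) (value-seq≡ j n))

  coefficient-polynomialBound : ∀ j → PolynomialBound (λ n → coefficient j (suc n))
  coefficient-polynomialBound one   = polynomialBound-0
  coefficient-polynomialBound euler = 1 , 0 , λ _ → ≤-refl
  coefficient-polynomialBound (exponent (λ′ , 0<λ) _) = 1 , floor-polynomial-bound em λ′ 0<λ (floorPower λ′ 0<λ) (floorPower-spec λ′ 0<λ)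

  coefficient-boundedDifference : ∀ j → SomeBoundedDifference (λ n → coefficient j (suc n))
  coefficient-boundedDifference one   = someBoundedDifference-constant ℤ.0ℤ
  coefficient-boundedDifference euler = someBoundedDifference-constant (+ 1)
  coefficient-boundedDifference (exponent (λ′ , 0<λ) _) =
    FloorOfPower.floor-boundedDifference em λ′ 0<λ (floorPower λ′ 0<λ) (floorPower-spec λ′ 0<λ)

  coefficient-≺ : ∀ j {x} → 0ᴿ <ᴿ x → rank j <ᴿ x → coefficient j ≺ x
  coefficient-≺ one   {x} 0<x _ = 0ᶻ-≺ {x} 0<x
  coefficient-≺ euler {x} 0<x _ = ≺-power {λ _ → + 1} {x} 0 1 0 (λ _ _ → ≤-refl) 0<x
  coefficient-≺ (exponent (λ′ , 0<λ) _) {x} _ λ<x = floor-≺ em λ′ 0<λ (floorPower λ′ 0<λ) (floorPower-spec λ′ 0<λ) {x} λ<x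

  module _ {m} (i : Fin m → Index) (i-injective : Injective _≡_ _≈ᴵ_ i) (c : Fin m → ℚ)
    (vanishes : sumᴿ (λ k → c k · value (i k)) ≈ 0ᴿ)
    (d : ℕ) (b : Fin m → ℤ) (b≡ : ∀ k → ι (b k) ≡ nat (suc d) ℚ.* c k) where

    private
      term : Fin m → ℕ → ℤ
      term k n = b k ℤ.* coefficient (i k) n

      source : ℕ → ℤ
      source n = Σᶻ λ k → term k n

      r : ℕ → ℤ
      r n = Σᶻ λ k → b k ℤ.* scaled-sum (offset (i k)) (coefficient (i k)) n

      r-rec : ∀ n → r (suc n) ≡ + suc n ℤ.* r n ℤ.+ source (suc n)
      r-rec n = Σᶻ-recurrence b (λ k → scaled-sum (offset (i k)) (coefficient (i k)) n) (λ k → coefficient (i k) (suc n)) (+ suc n)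

      r-vanishing : ∀ c → ∃[ L ] ∀ n → L ≤ n → c * ℤ.∣ r n ∣ < n !
      r-vanishing = vanishing-numerators d r (sumᴿ λ k → c k · value (i k)) vanishes λ n →
        integral-combination b c (value ∘ i) (λ k → scaled-sum (offset (i k)) (coefficient (i k)) n) (nat (suc d)) (nat (n !)) (suc n) b≡
          λ k → trans (ι-scaled-sum (offset (i k)) (coefficient (i k)) n) (cong (nat (n !) ℚ.*_) (value-seq (i k) (suc n)))

      -- The source enters shifted by one, since r(0) already contains its value at 0; the bounds on
      -- the coefficients are accordingly those at positive bases.
      module R = Recurrence r (source ∘ suc) r-rec r-vanishing

      source-polynomial : EventuallyPolynomial source
      source-polynomial =
        let (K , s , source≤) = Σᶻ-closed PolynomialBound polynomialBound-0 (λ {f} {h} → polynomialBound-+ {f} {h}) (λ k n → term k (suc n))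
              (λ k → polynomialBound-* (b k) (coefficient-polynomialBound (i k)))
            (M , difference≤) = Σᶻ-closed SomeBoundedDifference (someBoundedDifference-constant ℤ.0ℤ) (λ {f} {h} → someBoundedDifference-+ {f} {h}) (λ k n → term k (suc n))
              (λ k → someBoundedDifference-* (b k) (coefficient-boundedDifference (i k)))
        in eventuallyPolynomial-unshift source (R.source-eventuallyPolynomial K s source≤ M difference≤)

      term-zero : ∀ {k} → b k ≡ ℤ.0ℤ → ∀ n → term k n ≡ ℤ.0ℤ
      term-zero {k} bk≡0 n = trans (cong (ℤ._* coefficient (i k) n) bk≡0) (ℤₚ.*-zeroˡ (coefficient (i k) n))

      term-≺ : ∀ k {x} → 0ᴿ <ᴿ x → (b k ≢ ℤ.0ℤ → rank (i k) <ᴿ x) → term k ≺ x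
      term-≺ k {x} 0<x rank<x = by-cases (b k ℤₚ.≟ ℤ.0ℤ)
        where
        by-cases : Dec (b k ≡ ℤ.0ℤ) → term k ≺ x
        by-cases (yes bk≡0) = ≺-cong {x} (λ n → sym (term-zero bk≡0 n)) (0ᶻ-≺ {x} 0<x)
        by-cases (no bk≢0)  = ≺-dominated-by {h = coefficient (i k)} ℤ.∣ b k ∣ 0
          (λ n _ → ≤-reflexive (ℤₚ.∣i*j∣≡∣i∣*∣j∣ (b k) (coefficient (i k) n))) (coefficient-≺ (i k) {x} 0<x (rank<x bk≢0))

      Bad : Fin m → Set
      Bad k = IsExponent (i k) × b k ≢ ℤ.0ℤ

      module Maximal (k₀ : Fin m) (λ′ : ℝ) (0<λ : 0ᴿ <ᴿ λ′) (non-integral : NonIntegral λ′) (ik₀≡ : i k₀ ≡ exponent (λ′ , 0<λ) non-integral)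
        (bk₀≢0 : b k₀ ≢ ℤ.0ℤ) (maximal : ∀ k → Bad k → rank (i k) ≤ᴿ λ′) where

        rank≤ : ∀ k → b k ≢ ℤ.0ℤ → rank (i k) ≤ᴿ λ′
        rank≤ k bk≢0 = by-index (i k) (λ is-exponent → maximal k (is-exponent , bk≢0))
          where
          by-index : ∀ j → (IsExponent j → rank j ≤ᴿ λ′) → rank j ≤ᴿ λ′
          by-index one            _   = <ᴿ⇒≤ᴿ {0ᴿ} {λ′} 0<λ
          by-index euler          _   = <ᴿ⇒≤ᴿ {0ᴿ} {λ′} 0<λ
          by-index (exponent _ _) max = max tt

        -- Here the distinctness of the exponents as real numbers enters: equal reals would be equal
        -- indices, contrary to injectivity.
        rank< : ∀ k → k ≢ k₀ → b k ≢ ℤ.0ℤ → rank (i k) <ᴿ λ′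
        rank< k k≢k₀ bk≢0 = by-index (i k) refl (rank≤ k bk≢0)
          where
          by-index : ∀ j → i k ≡ j → rank j ≤ᴿ λ′ → rank j <ᴿ λ′
          by-index one            _   _ = 0<λ
          by-index euler          _   _ = 0<λ
          by-index (exponent (μ , _) _) ik≡ μ≤λ = by-order (trichotomy em μ λ′)
            where
            by-order : μ <ᴿ λ′ ⊎ μ ≈ λ′ ⊎ λ′ <ᴿ μ → μ <ᴿ λ′
            by-order (inj₁ μ<λ)        = μ<λ
            by-order (inj₂ (inj₁ μ≈λ)) = ⊥-elim (k≢k₀ (i-injective (subst₂ _≈ᴵ_ (sym ik≡) (sym ik₀≡) (exponent≈ μ≈λ))))
            by-order (inj₂ (inj₂ λ<μ)) = ⊥-elim (μ≤λ λ<μ)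

        floor-≺-term : term k₀ ≺ λ′ → floorPower λ′ 0<λ ≺ λ′
        floor-≺-term = ≺-dominated-by {h = term k₀} 1 0 λ n _ → begin
          ℤ.∣ floorPower λ′ 0<λ n ∣                 ≤⟨ m≤n*m ℤ.∣ floorPower λ′ 0<λ n ∣ ℤ.∣ b k₀ ∣ {{≢-nonZero λ ∣b∣≡0 → bk₀≢0 (ℤₚ.∣i∣≡0⇒i≡0 ∣b∣≡0)}} ⟩
          ℤ.∣ b k₀ ∣ * ℤ.∣ floorPower λ′ 0<λ n ∣    ≡⟨ ℤₚ.∣i*j∣≡∣i∣*∣j∣ (b k₀) (floorPower λ′ 0<λ n) ⟨
          ℤ.∣ b k₀ ℤ.* floorPower λ′ 0<λ n ∣        ≡⟨ cong (λ j → ℤ.∣ b k₀ ℤ.* coefficient j n ∣) (sym ik₀≡) ⟩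
          ℤ.∣ term k₀ n ∣                           ≡⟨ *-identityˡ ℤ.∣ term k₀ n ∣ ⟨
          1 * ℤ.∣ term k₀ n ∣                       ∎
          where open ≤-Reasoning

        -- With e the degree of the source: if λ < e, all terms are `≺` e and so is their sum,
        -- against its lower bound. If e < λ, the source and all other terms are `≺` λ, hence so is
        -- the term at `k₀`, against `floor-⊀`. Equality is excluded by non-integrality.
        absurd : ⊥
        absurd = let (e , A , L , upper , lower) = polynomial-degree source source-polynomial in
          by-order e A L upper (trichotomy em λ′ (const (nat e))) lower
          where
          by-order : ∀ e A L → (∀ n → L ≤ n → ℤ.∣ source n ∣ ≤ A * n ^ e) → λ′ <ᴿ const (nat e) ⊎ λ′ ≈ const (nat e) ⊎ const (nat e) <ᴿ λ′ →
            e ≡ 0 ⊎ (∀ n → L ≤ n → n ^ e ≤ A * ℤ.∣ source n ∣) → ⊥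
          -- Degree 0 without a lower bound would require λ < 0.
          by-order e A L _ (inj₁ λ<e) (inj₁ refl)  = <ᴿ⇒≤ᴿ {λ′} {0ᴿ} λ<e 0<λ
          by-order e A L _ (inj₁ λ<e) (inj₂ lower) = ⊀-power {source} e A L lower
            (Σᶻ-closed (_≺ const (nat e)) (0ᶻ-≺ {const (nat e)} 0<e) (≺-+ {const (nat e)}) term λ k →
              term-≺ k {const (nat e)} 0<e λ bk≢0 → ≤ᴿ-<ᴿ-trans {rank (i k)} {λ′} {const (nat e)} (rank≤ k bk≢0) λ<e)
            where
            0<e : 0ᴿ <ᴿ const (nat e)
            0<e = ≤ᴿ-<ᴿ-trans {0ᴿ} {λ′} {const (nat e)} (<ᴿ⇒≤ᴿ {0ᴿ} {λ′} 0<λ) λ<e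
          by-order e A L _ (inj₂ (inj₁ λ≈e)) _ = non-integral (+ e , λ≈e)
          by-order e A L upper (inj₂ (inj₂ e<λ)) _ = floor-⊀ em λ′ 0<λ (floorPower λ′ 0<λ) (floorPower-spec λ′ 0<λ)
            (floor-≺-term (Σᶻ-isolate (_≺ λ′) (≺-cong {λ′}) (0ᶻ-≺ {λ′} 0<λ) (≺-+ {λ′}) (≺-- {λ′}) term k₀
              (λ k k≢k₀ → term-≺ k {λ′} 0<λ (rank< k k≢k₀))
              (≺-power {source} {λ′} e A L upper e<λ)))

      no-Bad : ¬ ∃ Bad
      no-Bad some = by-index (proj₁ best) (i (proj₁ best)) refl (proj₁ (proj₂ best)) (proj₂ (proj₂ best))
        where
        best = argmax em Bad (rank ∘ i) some
        by-index : ∀ k₀ j → i k₀ ≡ j → Bad k₀ → (∀ k → Bad k → rank (i k) ≤ᴿ rank (i k₀)) → ⊥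
        by-index k₀ one   ik₀≡ (is-exponent , _) _ = subst IsExponent ik₀≡ is-exponent
        by-index k₀ euler ik₀≡ (is-exponent , _) _ = subst IsExponent ik₀≡ is-exponent
        by-index k₀ (exponent (λ′ , 0<λ) non-integral) ik₀≡ (_ , bk₀≢0) max =
          Maximal.absurd k₀ λ′ 0<λ non-integral ik₀≡ bk₀≢0 λ k bad → subst (λ j → rank (i k) ≤ᴿ rank j) ik₀≡ (max k bad)

      exponent-zero : ∀ k → IsExponent (i k) → b k ≡ ℤ.0ℤ
      exponent-zero k is-exponent = by-cases (b k ℤₚ.≟ ℤ.0ℤ)
        where
        by-cases : Dec (b k ≡ ℤ.0ℤ) → b k ≡ ℤ.0ℤ
        by-cases (yes bk≡0) = bk≡0
        by-cases (no bk≢0)  = ⊥-elim (no-Bad (k , is-exponent , bk≢0))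

      term-constant : ∀ k n → term k n ≡ b k ℤ.* weight (i k)
      term-constant k n = by-index (i k) (exponent-zero k)
        where
        by-index : ∀ j → (IsExponent j → b k ≡ ℤ.0ℤ) → b k ℤ.* coefficient j n ≡ b k ℤ.* weight j
        by-index one            _    = refl
        by-index euler          _    = refl
        by-index (exponent (λ′ , 0<λ) _) bk≡0 = trans (cong (ℤ._* floorPower λ′ 0<λ n) (bk≡0 tt))
          (trans (ℤₚ.*-zeroˡ (floorPower λ′ 0<λ n)) (sym (ℤₚ.*-zeroʳ (b k))))

      constants : (Σᶻ λ k → b k ℤ.* weight (i k)) ≡ ℤ.0ℤ × r 0 ≡ ℤ.0ℤ
      constants = R.constant-source (Σᶻ λ k → b k ℤ.* weight (i k)) λ n → Σᶻ-cong λ k → term-constant k (suc n)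

      euler-zero : ∀ k → i k ≡ euler → b k ≡ ℤ.0ℤ
      euler-zero k ik≡ = trans (sym (ℤₚ.*-identityʳ (b k))) (trans (cong (λ j → b k ℤ.* weight j) (sym ik≡))
        (Σᶻ-only-term (λ k → b k ℤ.* weight (i k)) k others (proj₁ constants)))
        where
        others : ∀ k′ → k′ ≢ k → b k′ ℤ.* weight (i k′) ≡ ℤ.0ℤ
        others k′ k′≢k = by-index (i k′) refl
          where
          by-index : ∀ j → i k′ ≡ j → b k′ ℤ.* weight j ≡ ℤ.0ℤ
          by-index one            _    = ℤₚ.*-zeroʳ (b k′)
          by-index euler          ik′≡ = ⊥-elim (k′≢k (i-injective (subst₂ _≈ᴵ_ (sym ik′≡) (sym ik≡) euler≈)))
          by-index (exponent _ _) _    = ℤₚ.*-zeroʳ (b k′)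

      -- The equation r(0) = 0 involves the offsets and the terms at n = 0. The number e contributes
      -- its first term 1 there, so its coefficient has to be known to vanish beforehand.
      one-zero : ∀ k → i k ≡ one → b k ≡ ℤ.0ℤ
      one-zero k ik≡ = trans (sym (ℤₚ.*-identityʳ (b k))) (trans (cong (λ j → b k ℤ.* (offset j ℤ.+ coefficient j 0)) (sym ik≡))
        (Σᶻ-only-term (λ k → b k ℤ.* (offset (i k) ℤ.+ coefficient (i k) 0)) k others (proj₂ constants)))
        where
        others : ∀ k′ → k′ ≢ k → b k′ ℤ.* (offset (i k′) ℤ.+ coefficient (i k′) 0) ≡ ℤ.0ℤ
        others k′ k′≢k = by-index (i k′) refl
          where
          annihilate : ∀ a → b k′ ≡ ℤ.0ℤ → b k′ ℤ.* a ≡ ℤ.0ℤ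
          annihilate a bk′≡0 = trans (cong (ℤ._* a) bk′≡0) (ℤₚ.*-zeroˡ a)
          by-index : ∀ j → i k′ ≡ j → b k′ ℤ.* (offset j ℤ.+ coefficient j 0) ≡ ℤ.0ℤ
          by-index one            ik′≡ = ⊥-elim (k′≢k (i-injective (subst₂ _≈ᴵ_ (sym ik′≡) (sym ik≡) one≈)))
          by-index euler          ik′≡ = annihilate (+ 1) (euler-zero k′ ik′≡)
          by-index (exponent (λ′ , 0<λ) p) ik′≡ = annihilate (ℤ.0ℤ ℤ.+ floorPower λ′ 0<λ 0) (exponent-zero k′ (subst IsExponent (sym ik′≡) tt))

      numerator-zero : ∀ k → b k ≡ ℤ.0ℤ
      numerator-zero k = by-index (i k) refl
        where
        by-index : ∀ j → i k ≡ j → b k ≡ ℤ.0ℤ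
        by-index one            = one-zero k
        by-index euler          = euler-zero k
        by-index (exponent _ _) ik≡ = exponent-zero k (subst IsExponent (sym ik≡) tt)

    coefficients-zero : ∀ k → c k ≡ 0ℚ
    coefficients-zero k = trans (sym (cancel-unit d (c k))) (trans (regroup (nat (suc d)) (unit d) (c k))
      (trans (cong (unit d ℚ.*_) (trans (sym (b≡ k)) (cong ι (numerator-zero k)))) (ℚₚ.*-zeroʳ (unit d))))
      where
      open ℚ-Solver.+-*-Solver
      regroup : ∀ D u x → D ℚ.* (u ℚ.* x) ≡ u ℚ.* (D ℚ.* x)
      regroup = solve 3 (λ D u x → D :* (u :* x) := u :* (D :* x)) refl

  linearlyIndependent : LinearlyIndependent _≈ᴵ_ value
  linearlyIndependent m i i-injective c vanishes = by-denominator (common-denominator c)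
    where
    by-denominator : CommonDenominator c → ∀ k → c k ≡ 0ℚ
    by-denominator (d , b , b≡) = coefficients-zero i i-injective c vanishes d b b≡

theorem1 : (em : ExcludedMiddle 0ℓ) → LinearlyIndependent _≈ᴵ_ (member em)
theorem1 em = conclude (member em) refl
  where
  transport : ∀ v → v ≡ member em → LinearlyIndependent _≈ᴵ_ v → LinearlyIndependent _≈ᴵ_ (member em)
  transport v refl independent = independent
  conclude : ∀ v → v ≡ member em → LinearlyIndependent _≈ᴵ_ (member em)
  conclude v v≡ = transport v v≡ (Independence.linearlyIndependent em v v≡)
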